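{- Let $\Sigma$ consist of strictly observable first-order constants. The map $Next$ is Scott-continuous from $\Gamma$ to $\mathbf V\Gamma$, where $\Gamma$ is the dcpo of configurations (generalized ISPCF terms) and $Next$ is the one-step probabilistic operational semantics of ISPCF.
   Context: Valuations. Dcpos carry their Scott topology. A continuous valuation on a space $X$ is a Scott-continuous map $\nu\colon\mathcal O X\to\overline{\mathbb R}_+=[0,+\infty]$ with $\nu(\emptyset)=0$, $\nu(U\cup V)+\nu(U\cap V)=\nu(U)+\nu(V)$; $\mathbf V X$ is the dcpo of continuous valuations ordered pointwise; $\delta_x$ is the Dirac valuation; $f[\nu](V)=\nu(f^{ -1}(V))$ is the image valuation. $\mathbf I\mathbb R$ is the dcpo of closed real intervals $[a,b]$ ($a\le b$) ordered by reverse inclusion; $\mathbf I\mathbb R_\bot$ adds a least element $\bot$; a real $a$ is identified with $[a,a]$. For $\mathbf a\in\mathbf I\mathbb R_\bot$, $|\mathbf a|=0$ if $\mathbf a=\bot$ or $\mathbf a=[a,b]$ with $a\le0\le b$; $|[a,b]|=a$ if $a\ge0$; $|[a,b]|=-b$ if $b\le0$. Types and terms of ISPCF. Types: $\sigma,\tau::=\mathbf{unit}\mid\mathbf{void}\mid\mathbf{int}\mid\mathbf{real}\mid\sigma+\tau\mid\sigma\times\tau\mid\sigma\to\tau\mid D\tau$. Basic types: unit, void, int, real. Observable types: $\beta::=\mathbf{unit}\mid\mathbf{void}\mid\mathbf{int}\mid\mathbf{real}\mid\beta_1+\beta_2\mid\beta_1\times\beta_2$. Interpretation of the types needed for constants: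 $[\![\mathbf{unit}]\!]=\{\bot<*\}$, $[\![\mathbf{void}]\!]=\{\bot\}$, $[\![\mathbf{int}]\!]=\mathbb Z_\bot$ (flat), $[\![\mathbf{real}]\!]=\mathbf I\mathbb R_\bot$, $[\![\sigma\times\tau]\!]=[\![\sigma]\!]\times[\![\tau]\!]$, $[\![\sigma+\tau]\!]$ is the coproduct (elements $(1,a)$, $(2,b)$) with an added least element $\bot$, $[\![\sigma\to\tau]\!]$ is the dcpo of Scott-continuous maps, ordered pointwise. Terms: $M,N,P::=x_\sigma\mid\underline f\mid\mathbf{sample}[\mu]\mid\mathbf{score}\,M\mid\lambda x_\sigma.M\mid MN\mid\mathbf{rec}\,M\mid\mathbf{ret}\,M\mid\mathbf{do}\,x_\sigma\leftarrow M;N\mid\langle M,N\rangle\mid\pi_1M\mid\pi_2M\mid\iota_1M\mid\iota_2M\mid\mathbf{case}\,M\,N\,P$, up to renaming of bound variables, where $\underline f$ ranges over a set $\Sigma$ of constants, each with a type and a denotation $f$ in the interpretation of that type, and $\mu$ over a fixed set $\mathcal M$ of (Borel) measures on $\mathbb R$. Typing: $x_\sigma:\sigma$; $\underline f$ has its given type; $\mathbf{rec}\,M:\sigma$ if $M:\sigma\to\sigma$; $\mathbf{sample}[\mu]:D\,\mathbf{real}$; $\mathbf{score}\,M:D\,\mathbf{unit}$ if $M:\mathbf{real}$; $\lambda x_\sigma.M:\sigma\to\tau$ if $M:\tau$; $MN:\tau$ if $M:\sigma\to\tau$, $N:\sigma$; $\mathbf{ret}\,M:D\tau$ if $M:\tau$;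 $\mathbf{do}\,x_\sigma\leftarrow M;N:D\tau$ if $M:D\sigma$, $N:D\tau$; $\langle M,N\rangle:\sigma\times\tau$ if $M:\sigma,N:\tau$; $\pi_1M:\sigma$ and $\pi_2M:\tau$ if $M:\sigma\times\tau$; $\iota_1M:\sigma+\tau$ if $M:\sigma$; $\iota_2M:\sigma+\tau$ if $M:\tau$; $\mathbf{case}\,M\,N\,P:\upsilon$ if $M:\sigma+\tau$, $N:\sigma\to\upsilon$, $P:\tau\to\upsilon$. Only typed terms are considered. $\Sigma$ contains constants $\underline *:\mathbf{unit}$ and $\underline n:\mathbf{int}$ ($n\in\mathbb Z$) with denotations $*$ and $n$. Configurations. A generalized ISPCF term is a closed ISPCF term over constants whose constants of type real are exactly one constant $\underline{\mathbf a}$ (with denotation $\mathbf a$) for each $\mathbf a\in\mathbf I\mathbb R$ (already existing constants $\underline r$, $r \in\mathbb R$, being identified with $\underline{[r,r]}$). Fix an enumeration $x_1,x_2,\ldots$ of "template" variables of type real, leaving infinitely many other variables of type real. A template is a term $M$ whose free variables, read from left to right, are $x_1,\ldots,x_k$ for some $k$ (each occurring once) and which contains no constant of type real. A configuration is a pair $(M,\theta)$ with $M$ a template and $\theta\in\mathbf I\mathbb R^{\mathrm{fv}(M)}$, fv$(M)$ being the set of free variables; it is identified with the generalized ISPCF term $M\theta$ obtained by replacing each $x_i$ by $\underline{\theta(x_i)}$ (a bijection); $M$ is its shape. $\Gamma$ is the set of configurations, ordered by $(M,\theta)\le(N,\theta')$ iff $M=N$ and $\theta\le\theta'$ pointwise;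 it is a dcpo. Observable elements. Observable elements of $[\![\beta]\!]$: for basic $\beta$, all elements except $\bot$; for $\beta_1\times\beta_2$, pairs of observable elements; for $\beta_1+\beta_2$, elements $(1,b)$ or $(2,b)$ with $b$ observable. For observable $a$, $\underline a$ is the term defined by $\underline n,\underline *,\underline{\mathbf a}$ (given constants), $\underline{(a,b)}=\langle\underline a,\underline b\rangle$ (product types), $\underline{(1,a)}=\iota_1\underline a$, $\underline{(2,b)}=\iota_2\underline b$ (sum types). $\Sigma$ consists of strictly observable first-order constants iff each $\underline f\in\Sigma$: has a type $\sigma_1\to\cdots\to\sigma_k\to\tau$ with every $\sigma_i$ basic and $\tau$ observable ($k=\alpha(\underline f)$ is its arity); $f(v_1)\cdots(v_k)$ is always observable or $\bot$, and is $\bot$ if some $v_i=\bot$; and the only constants in $\Sigma$ of observable types are of basic types and have observable denotations. Evaluation contexts. $E::=E^0\mid\mathbf{ret}\,E\mid\langle E,M\rangle\mid\langle V,E\rangle\mid\iota_1E\mid\iota_2E$; weak evaluation contexts $E^0::=[]\mid\mathbf{score}\,E^0\mid E^0N\mid\mathbf{do}\,x\leftarrow E^0;N\mid\underline f\,\underline a_1\cdots\underline a_{i-1}E^0\ (i\le\alpha(\underline f))\mid\mathbf{case}\,E^0NP\mid\pi_1E^0\mid\pi_2E^0$; values $V::=\underline a\mid\lambda x.M\mid\mathbf{ret}\,V\mid\langle V,V\rangle\mid\iota_1V\mid\iota_2V\mid\underline f\,\underline a_1\cdots\underline a_i\ (i<\alpha(\underline f))$, where $\underline a,\underline a_j$ range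 over zero-ary constants of basic types; all are typed, and $E[M]$ is $E$ with hole $[]$ replaced by $M$. The map $Next$. Rules $L\to R$ of the first kind: $E^0[\mathbf{do}\,x\leftarrow\mathbf{ret}\,M;N]\to E^0[N[x:=M]]$; $E[\mathbf{rec}\,M]\to E[M(\mathbf{rec}\,M)]$; $E[(\lambda x.M)N]\to E[M[x:=N]]$; $E[\pi_1\langle M,N\rangle]\to E[M]$; $E[\pi_2\langle M,N\rangle]\to E[N]$; $E[\mathbf{case}(\iota_1M)NP]\to E[NM]$; $E[\mathbf{case}(\iota_2M)NP]\to E[PM]$. $Next\colon\Gamma\to\mathbf V\Gamma$ is defined by: $Next(L)=\delta_R$ for these rules; $Next(E^0[\mathbf{sample}[\mu]])=f_{E^0}[\mu]$ where $f_{E^0}(a)=E^0[\mathbf{ret}\,\underline a]$ for $a\in\mathbb R$ ($\mu$ being viewed as a continuous valuation on $\mathbb R$); $Next(E^0[\mathbf{score}\,\underline{\mathbf a}])=|\mathbf a|\cdot\delta_{E^0[\mathbf{ret}\,\underline *]}$; for $k=\alpha(\underline f)\ne0$, $Next(E[\underline f\,\underline a_1\cdots\underline a_k])=\delta_{E[\underline{f(a_1)\cdots(a_k)}]}$ if $f(a_1)\cdots(a_k)$ is observable, and the zero valuation otherwise; and $Next(M)$ is the zero valuation for every other $M$. (Each term matches at most one case.) -}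

module Defs where

import Algebra.Properties.Group
open import Axiom.ExcludedMiddle using (ExcludedMiddle)
open import Data.Bool.Base using (Bool; true; false; T; not; _∧_; _∨_; if_then_else_)
open import Data.Bool.Properties using (T-∧; T-∨)
open import Data.Empty using (⊥; ⊥-elim)
open import Data.Integer.Base as ℤ using (ℤ; -[1+_])
open import Data.List.Base using (List; []; _∷_; map; cartesianProduct; upTo; _++_)
open import Data.List.Membership.Propositional using () renaming (_∈_ to _∈ˡ_)
open import Data.List.Membership.Propositional.Properties
  using (∈-map⁺; ∈-++⁺ˡ; ∈-++⁺ʳ; ∈-upTo⁺; ∈-cartesianProduct⁺)
open import Data.List.Relation.Unary.Any using (here; there)
open import Data.Nat.Base as ℕ using (ℕ; zero; suc)
import Data.Nat.Properties as ℕ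
open import Data.Product.Base using (∃; ∃-syntax; _×_; _,_; proj₁; proj₂)
open import Data.Product.Relation.Binary.Pointwise.NonDependent using (×-poset)
open import Data.Rational.Base as ℚ using (ℚ; mkℚ; 0ℚ; 1ℚ; _<_; _+_; _*_; -_; _/_)
import Data.Rational.Properties as ℚ
open import Data.Sum.Base using (_⊎_; inj₁; inj₂; [_,_]′)
open import Data.Sum.Relation.Binary.Pointwise using (⊎-poset)
open import Data.Unit.Base using (⊤; tt)
open import Function.Base using (_∘_; id; _|>′_)
open import Function.Bundles using (_⇔_; mk⇔; Equivalence)
open import Level using (0ℓ)
open import Relation.Binary.Bundles using (Poset)
import Relation.Binary.Construct.Add.Infimum.NonStrict as Infimum
import Relation.Binary.Construct.Interior.Symmetric as Symmetric
open Symmetric using (_,_)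
open import Relation.Binary.Definitions using (tri<; tri≈; tri>)
open import Relation.Binary.PropositionalEquality
  using (_≡_; _≢_; refl; sym; trans; cong; cong₂; subst; setoid)
import Relation.Binary.Properties.Setoid as SetoidProperties
open import Relation.Nullary using (¬_; yes; no)
open import Relation.Nullary.Construct.Add.Infimum using (_₋; ⊥₋; [_])
open import Relation.Nullary.Decidable using (⌊_⌋; toWitness; fromWitness)

module ℚ-Group = Algebra.Properties.Group ℚ.+-0-group

-- Subsets are Boolean-valued: under excluded middle this is no
-- restriction, and it makes the powerset of a small set small.

ℙ : Set → Set
ℙ X = X → Bool

infix 4 _∈_ _⊆_ _≐_

_∈_ : {X : Set} → X → ℙ X → Set
x ∈ A = T (A x)

_⊆_ _≐_ : {X : Set} → ℙ X → ℙ X → Set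
A ⊆ B = ∀ x → x ∈ A → x ∈ B
A ≐ B = ∀ x → x ∈ A ⇔ x ∈ B

∅ whole : {X : Set} → ℙ X
∅     _ = false
whole _ = true

infixr 6 _∪_
infixr 7 _∩_
infix  7 _∖_

_∪_ _∩_ _∖_ : {X : Set} → ℙ X → ℙ X → ℙ X
(A ∪ B) x = A x ∨ B x
(A ∩ B) x = A x ∧ B x
(A ∖ B) x = A x ∧ not (B x)

Disjoint : {X : Set} → ℙ X → ℙ X → Set
Disjoint A B = ∀ x → x ∈ A → x ∈ B → ⊥

infix 4 _IsUnionOf_

_IsUnionOf_ : {X I : Set} → ℙ X → (I → ℙ X) → Set
B IsUnionOf A = ∀ x → x ∈ B ⇔ (∃[ i ] x ∈ A i)

open Equivalence using (to; from)

T? : (b : Bool) → T b ⊎ T (not b)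
T? true  = inj₁ tt
T? false = inj₂ tt

T-not : (b : Bool) → T (not b) → T b → ⊥
T-not true ()

Poset₀ : Set₁
Poset₀ = Poset 0ℓ 0ℓ 0ℓ

∣_∣ : Poset₀ → Set
∣ P ∣ = Poset.Carrier P

infix 4 _⊢_≤_ _⊢_≈_

_⊢_≤_ _⊢_≈_ : (P : Poset₀) → ∣ P ∣ → ∣ P ∣ → Set
P ⊢ x ≤ y = Poset._≤_ P x y
P ⊢ x ≈ y = Poset._≈_ P x y

record IsDirected (P : Poset₀) (D : ℙ ∣ P ∣) : Set where
  field
    inhabited : ∃[ x ] x ∈ D
    bounded   : ∀ {x y} → x ∈ D → y ∈ D →
                ∃[ z ] z ∈ D × P ⊢ x ≤ z × P ⊢ y ≤ z

record IsLub (P : Poset₀) {I : Set} (x : I → ∣ P ∣) (s : ∣ P ∣) : Set where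
  field
    upper : ∀ i → P ⊢ x i ≤ s
    least : ∀ t → (∀ i → P ⊢ x i ≤ t) → P ⊢ s ≤ t

members : {X : Set} (D : ℙ X) → ∃ (_∈ D) → X
members D = proj₁

record ScottContinuous (P Q : Poset₀) (f : ∣ P ∣ → ∣ Q ∣) : Set where
  field
    mono          : ∀ {x y} → P ⊢ x ≤ y → Q ⊢ f x ≤ f y
    preserves-lub : ∀ (D : ℙ ∣ P ∣) → IsDirected P D → ∀ {s} →
                    IsLub P (members D) s → IsLub Q (f ∘ members D) (f s)

infixr 5 _⇨_

_⇨_ : Poset₀ → Poset₀ → Poset₀
P ⇨ Q = Symmetric.poset {A = ∃ (ScottContinuous P Q)}
  {R = λ f g → ∀ x → Q ⊢ proj₁ f x ≤ proj₁ g x}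
  (λ x → Poset.refl Q) (λ p q x → Poset.trans Q (p x) (q x))

Lift⊥ : Poset₀ → Poset₀
Lift⊥ P = record { isPartialOrder =
  Infimum.≤₋-isPartialOrder (Poset._≤_ P) (Poset.isPartialOrder P) }

discrete : Set → Poset₀
discrete A = SetoidProperties.≈-poset (setoid A)

IsBottom : (P : Poset₀) → ∣ P ∣ → Set
IsBottom P x = ∀ y → P ⊢ x ≤ y

record Space : Set₁ where
  field
    Point      : Set
    IsOpen     : ℙ Point → Set
    whole-open : IsOpen whole
    ∩-open     : ∀ {U V} → IsOpen U → IsOpen V → IsOpen (U ∩ V)
    ⋃-open     : ∀ {I : Set} (U : I → ℙ Point) → (∀ i → IsOpen (U i)) →
                 ∀ {V} → V IsUnionOf U → IsOpen V

  ∅-open : IsOpen ∅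
  ∅-open = ⋃-open {⊥} (λ ()) (λ ()) (λ x → mk⇔ (λ ()) (λ { (() , _) }))

  ∪-open : ∀ {U V} → IsOpen U → IsOpen V → IsOpen (U ∪ V)
  ∪-open {U} {V} u v = ⋃-open {Bool} (λ b → if b then U else V)
    (λ { true → u ; false → v })
    (λ x → mk⇔ (λ p → [ (true ,_) , (false ,_) ]′ (to T-∨ p))
               (λ { (true , p) → from T-∨ (inj₁ p) ; (false , p) → from T-∨ (inj₂ p) }))

open Space using (Point; IsOpen)

𝒪 : Space → Poset₀
𝒪 X = Symmetric.poset {A = ∃ (IsOpen X)} {R = λ U V → proj₁ U ⊆ proj₁ V}
  (λ x p → p) (λ p q x r → q x (p x r))

∅ₒ : (X : Space) → ∣ 𝒪 X ∣
∅ₒ X = ∅ , Space.∅-open X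

_∪ₒ_ _∩ₒ_ : {X : Space} → ∣ 𝒪 X ∣ → ∣ 𝒪 X ∣ → ∣ 𝒪 X ∣
_∪ₒ_ {X} (U , u) (V , v) = U ∪ V , Space.∪-open X u v
_∩ₒ_ {X} (U , u) (V , v) = U ∩ V , Space.∩-open X u v

Continuous : (X Y : Space) → (Point X → Point Y) → Set
Continuous X Y f = ∀ V → IsOpen Y V → IsOpen X (V ∘ f)

record IsScottOpen (P : Poset₀) (U : ℙ ∣ P ∣) : Set where
  field
    upward       : ∀ {x y} → P ⊢ x ≤ y → x ∈ U → y ∈ U
    inaccessible : ∀ (D : ℙ ∣ P ∣) → IsDirected P D → ∀ {s} →
                   IsLub P (members D) s → s ∈ U → ∃[ x ] x ∈ D × x ∈ U

open IsDirected
open IsLub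
open ScottContinuous
open IsScottOpen

Scott : Poset₀ → Space
Scott P = record
  { Point      = ∣ P ∣
  ; IsOpen     = IsScottOpen P
  ; whole-open = record
    { upward       = λ _ _ → tt
    ; inaccessible = λ D d _ _ → let (x , p) = inhabited d in x , p , tt
    }
  ; ∩-open     = λ {U} {V} u v → record
    { upward       = λ p q → let (a , b) = to T-∧ q in
                     from T-∧ (upward u p a , upward v p b)
    ; inaccessible = λ D d l q →
        let (a , b)               = to T-∧ q
            (x , x∈D , x∈U)       = inaccessible u D d l a
            (y , y∈D , y∈V)       = inaccessible v D d l b
            (z , z∈D , x≤z , y≤z) = bounded d x∈D y∈D
        in z , z∈D , from T-∧ (upward u x≤z x∈U , upward v y≤z y∈V)
    }
  ; ⋃-open     = λ U u {V} e → record
    { upward       = λ p q → let (i , r) = to (e _) q in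
                     from (e _) (i , upward (u i) p r)
    ; inaccessible = λ D d l q →
        let (i , r)         = to (e _) q
            (x , x∈D , x∈U) = inaccessible (u i) D d l r
        in x , x∈D , from (e _) (i , x∈U)
    }
  }

record ℝ : Set where
  field
    L U         : ℙ ℚ
    L-inhabited : ∃[ q ] q ∈ L
    U-inhabited : ∃[ q ] q ∈ U
    L-lower     : ∀ {p q} → p < q → q ∈ L → p ∈ L
    U-upper     : ∀ {p q} → p < q → p ∈ U → q ∈ U
    L-open      : ∀ {q} → q ∈ L → ∃[ r ] q < r × r ∈ L
    U-open      : ∀ {q} → q ∈ U → ∃[ r ] r < q × r ∈ U
    disjoint    : ∀ {q} → q ∈ L → q ∈ U → ⊥
    located     : ∀ {p q} → p < q → p ∈ L ⊎ q ∈ U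

open ℝ

infix 4 _≤ᴿ_

_≤ᴿ_ : ℝ → ℝ → Set
x ≤ᴿ y = L x ⊆ L y

q-1<q : ∀ q → q + - 1ℚ < q
q-1<q q = subst (q + - 1ℚ <_) (ℚ.+-identityʳ q) (ℚ.+-monoʳ-< q (ℚ.*<* ℤ.-<+))

q<q+1 : ∀ q → q < q + 1ℚ
q<q+1 q = subst (_< q + 1ℚ) (ℚ.+-identityʳ q) (ℚ.+-monoʳ-< q (ℚ.*<* (ℤ.+<+ (ℕ.s≤s ℕ.z≤n))))

cmp : ∀ p q → p < q ⊎ q ℚ.≤ p
cmp p q with p ℚ.<? q
... | yes l = inj₁ l
... | no  n = inj₂ (ℚ.≮⇒≥ n)

fromℚ : ℚ → ℝ
fromℚ a = record
  { L           = λ q → ⌊ q ℚ.<? a ⌋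
  ; U           = λ q → ⌊ a ℚ.<? q ⌋
  ; L-inhabited = a + - 1ℚ , fromWitness (q-1<q a)
  ; U-inhabited = a + 1ℚ , fromWitness (q<q+1 a)
  ; L-lower     = λ l m → fromWitness (ℚ.<-trans l (toWitness m))
  ; U-upper     = λ l m → fromWitness (ℚ.<-trans (toWitness m) l)
  ; L-open      = λ m → let (r , l , l′) = ℚ.<-dense (toWitness m) in r , l , fromWitness l′
  ; U-open      = λ m → let (r , l , l′) = ℚ.<-dense (toWitness m) in r , l′ , fromWitness l
  ; disjoint    = λ m m′ → ℚ.<-asym (toWitness m) (toWitness m′)
  ; located     = λ {p} {q} l → [ (λ m → inj₁ (fromWitness m))
                                , (λ m → inj₂ (fromWitness (ℚ.≤-<-trans m l))) ]′ (cmp p a)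
  }

0ᴿ : ℝ
0ᴿ = fromℚ 0ℚ

neg-flip : ∀ {p q} → p < q → - q < - p
neg-flip = ℚ.neg-antimono-<

neg-flipʳ : ∀ {p q} → - p < q → - q < p
neg-flipʳ {p} {q} l = subst (- q <_) (ℚ-Group.⁻¹-involutive p) (neg-flip l)

neg-flipˡ : ∀ {p q} → p < - q → q < - p
neg-flipˡ {p} {q} l = subst (_< - p) (ℚ-Group.⁻¹-involutive q) (neg-flip l)

-ᴿ_ : ℝ → ℝ
-ᴿ x = record
  { L           = λ q → U x (- q)
  ; U           = λ q → L x (- q)
  ; L-inhabited = let (q , m) = U-inhabited x in - q , subst (_∈ U x) (sym (ℚ-Group.⁻¹-involutive q)) m
  ; U-inhabited = let (q , m) = L-inhabited x in - q , subst (_∈ L x) (sym (ℚ-Group.⁻¹-involutive q)) m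
  ; L-lower     = λ l → U-upper x (neg-flip l)
  ; U-upper     = λ l → L-lower x (neg-flip l)
  ; L-open      = λ m → let (r , l , m′) = U-open x m in
                  - r , neg-flipˡ l , subst (_∈ U x) (sym (ℚ-Group.⁻¹-involutive r)) m′
  ; U-open      = λ m → let (r , l , m′) = L-open x m in
                  - r , neg-flipʳ l , subst (_∈ L x) (sym (ℚ-Group.⁻¹-involutive r)) m′
  ; disjoint    = λ m m′ → disjoint x m′ m
  ; located     = λ l → [ inj₂ , inj₁ ]′ (located x (neg-flip l))
  }

L-lower≤ : ∀ x {p q} → p ℚ.≤ q → q ∈ L x → p ∈ L x
L-lower≤ x {p} {q} l m with cmp p q
... | inj₁ l′ = L-lower x l′ m
... | inj₂ l′ = subst (_∈ L x) (ℚ.≤-antisym l′ l) m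

U-upper≤ : ∀ x {p q} → p ℚ.≤ q → p ∈ U x → q ∈ U x
U-upper≤ x {p} {q} l m with cmp p q
... | inj₁ l′ = U-upper x l′ m
... | inj₂ l′ = subst (_∈ U x) (ℚ.≤-antisym l l′) m

L<U : ∀ x {p q} → p ∈ L x → q ∈ U x → p < q
L<U x {p} {q} m m′ with cmp p q
... | inj₁ l = l
... | inj₂ l = ⊥-elim (disjoint x (L-lower≤ x l m) m′)

_∈⟨_,_⟩ : ℝ → ℚ → ℚ → Set
x ∈⟨ p , q ⟩ = p ∈ L x × q ∈ U x

IsOpenᴿ : ℙ ℝ → Set
IsOpenᴿ A = ∀ x → x ∈ A → ∃[ p ] ∃[ q ] x ∈⟨ p , q ⟩ × (∀ y → y ∈⟨ p , q ⟩ → y ∈ A)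

max-L : ∀ p p′ → ∃[ m ] p ℚ.≤ m × p′ ℚ.≤ m × (∀ x → p ∈ L x → p′ ∈ L x → m ∈ L x)
max-L p p′ with ℚ.≤-total p p′
... | inj₁ l = p′ , l , ℚ.≤-refl , λ _ _ m → m
... | inj₂ l = p , ℚ.≤-refl , l , λ _ m _ → m

min-U : ∀ q q′ → ∃[ m ] m ℚ.≤ q × m ℚ.≤ q′ × (∀ x → q ∈ U x → q′ ∈ U x → m ∈ U x)
min-U q q′ with ℚ.≤-total q q′
... | inj₁ l = q , ℚ.≤-refl , l , λ _ m _ → m
... | inj₂ l = q′ , l , ℚ.≤-refl , λ _ _ m → m

ℝ-space : Space
ℝ-space = record
  { Point      = ℝ
  ; IsOpen     = IsOpenᴿ
  ; whole-open = λ x _ → let (p , l) = L-inhabited x ; (q , u) = U-inhabited x in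
                 p , q , (l , u) , λ _ _ → tt
  ; ∩-open     = λ u v x m →
      let (a , b)                   = to T-∧ m
          (p  , q  , (l  , r ) , s) = u x a
          (p′ , q′ , (l′ , r′) , t) = v x b
          (m₁ , p≤ , p′≤ , in₁)     = max-L p p′
          (m₂ , ≤q , ≤q′ , in₂)     = min-U q q′
      in m₁ , m₂ , (in₁ x l l′ , in₂ x r r′) , λ { y (h , k) →
           from T-∧ ( s y (L-lower≤ y p≤ h , U-upper≤ y ≤q k)
                    , t y (L-lower≤ y p′≤ h , U-upper≤ y ≤q′ k)) }
  ; ⋃-open     = λ U u e x m →
      let (i , k)         = to (e x) m
          (p , q , h , s) = u i x k
      in p , q , h , λ y z → from (e y) (i , s y z)
  }

record Interval : Set where
  constructor ⟦_,_∣_⟧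
  field
    lo hi : ℝ
    lo≤hi : lo ≤ᴿ hi

open Interval

𝐈ℝ : Poset₀
𝐈ℝ = Symmetric.poset {A = Interval} {R = λ 𝐚 𝐛 → lo 𝐚 ≤ᴿ lo 𝐛 × hi 𝐛 ≤ᴿ hi 𝐚}
  ((λ _ m → m) , (λ _ m → m))
  (λ { (a , b) (c , d) → (λ q m → c q (a q m)) , (λ q m → b q (d q m)) })

singleton : ℝ → Interval
singleton x = ⟦ x , x ∣ (λ _ m → m) ⟧

-- [0,+∞]: an element is given by the rationals strictly below it, so that
-- +∞ is the whole of ℚ.
record ℝ̄₊ : Set where
  field
    below   : ℙ ℚ
    ≥0      : ∀ {q} → q < 0ℚ → q ∈ below
    lower   : ∀ {p q} → p < q → q ∈ below → p ∈ below
    rounded : ∀ {q} → q ∈ below → ∃[ r ] q < r × r ∈ below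

open ℝ̄₊

ℝ̄₊-poset : Poset₀
ℝ̄₊-poset = Symmetric.poset {A = ℝ̄₊} {R = λ x y → below x ⊆ below y}
  (λ _ m → m) (λ a b q m → b q (a q m))

fromℝ : (x : ℝ) → 0ᴿ ≤ᴿ x → ℝ̄₊
fromℝ x 0≤x = record
  { below   = L x
  ; ≥0      = λ l → 0≤x _ (fromWitness l)
  ; lower   = L-lower x
  ; rounded = L-open x
  }

0⁺ 1⁺ : ℝ̄₊
0⁺ = fromℝ 0ᴿ (λ _ m → m)
1⁺ = fromℝ (fromℚ 1ℚ) (λ _ m → fromWitness (ℚ.<-trans (toWitness m) (ℚ.*<* (ℤ.+<+ (ℕ.s≤s ℕ.z≤n)))))

0⁺-least : ∀ x → ℝ̄₊-poset ⊢ 0⁺ ≤ x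
0⁺-least x q m = ≥0 x (toWitness m)

shrinkʳ : ∀ q r s → q < r + s → ∃[ t ] t < s × q < r + t
shrinkʳ q r s l =
  let (t , i , j) = ℚ.<-dense {(- r) + q} {s}
        (subst ((- r) + q <_) (ℚ-Group.\\-leftDividesʳ r s) (ℚ.+-monoʳ-< (- r) l))
  in t , j , subst (_< r + t) (ℚ-Group.\\-leftDividesˡ r q) (ℚ.+-monoʳ-< r i)

shrink₀ : ∀ q r → q < r → ∃[ t ] t < 0ℚ × q < r + t
shrink₀ q r l = shrinkʳ q r 0ℚ (subst (q <_) (sym (ℚ.+-identityʳ r)) l)

-- Excluded middle is used to form subsets by comprehension (⌜_⌝), in the
-- case distinction defining ∣_∣⁺, and to decide whether a rule applies in
-- Next.
module Classical (lem : ExcludedMiddle 0ℓ) where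

  ⌜_⌝ : Set → Bool
  ⌜ P ⌝ = ⌊ lem {P} ⌋

  holds : ∀ {P} → P → T ⌜ P ⌝
  holds = fromWitness

  held : ∀ {P} → T ⌜ P ⌝ → P
  held = toWitness

  infixl 6 _+⁺_
  infixl 7 _·⁺_

  _+⁺_ : ℝ̄₊ → ℝ̄₊ → ℝ̄₊
  x +⁺ y = record
    { below   = λ q → ⌜ ∃[ r ] ∃[ s ] r ∈ below x × s ∈ below y × q < r + s ⌝
    ; ≥0      = λ {q} l →
        let (r , q<r , r<0) = ℚ.<-dense l
            (s , s<0 , h)   = shrink₀ q r q<r
        in holds (r , s , ≥0 x r<0 , ≥0 y s<0 , h)
    ; lower   = λ l m → let (r , s , a , b , h) = held m in
                holds (r , s , a , b , ℚ.<-trans l h)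
    ; rounded = λ m → let (r , s , a , b , h) = held m
                          (t , l , l′)        = ℚ.<-dense h
                      in t , l , holds (r , s , a , b , l′)
    }

  -- The second disjunct is empty when x or y is 0, so 0 · ∞ = 0.
  _·⁺_ : ℝ̄₊ → ℝ̄₊ → ℝ̄₊
  x ·⁺ y = record
    { below   = λ q → ⌜ (q < 0ℚ) ⊎ (∃[ r ] ∃[ s ] 0ℚ < r × 0ℚ < s ×
                         r ∈ below x × s ∈ below y × q < r * s) ⌝
    ; ≥0      = λ l → holds (inj₁ l)
    ; lower   = λ l m → [ (λ h → holds (inj₁ (ℚ.<-trans l h)))
                        , (λ { (r , s , i , j , a , b , h) →
                             holds (inj₂ (r , s , i , j , a , b , ℚ.<-trans l h)) }) ]′ (held m)
    ; rounded = λ m → [ (λ h → let (t , l , l′) = ℚ.<-dense h in t , l , holds (inj₁ l′))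
                      , (λ { (r , s , i , j , a , b , h) →
                           let (t , l , l′) = ℚ.<-dense h in
                           t , l , holds (inj₂ (r , s , i , j , a , b , l′)) }) ]′ (held m)
    }

  ∑ : (ℕ → ℝ̄₊) → ℕ → ℝ̄₊
  ∑ f zero    = 0⁺
  ∑ f (suc n) = ∑ f n +⁺ f n

  private
    module E = Poset ℝ̄₊-poset

    infix 4 _≤⁺_ _≈⁺_
    _≤⁺_ _≈⁺_ : ℝ̄₊ → ℝ̄₊ → Set
    _≤⁺_ = E._≤_
    _≈⁺_ = E._≈_

    open Symmetric.SymInterior using () renaming (lhs≤rhs to fst; rhs≤lhs to snd)

  +⁺-mono : ∀ {x x′ y y′} → x ≤⁺ x′ → y ≤⁺ y′ → x +⁺ y ≤⁺ x′ +⁺ y′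
  +⁺-mono f g q m = let (r , s , a , b , h) = held m in holds (r , s , f r a , g s b , h)

  +⁺-cong : ∀ {x x′ y y′} → x ≈⁺ x′ → y ≈⁺ y′ → x +⁺ y ≈⁺ x′ +⁺ y′
  +⁺-cong {x} {x′} {y} {y′} (f , f′) (g , g′) =
    +⁺-mono {x} {x′} {y} {y′} f g , +⁺-mono {x′} {x} {y′} {y} f′ g′

  +⁺-comm≤ : ∀ x y → x +⁺ y ≤⁺ y +⁺ x
  +⁺-comm≤ x y q m = let (r , s , a , b , h) = held m in
    holds (s , r , b , a , subst (q <_) (ℚ.+-comm r s) h)

  +⁺-comm : ∀ x y → x +⁺ y ≈⁺ y +⁺ x
  +⁺-comm x y = +⁺-comm≤ x y , +⁺-comm≤ y x

  +⁺-assoc≤ : ∀ x y z → (x +⁺ y) +⁺ z ≤⁺ x +⁺ (y +⁺ z)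
  +⁺-assoc≤ x y z q m =
    let (u , t , c , d , h) = held m
        (r , s , a , b , k) = held c
        h′ : q < r + (s + t)
        h′ = subst (q <_) (ℚ.+-assoc r s t) (ℚ.<-trans h (ℚ.+-monoˡ-< t k))
        (v , i , j)         = shrinkʳ q r (s + t) h′
    in holds (r , v , a , holds (s , t , b , d , i) , j)

  +⁺-assoc≥ : ∀ x y z → x +⁺ (y +⁺ z) ≤⁺ (x +⁺ y) +⁺ z
  +⁺-assoc≥ x y z q m =
    +⁺-comm≤ z (x +⁺ y) q (+⁺-assoc≤ z x y q (+⁺-comm≤ y (z +⁺ x) q
      (+⁺-assoc≤ y z x q (+⁺-comm≤ x (y +⁺ z) q m))))

  +⁺-identityʳ : ∀ x → x +⁺ 0⁺ ≈⁺ x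
  +⁺-identityʳ x = below⊆ , ⊆below
    where
    below⊆ : x +⁺ 0⁺ ≤⁺ x
    below⊆ q m = let (r , s , a , b , h) = held m in
      lower x (ℚ.<-trans h (subst (r + s <_) (ℚ.+-identityʳ r) (ℚ.+-monoʳ-< r (toWitness b)))) a
    ⊆below : x ≤⁺ x +⁺ 0⁺
    ⊆below q m =
      let (r , l , m′) = rounded x m
          (s , i , j)  = shrink₀ q r l
      in holds (r , s , m′ , fromWitness i , j)

  +⁺-identityˡ : ∀ x → 0⁺ +⁺ x ≈⁺ x
  +⁺-identityˡ x = E.Eq.trans {0⁺ +⁺ x} {x +⁺ 0⁺} {x} (+⁺-comm 0⁺ x) (+⁺-identityʳ x)

  record ContinuousValuation (X : Space) : Set where
    field
      value      : ∣ 𝒪 X ∣ → ℝ̄₊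
      continuous : ScottContinuous (𝒪 X) ℝ̄₊-poset value
      strict     : value (∅ₒ X) ≈⁺ 0⁺
      modular    : ∀ U V → value (_∪ₒ_ {X} U V) +⁺ value (_∩ₒ_ {X} U V) ≈⁺ value U +⁺ value V

  open ContinuousValuation

  𝐕 : Space → Poset₀
  𝐕 X = Symmetric.poset {A = ContinuousValuation X}
    {R = λ ν ξ → ∀ U → value ν U ≤⁺ value ξ U}
    (λ _ _ m → m) (λ p q U r m → q U r (p U r m))

  lub-is-union : (X : Space) (D : ℙ ∣ 𝒪 X ∣) {s : ∣ 𝒪 X ∣} → IsLub (𝒪 X) (members D) s →
                 proj₁ s IsUnionOf (λ (U : ∃ (_∈ D)) → proj₁ (proj₁ U))
  lub-is-union X D l x = mk⇔ (λ m → held (least l W (λ i y m′ → holds (i , m′)) x m))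
                             (λ { (i , m) → upper l i x m })
    where
    W : ∣ 𝒪 X ∣
    W = (λ x → ⌜ (∃[ U ] x ∈ proj₁ (members D U)) ⌝)
      , Space.⋃-open X (λ U → proj₁ (members D U)) (λ U → proj₂ (members D U))
          (λ x → mk⇔ held holds)

  module _ {X : Space} where

    -- U ↦ w (x ∈ U).
    pointMass : (w : Bool → ℝ̄₊) → w false ≤⁺ 0⁺ → Point X → ContinuousValuation X
    pointMass w w≤0 x = record
      { value      = λ U → w (proj₁ U x)
      ; continuous = record
        { mono          = λ {U} {V} p → mono-w (proj₁ U x) (proj₁ V x) (p x)
        ; preserves-lub = λ D d {s} l → record
          { upper = λ i → mono-w (proj₁ (members D i) x) (proj₁ s x) (upper l i x)
          ; least = λ t b → least-w D s l t b (proj₁ s x) refl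
          }
        }
      ; strict     = w≤0 , 0⁺-least (w false)
      ; modular    = λ U V → modular-w (proj₁ U x) (proj₁ V x)
      }
      where
      w≤ : ∀ y → w false ≤⁺ y
      w≤ y = E.trans {w false} {0⁺} {y} w≤0 (0⁺-least y)
      mono-w : ∀ a b → (T a → T b) → w a ≤⁺ w b
      mono-w false b     _ = w≤ (w b)
      mono-w true  true  _ = λ _ m → m
      mono-w true  false p = ⊥-elim (p tt)
      modular-w : ∀ a b → w (a ∨ b) +⁺ w (a ∧ b) ≈⁺ w a +⁺ w b
      modular-w true  true  = (λ _ m → m) , (λ _ m → m)
      modular-w true  false = (λ _ m → m) , (λ _ m → m)
      modular-w false true  = +⁺-comm (w true) (w false)
      modular-w false false = (λ _ m → m) , (λ _ m → m)
      least-w : ∀ D s → IsLub (𝒪 X) (members D) s → ∀ t →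
                (∀ i → w (proj₁ (members D i) x) ≤⁺ t) → ∀ b → proj₁ s x ≡ b → w b ≤⁺ t
      least-w D s l t h false e = w≤ t
      least-w D s l t h true  e =
        let (i , m) = to (lub-is-union X D {s} l x) (subst T (sym e) tt) in
        E.trans {w true} {w (proj₁ (members D i) x)} {t}
          (mono-w true (proj₁ (members D i) x) (λ _ → m)) (h i)

    indicator : Bool → ℝ̄₊
    indicator b = if b then 1⁺ else 0⁺

    δ : Point X → ContinuousValuation X
    δ = pointMass indicator (λ _ m → m)

    _·δ_ : ℝ̄₊ → Point X → ContinuousValuation X
    c ·δ x = pointMass (λ b → c ·⁺ indicator b) ≤0 x
      where
      ≤0 : c ·⁺ 0⁺ ≤⁺ 0⁺
      ≤0 q m = [ fromWitness
               , (λ { (r , s , _ , 0<s , _ , s<0 , _) →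
                    ⊥-elim (ℚ.<-asym 0<s (toWitness s<0)) }) ]′ (held m)

    𝟎 : ContinuousValuation X
    𝟎 = record
      { value      = λ _ → 0⁺
      ; continuous = record
        { mono          = λ _ _ m → m
        ; preserves-lub = λ D d l → record
          { upper = λ _ _ m → m
          ; least = λ t _ → 0⁺-least t
          }
        }
      ; strict     = E.Eq.refl {0⁺}
      ; modular    = λ _ _ → E.Eq.refl {0⁺ +⁺ 0⁺}
      }

  module _ {X Y : Space} (f : Point X → Point Y) (c : Continuous X Y f) where

    preimage : ∣ 𝒪 Y ∣ → ∣ 𝒪 X ∣
    preimage (V , v) = V ∘ f , c V v

    image : ContinuousValuation X → ContinuousValuation Y
    image ν = record
      { value      = λ V → value ν (preimage V)
      ; continuous = record
        { mono          = λ {U} {V} p → mono-ν U V p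
        ; preserves-lub = λ D d {s} l → record
          { upper = λ { (V , V∈D) → mono-ν V s (upper l (V , V∈D)) }
          ; least = λ t b → least (preserves-lub (continuous ν) (pre D) (pre-directed D d) {preimage s} (pre-lub D s l)) t
              (λ { (U , m) → let (V , V∈D , p) = held m in
                   E.trans {value ν U} {value ν (preimage V)} {t}
                     (subst (λ W → value ν W ≤⁺ value ν (preimage V)) p (λ _ m → m)) (b (V , V∈D)) })
          }
        }
      ; strict     = E.Eq.trans {value ν (preimage (∅ₒ Y))} {value ν (∅ₒ X)} {0⁺}
          (same (preimage (∅ₒ Y)) (∅ₒ X) (λ _ m → m) (λ _ m → m)) (strict ν)
      ; modular    = λ U V → E.Eq.trans
          {value ν (preimage (_∪ₒ_ {Y} U V)) +⁺ value ν (preimage (_∩ₒ_ {Y} U V))}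
          {value ν (_∪ₒ_ {X} (preimage U) (preimage V)) +⁺ value ν (_∩ₒ_ {X} (preimage U) (preimage V))}
          (+⁺-cong (same (preimage (_∪ₒ_ {Y} U V)) (_∪ₒ_ {X} (preimage U) (preimage V)) (λ _ m → m) (λ _ m → m))
                   (same (preimage (_∩ₒ_ {Y} U V)) (_∩ₒ_ {X} (preimage U) (preimage V)) (λ _ m → m) (λ _ m → m)))
          (modular ν (preimage U) (preimage V))
      }
      where
      same : ∀ U V → proj₁ U ⊆ proj₁ V → proj₁ V ⊆ proj₁ U → value ν U ≈⁺ value ν V
      same U V p q = mono (continuous ν) {U} {V} p , mono (continuous ν) {V} {U} q
      mono-ν : ∀ U V → proj₁ U ⊆ proj₁ V → value ν (preimage U) ≤⁺ value ν (preimage V)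
      mono-ν U V p = mono (continuous ν) {preimage U} {preimage V} (λ x → p (f x))
      pre : ℙ ∣ 𝒪 Y ∣ → ℙ ∣ 𝒪 X ∣
      pre D U = ⌜ (∃[ V ] V ∈ D × preimage V ≡ U) ⌝
      pre-directed : ∀ D → IsDirected (𝒪 Y) D → IsDirected (𝒪 X) (pre D)
      pre-directed D d = record
        { inhabited = let (V , m) = inhabited d in preimage V , holds (V , m , refl)
        ; bounded   = λ p q → bnd (held p) (held q)
        }
        where
        bnd : ∀ {U U′} → ∃[ V ] V ∈ D × preimage V ≡ U → ∃[ V ] V ∈ D × preimage V ≡ U′ →
              ∃[ W ] W ∈ pre D × proj₁ U ⊆ proj₁ W × proj₁ U′ ⊆ proj₁ W
        bnd (V , m , refl) (V′ , m′ , refl) =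
          let (W , k , a , b) = bounded d m m′ in
          preimage W , holds (W , k , refl) , (λ x → a (f x)) , (λ x → b (f x))
      pre-lub : ∀ D s → IsLub (𝒪 Y) (members D) s → IsLub (𝒪 X) (members (pre D)) (preimage s)
      pre-lub D s l = record
        { upper = λ { (U , m) x k → up U (held m) x k }
        ; least = λ t b x m →
            let ((V , V∈D) , k) = to (lub-is-union Y D {s} l (f x)) m in
            b (preimage V , holds (V , V∈D , refl)) x k
        }
        where
        up : ∀ U → ∃[ V ] V ∈ D × preimage V ≡ U → proj₁ U ⊆ proj₁ (preimage s)
        up U (V , V∈D , refl) x k = upper l (V , V∈D) (f x) k


  data Borel : ℙ ℝ → Set where
    opens       : ∀ {A} → IsOpenᴿ A → Borel A
    complements : ∀ {A B} → Borel A → (∀ x → x ∈ B ⇔ (¬ x ∈ A)) → Borel B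
    unions      : ∀ (A : ℕ → ℙ ℝ) {B} → (∀ n → Borel (A n)) → B IsUnionOf A → Borel B

  record BorelMeasure : Set where
    field
      measure     : ∃ Borel → ℝ̄₊
      extensional : ∀ A B → proj₁ A ≐ proj₁ B → measure A ≈⁺ measure B
      null-empty  : ∀ b → measure (∅ , b) ≈⁺ 0⁺
      σ-additive  : ∀ (A : ℕ → ∃ Borel) →
                    (∀ {m n} → m ≢ n → Disjoint (proj₁ (A m)) (proj₁ (A n))) →
                    ∀ B → proj₁ B IsUnionOf (proj₁ ∘ A) →
                    IsLub ℝ̄₊-poset (∑ (measure ∘ A)) (measure B)

  borel-∪ : ∀ {A B} → Borel A → Borel B → Borel (A ∪ B)
  borel-∪ {A} {B} a b = unions (λ { zero → A ; (suc _) → B }) (λ { zero → a ; (suc _) → b })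
    (λ x → mk⇔ (λ m → [ (zero ,_) , (suc zero ,_) ]′ (to T-∨ m))
               (λ { (zero , m) → from T-∨ (inj₁ m) ; (suc _ , m) → from T-∨ (inj₂ m) }))

  borel-∖ : ∀ {A B} → Borel A → Borel B → Borel (A ∖ B)
  borel-∖ {A} {B} a b = complements
    (borel-∪ (complements {A} {not ∘ A} a (λ x → mk⇔ (T-not (A x)) (not-T (A x)))) b)
    (λ x → char (A x) (B x))
    where
    not-T : ∀ c → ¬ T c → T (not c)
    not-T true  n = ⊥-elim (n tt)
    not-T false n = tt
    char : ∀ c d → T (c ∧ not d) ⇔ (¬ T (not c ∨ d))
    char true  true  = mk⇔ (λ ()) (λ n → n tt)
    char true  false = mk⇔ (λ _ ()) (λ _ → tt)
    char false _     = mk⇔ (λ ()) (λ n → n tt)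

  -- The restriction of a Borel measure to the open sets is Scott-continuous
  -- because every open set is a union of open intervals with endpoints in
  -- the countable set ℚ.

  private
    fractions : ℕ → List ℚ
    fractions n = map (λ { (i , d) → i / suc d })
      (cartesianProduct (map ℤ.+_ (upTo n) ++ map -[1+_] (upTo n)) (upTo n))

    size : ℚ → ℕ
    size r = suc (ℤ.∣ ℚ.numerator r ∣ ℕ.+ ℚ.denominator-1 r)

    ∈-fractions : ∀ r n → size r ℕ.≤ n → r ∈ˡ fractions n
    ∈-fractions r@(mkℚ i d _) n l = subst (_∈ˡ fractions n) (ℚ.↥p/↧p≡p r)
      (∈-map⁺ (λ { (i , d) → i / suc d })
        (∈-cartesianProduct⁺ (∈-numerators i (ℕ.≤-trans (ℕ.s≤s (ℕ.m≤m+n ℤ.∣ i ∣ d)) l))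
                             (∈-upTo⁺ (ℕ.≤-trans (ℕ.s≤s (ℕ.m≤n+m d ℤ.∣ i ∣)) l))))
      where
      ∈-numerators : ∀ i → ℤ.∣ i ∣ ℕ.< n → i ∈ˡ map ℤ.+_ (upTo n) ++ map -[1+_] (upTo n)
      ∈-numerators (ℤ.+ k)  k<n = ∈-++⁺ˡ (∈-map⁺ ℤ.+_ (∈-upTo⁺ k<n))
      ∈-numerators -[1+ k ] k<n = ∈-++⁺ʳ (map ℤ.+_ (upTo n))
        (∈-map⁺ -[1+_] (∈-upTo⁺ (ℕ.<-trans (ℕ.n<1+n k) k<n)))

    pairs : ℕ → List (ℚ × ℚ)
    pairs zero    = []
    pairs (suc n) = pairs n ++ cartesianProduct (fractions n) (fractions n)

    all-pairs : ∀ p q → ∃[ n ] (p , q) ∈ˡ pairs n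
    all-pairs p q = suc n , ∈-++⁺ʳ (pairs n)
      (∈-cartesianProduct⁺ (∈-fractions p n (ℕ.m≤m+n (size p) (size q)))
                           (∈-fractions q n (ℕ.m≤n+m (size q) (size p))))
      where n = size p ℕ.+ size q

  module _ (M : BorelMeasure) where

    open BorelMeasure M

    private
      additive : ∀ A B C → Disjoint (proj₁ A) (proj₁ B) → proj₁ C ≐ proj₁ A ∪ proj₁ B →
                 measure C ≈⁺ measure A +⁺ measure B
      additive A B C disj e = least lub (measure A +⁺ measure B) bound
                            , λ q m → upper lub 2 q (+⁺-mono {measure A} {0⁺ +⁺ measure A} {measure B} {measure B}
                                (snd (+⁺-identityˡ (measure A))) (λ _ m → m) q m)
        where
        Z : ∃ Borel
        Z = ∅ , opens (λ _ ())
        S : ℕ → ∃ Borel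
        S zero          = A
        S (suc zero)    = B
        S (suc (suc _)) = Z
        S-disjoint : ∀ m n → m ≢ n → Disjoint (proj₁ (S m)) (proj₁ (S n))
        S-disjoint zero          zero          m≢n _ _ _ = m≢n refl
        S-disjoint zero          (suc zero)    _         = disj
        S-disjoint (suc zero)    zero          _   x a b = disj x b a
        S-disjoint (suc zero)    (suc zero)    m≢n _ _ _ = m≢n refl
        S-disjoint (suc (suc _)) _             _ _ ()
        S-disjoint zero          (suc (suc _)) _ _ _ ()
        S-disjoint (suc zero)    (suc (suc _)) _ _ _ ()
        lub : IsLub ℝ̄₊-poset (∑ (measure ∘ S)) (measure C)
        lub = σ-additive S (λ {m} {n} → S-disjoint m n) C (λ x → mk⇔
          (λ m → [ (zero ,_) , (suc zero ,_) ]′ (to T-∨ (to (e x) m)))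
          (λ { (zero , m) → from (e x) (from T-∨ (inj₁ m))
             ; (suc zero , m) → from (e x) (from T-∨ (inj₂ m)) }))
        bound : ∀ n → ∑ (measure ∘ S) n ≤⁺ measure A +⁺ measure B
        bound zero                q m = 0⁺-least (measure A +⁺ measure B) q m
        bound (suc zero)          q m =
          fst (+⁺-identityʳ (measure A +⁺ measure B)) q
            (+⁺-mono {0⁺ +⁺ measure A} {measure A +⁺ measure B} {0⁺} {0⁺}
              (λ r k → +⁺-comm≤ (measure B) (measure A) r
                (+⁺-mono {0⁺} {measure B} {measure A} {measure A} (0⁺-least (measure B)) (λ _ k → k) r k))
              (λ _ k → k) q
              (snd (+⁺-identityʳ (0⁺ +⁺ measure A)) q m))
        bound (suc (suc zero))    q m =
          +⁺-mono {0⁺ +⁺ measure A} {measure A} {measure B} {measure B}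
            (fst (+⁺-identityˡ (measure A))) (λ _ k → k) q m
        bound (suc (suc (suc n))) q m = bound (suc (suc n)) q
          (fst (+⁺-identityʳ (∑ (measure ∘ S) (suc (suc n)))) q
            (+⁺-mono {∑ (measure ∘ S) (suc (suc n))} {∑ (measure ∘ S) (suc (suc n))} {measure Z} {0⁺}
              (λ _ k → k) (fst (null-empty (proj₂ Z))) q m))

      split : ∀ A B → proj₁ A ⊆ proj₁ B →
              measure B ≈⁺ measure A +⁺ measure (proj₁ B ∖ proj₁ A , borel-∖ (proj₂ B) (proj₂ A))
      split A B A⊆B = additive A (proj₁ B ∖ proj₁ A , borel-∖ (proj₂ B) (proj₂ A)) B
        (λ x a b → T-not (proj₁ A x) (proj₂ (to T-∧ b)) a)
        (λ x → mk⇔ (λ b → from T-∨ ([ inj₁ , (λ n → inj₂ (from T-∧ (b , n))) ]′ (T? (proj₁ A x))))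
                   (λ m → [ A⊆B x , (λ n → proj₁ (to T-∧ n)) ]′ (to T-∨ m)))

      monotone : ∀ A B → proj₁ A ⊆ proj₁ B → measure A ≤⁺ measure B
      monotone A B A⊆B q m = snd (split A B A⊆B) q
        (+⁺-mono {measure A} {measure A} {0⁺} {rest} (λ _ k → k) (0⁺-least rest) q
          (snd (+⁺-identityʳ (measure A)) q m))
        where rest = measure (proj₁ B ∖ proj₁ A , borel-∖ (proj₂ B) (proj₂ A))

      increasing : ∀ (B : ℕ → ∃ Borel) → (∀ n → proj₁ (B n) ⊆ proj₁ (B (suc n))) →
                   ∀ C → proj₁ C IsUnionOf (proj₁ ∘ B) →
                   ∀ t → (∀ n → measure (B n) ≤⁺ t) → measure C ≤⁺ t
      increasing B step C e t h = least (σ-additive A (λ {m} {n} → A-disjoint m n) C union) t bound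
        where
        A : ℕ → ∃ Borel
        A zero    = B zero
        A (suc n) = proj₁ (B (suc n)) ∖ proj₁ (B n) , borel-∖ (proj₂ (B (suc n))) (proj₂ (B n))
        A⊆B : ∀ n → proj₁ (A n) ⊆ proj₁ (B n)
        A⊆B zero    x m = m
        A⊆B (suc n) x m = proj₁ (to T-∧ m)
        B-mono : ∀ {m n} → m ℕ.≤′ n → proj₁ (B m) ⊆ proj₁ (B n)
        B-mono ℕ.≤′-refl     x k = k
        B-mono (ℕ.≤′-step l) x k = step _ x (B-mono l x k)
        apart : ∀ {m n} → m ℕ.< n → Disjoint (proj₁ (A m)) (proj₁ (A n))
        apart {m} {suc n} (ℕ.s≤s l) x a b =
          T-not (proj₁ (B n) x) (proj₂ (to (T-∧ {proj₁ (B (suc n)) x}) b)) (B-mono (ℕ.≤⇒≤′ l) x (A⊆B m x a))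
        A-disjoint : ∀ m n → m ≢ n → Disjoint (proj₁ (A m)) (proj₁ (A n))
        A-disjoint m n m≢n x a b with ℕ.<-cmp m n
        ... | tri< l _ _ = apart l x a b
        ... | tri≈ _ p _ = m≢n p
        ... | tri> _ _ l = apart l x b a
        find : ∀ n x → x ∈ proj₁ (B n) → ∃[ m ] x ∈ proj₁ (A m)
        find zero    x m = zero , m
        find (suc n) x m = [ find n x , (λ k → suc n , from T-∧ (m , k)) ]′ (T? (proj₁ (B n) x))
        union : proj₁ C IsUnionOf (proj₁ ∘ A)
        union x = mk⇔ (λ m → let (n , k) = to (e x) m in find n x k)
                      (λ { (n , k) → from (e x) (n , A⊆B n x k) })
        sums : ∀ n → ∑ (measure ∘ A) (suc n) ≤⁺ measure (B n)
        sums zero    = fst (+⁺-identityˡ (measure (B zero)))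
        sums (suc n) q m = snd (split (B n) (B (suc n)) (step n)) q
          (+⁺-mono {∑ (measure ∘ A) (suc n)} {measure (B n)} {measure (A (suc n))} {measure (A (suc n))}
            (sums n) (λ _ k → k) q m)
        bound : ∀ n → ∑ (measure ∘ A) n ≤⁺ t
        bound zero        = 0⁺-least t
        bound (suc n) q m = h n q (sums n q m)

      asBorel : ∣ 𝒪 ℝ-space ∣ → ∃ Borel
      asBorel (U , u) = U , opens u

      module Approximation (D : ℙ ∣ 𝒪 ℝ-space ∣) (d : IsDirected (𝒪 ℝ-space) D)
                           {s : ∣ 𝒪 ℝ-space ∣} (l : IsLub (𝒪 ℝ-space) (members D) s) where

        Inside : ℚ × ℚ → ∣ 𝒪 ℝ-space ∣ → Set
        Inside (p , q) U = ∀ y → y ∈⟨ p , q ⟩ → y ∈ proj₁ U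

        Good : ℚ × ℚ → Set
        Good I = ∃[ U ] U ∈ D × Inside I U

        InUnion : List (ℚ × ℚ) → ℝ → Set
        InUnion Is x = ∃[ I ] I ∈ˡ Is × Good I × x ∈⟨ proj₁ I , proj₂ I ⟩

        B : ℕ → ∣ 𝒪 ℝ-space ∣
        B n = (λ x → ⌜ InUnion (pairs n) x ⌝)
            , λ x m → let ((p , q) , i , g , h) = held m in
                      p , q , h , λ y k → holds ((p , q) , i , g , k)

        B-step : ∀ n → proj₁ (B n) ⊆ proj₁ (B (suc n))
        B-step n x m = let (I , i , g) = held m in holds (I , ∈-++⁺ˡ i , g)

        B-union : proj₁ s IsUnionOf (proj₁ ∘ B)
        B-union x = mk⇔
          (λ m → let ((U , U∈D) , k)     = to (lub-is-union ℝ-space D {s} l x) m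
                     (p , q , h , sub)   = proj₂ U x k
                     (n , i)             = all-pairs p q
                 in n , holds ((p , q) , i , (U , U∈D , sub) , h))
          (λ { (n , m) → let ((p , q) , _ , (U , U∈D , sub) , h) = held m in
                         upper l (U , U∈D) x (sub x h) })

        absorb : ∀ Is → ∃[ U ] U ∈ D × (∀ x → InUnion Is x → x ∈ proj₁ U)
        absorb [] = let (U , U∈D) = inhabited d in U , U∈D , λ { x (_ , () , _) }
        absorb (I ∷ Is) with absorb Is | lem {Good I}
        ... | U , U∈D , f | no ¬g = U , U∈D ,
          λ { x (_ , here refl , g , _) → ⊥-elim (¬g g)
            ; x (J , there j , g) → f x (J , j , g) }
        ... | U , U∈D , f | yes (V , V∈D , sub) =
          let (W , W∈D , a , b) = bounded d U∈D V∈D in W , W∈D ,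
          λ { x (_ , here refl , _ , h) → b x (sub x h)
            ; x (J , there j , g) → a x (f x (J , j , g)) }

        result : ∀ t → (∀ i → measure (asBorel (members D i)) ≤⁺ t) → measure (asBorel s) ≤⁺ t
        result t h = increasing (asBorel ∘ B) B-step (asBorel s) B-union t
          (λ n q m → let (U , U∈D , f) = absorb (pairs n) in
             h (U , U∈D) q (monotone (asBorel (B n)) (asBorel U) (λ x k → f x (held k)) q m))

    valuation : ContinuousValuation ℝ-space
    valuation = record
      { value      = λ U → measure (asBorel U)
      ; continuous = record
        { mono          = λ {U} {V} → monotone (asBorel U) (asBorel V)
        ; preserves-lub = λ D d {s} l → record
          { upper = λ i → monotone (asBorel (members D i)) (asBorel s) (upper l i)
          ; least = Approximation.result D d {s} l
          }
        }
      ; strict     = null-empty (proj₂ (asBorel (∅ₒ ℝ-space)))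
      ; modular    = λ U V → mod (asBorel U) (asBorel V)
                               (asBorel (_∪ₒ_ {ℝ-space} U V)) (asBorel (_∩ₒ_ {ℝ-space} U V))
                               (λ _ → mk⇔ id id) (λ _ → mk⇔ id id)
      }
      where
      mod : ∀ U V W Z → proj₁ W ≐ proj₁ U ∪ proj₁ V → proj₁ Z ≐ proj₁ U ∩ proj₁ V →
            measure W +⁺ measure Z ≈⁺ measure U +⁺ measure V
      mod U V W Z w z =
          (λ q m → +⁺-mono {u} {u} {d +⁺ i} {v} (λ _ k → k)
             (λ r k → snd v≈ r (+⁺-comm≤ d i r k)) q
             (+⁺-assoc≤ u d i q
               (+⁺-mono {measure W} {u +⁺ d} {i} {i} (fst w≈) (λ _ k → k) q m)))
        , (λ q m → +⁺-mono {u +⁺ d} {measure W} {i} {i} (snd w≈) (λ _ k → k) q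
             (+⁺-assoc≥ u d i q
               (+⁺-mono {u} {u} {v} {d +⁺ i} (λ _ k → k)
                 (λ r k → +⁺-comm≤ i d r (fst v≈ r k)) q m)))
        where
        Z⊆V : proj₁ Z ⊆ proj₁ V
        Z⊆V x k = proj₂ (to T-∧ (to (z x) k))
        Δ : ∃ Borel
        Δ = proj₁ V ∖ proj₁ Z , borel-∖ (proj₂ V) (proj₂ Z)
        u = measure U
        v = measure V
        i = measure Z
        d = measure Δ
        v≈ : v ≈⁺ i +⁺ d
        v≈ = split Z V Z⊆V
        w≈ : measure W ≈⁺ u +⁺ d
        w≈ = additive U Δ W
          (λ x a b → let (b₁ , b₂) = to T-∧ b in
             T-not (proj₁ Z x) b₂ (from (z x) (from T-∧ (a , b₁))))
          (λ x → let h = absorbed (proj₁ U x) (proj₁ V x) (proj₁ Z x)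
                           (λ k → proj₁ (to (T-∧ {proj₁ U x}) (to (z x) k))) in
             mk⇔ (to h ∘ to (w x)) (from (w x) ∘ from h))
          where
          absorbed : ∀ a b c → (T c → T a) → T (a ∨ b) ⇔ T (a ∨ (b ∧ not c))
          absorbed true  _     _     _ = mk⇔ id id
          absorbed false true  true  h = ⊥-elim (h tt)
          absorbed false true  false _ = mk⇔ id id
          absorbed false false _     _ = mk⇔ id id


  ∣_∣⁺ : ∣ Lift⊥ 𝐈ℝ ∣ → ℝ̄₊
  ∣ ⊥₋    ∣⁺ = 0⁺
  -- In the last case 𝐚 contains 0.
  ∣ [ 𝐚 ] ∣⁺ with lem {0ᴿ ≤ᴿ lo 𝐚} | lem {hi 𝐚 ≤ᴿ 0ᴿ}
  ... | yes 0≤a | _       = fromℝ (lo 𝐚) 0≤a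
  ... | no  _   | yes b≤0 = fromℝ (-ᴿ hi 𝐚) 0≤-b
    where
    0≤-b : 0ᴿ ≤ᴿ -ᴿ hi 𝐚
    0≤-b q m with ℚ.<-dense (toWitness m)
    ... | r , q<r , r<0 with located (hi 𝐚) (neg-flip q<r)
    ...   | inj₁ h = ⊥-elim (ℚ.<-asym (neg-flip r<0) (toWitness (b≤0 (- r) h)))
    ...   | inj₂ h = h
  ... | no  _   | no  _   = 0⁺

  singleton-continuous : Continuous ℝ-space (Scott 𝐈ℝ) singleton
  singleton-continuous V v x x∈V =
    let (J , J∈D , J∈V)       = inaccessible v D D-directed {singleton x} D-lub x∈V
        (p , q , (l , u) , e) = held {∃[ p ] ∃[ q ] ∃ λ h → J ≡ box p q h} J∈D
    in p , q , (l , u) , λ y k →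
       upward v {J} {singleton y} (subst (λ K → 𝐈ℝ ⊢ K ≤ singleton y) (sym e) (box≤ p q (l , u) y k)) J∈V
    where
    box : ∀ p q → x ∈⟨ p , q ⟩ → Interval
    box p q (l , u) = ⟦ fromℚ p , fromℚ q
      ∣ (λ r m → fromWitness (ℚ.<-trans (toWitness m) (L<U x l u))) ⟧
    box≤ : ∀ p q h y → y ∈⟨ p , q ⟩ → 𝐈ℝ ⊢ box p q h ≤ singleton y
    box≤ p q h y (l , u) = (λ r m → L-lower y (toWitness m) l)
                         , (λ r m → fromWitness (L<U y m u))
    D : ℙ Interval
    D J = ⌜ (∃[ p ] ∃[ q ] ∃ λ h → J ≡ box p q h) ⌝
    D-directed : IsDirected 𝐈ℝ D
    D-directed = record
      { inhabited = let (p , l) = L-inhabited x ; (q , u) = U-inhabited x in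
                    box p q (l , u) , holds (p , q , (l , u) , refl)
      ; bounded   = λ a b → join (held a) (held b)
      }
      where
      join : ∀ {J K} → ∃[ p ] ∃[ q ] (∃ λ h → J ≡ box p q h) →
             ∃[ p ] ∃[ q ] (∃ λ h → K ≡ box p q h) →
             ∃[ M ] M ∈ D × 𝐈ℝ ⊢ J ≤ M × 𝐈ℝ ⊢ K ≤ M
      join (p , q , (l , u) , refl) (p′ , q′ , (l′ , u′) , refl) =
        let (m , p≤m , p′≤m , i) = max-L p p′
            (n , n≤q , n≤q′ , j) = min-U q q′
            h                    = i x l l′ , j x u u′
        in box m n h , holds (m , n , h , refl)
         , ( (λ r k → fromWitness (ℚ.<-≤-trans (toWitness k) p≤m))
           , (λ r k → fromWitness (ℚ.<-≤-trans (toWitness k) n≤q)))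
         , ( (λ r k → fromWitness (ℚ.<-≤-trans (toWitness k) p′≤m))
           , (λ r k → fromWitness (ℚ.<-≤-trans (toWitness k) n≤q′)))
    D-lub : IsLub 𝐈ℝ (members D) (singleton x)
    D-lub = record
      { upper = λ { (J , m) → let (p , q , h , e) = held {∃[ p ] ∃[ q ] ∃ λ h → J ≡ box p q h} m in
                    subst (λ K → 𝐈ℝ ⊢ K ≤ singleton x) (sym e) (box≤ p q h x h) }
      ; least = λ K b → lower-bound K b , upper-bound K b
      }
      where
      lower-bound : ∀ K → (∀ i → 𝐈ℝ ⊢ members D i ≤ K) → x ≤ᴿ lo K
      lower-bound K b r m =
        let (p , r<p , l) = L-open x m
            (q , u)       = U-inhabited x
        in proj₁ (b (box p q (l , u) , holds (p , q , (l , u) , refl))) r (fromWitness r<p)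
      upper-bound : ∀ K → (∀ i → 𝐈ℝ ⊢ members D i ≤ K) → hi K ≤ᴿ x
      upper-bound K b r m with L-open (hi K) m
      ... | q , r<q , m′ with located x r<q
      ...   | inj₁ h = h
      ...   | inj₂ u =
        let (p , l) = L-inhabited x in
        ⊥-elim (ℚ.<-irrefl refl (toWitness
          (proj₂ (b (box p q (l , u) , holds (p , q , (l , u) , refl))) q m′)))

  Scott-continuous⇒continuous : ∀ (P Q : Poset₀) {f} → ScottContinuous P Q f →
                                Continuous (Scott P) (Scott Q) f
  Scott-continuous⇒continuous P Q {f} c V v = record
    { upward       = λ l → upward v (mono c l)
    ; inaccessible = λ D d {s} l m →
        let (y , y∈fD , y∈V)  = inaccessible v (f[ D ]) (f[]-directed D d) (f[]-lub D d l) m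
            (x , x∈D , e)     = held {∃[ x ] x ∈ D × f x ≡ y} y∈fD
        in x , x∈D , subst (_∈ V) (sym e) y∈V
    }
    where
    f[_] : ℙ ∣ P ∣ → ℙ ∣ Q ∣
    f[ D ] y = ⌜ (∃[ x ] x ∈ D × f x ≡ y) ⌝
    f[]-directed : ∀ D → IsDirected P D → IsDirected Q f[ D ]
    f[]-directed D d = record
      { inhabited = let (x , m) = inhabited d in f x , holds (x , m , refl)
      ; bounded   = λ a b → bnd (held a) (held b)
      }
      where
      bnd : ∀ {y y′} → ∃[ x ] x ∈ D × f x ≡ y → ∃[ x ] x ∈ D × f x ≡ y′ →
            ∃[ z ] z ∈ f[ D ] × Q ⊢ y ≤ z × Q ⊢ y′ ≤ z
      bnd (x , m , refl) (x′ , m′ , refl) =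
        let (z , k , a , b) = bounded d m m′ in
        f z , holds (z , k , refl) , mono c a , mono c b
    f[]-lub : ∀ D → IsDirected P D → ∀ {s} → IsLub P (members D) s →
              IsLub Q (members f[ D ]) (f s)
    f[]-lub D d {s} l = record
      { upper = λ { (y , m) → let (x , x∈D , e) = held {∃[ x ] x ∈ D × f x ≡ y} m in
                    subst (λ z → Q ⊢ z ≤ f s) e (mono c (upper l (x , x∈D))) }
      ; least = λ t b → least (preserves-lub c D d l) t
                  (λ { (x , m) → b (f x , holds (x , m , refl)) })
      }

  infixr 5 _⇒_
  infixr 6 _⊕_
  infixr 7 _⊗_

  data Ty : Set where
    unit void int real : Ty
    _⊕_ _⊗_ _⇒_        : Ty → Ty → Ty
    𝐃                  : Ty → Ty

  data Basic : Ty → Set where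
    unit : Basic unit
    void : Basic void
    int  : Basic int
    real : Basic real

  data ObservableTy : Ty → Set where
    basic : ∀ {σ} → Basic σ → ObservableTy σ
    _⊕_   : ∀ {σ τ} → ObservableTy σ → ObservableTy τ → ObservableTy (σ ⊕ τ)
    _⊗_   : ∀ {σ τ} → ObservableTy σ → ObservableTy τ → ObservableTy (σ ⊗ τ)

  data FirstOrder : Ty → Set where
    result : ∀ {τ} → ObservableTy τ → FirstOrder τ
    _⇒_    : ∀ {σ τ} → Basic σ → FirstOrder τ → FirstOrder (σ ⇒ τ)

  -- Types are only interpreted in order to give denotations to constants.
  -- First-order types do not involve 𝐃, hence its interpretation is
  -- left arbitrary.
  module Interpretation (⟦𝐃⟧ : Ty → Poset₀) where

    ⟦_⟧ : Ty → Poset₀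
    ⟦ unit ⟧  = Lift⊥ (discrete ⊤)
    ⟦ void ⟧  = Lift⊥ (discrete ⊥)
    ⟦ int ⟧   = Lift⊥ (discrete ℤ)
    ⟦ real ⟧  = Lift⊥ 𝐈ℝ
    ⟦ σ ⊕ τ ⟧ = Lift⊥ (⊎-poset ⟦ σ ⟧ ⟦ τ ⟧)
    ⟦ σ ⊗ τ ⟧ = ×-poset ⟦ σ ⟧ ⟦ τ ⟧
    ⟦ σ ⇒ τ ⟧ = ⟦ σ ⟧ ⇨ ⟦ τ ⟧
    ⟦ 𝐃 τ ⟧   = ⟦𝐃⟧ τ

    Observable : ∀ τ → ∣ ⟦ τ ⟧ ∣ → Set
    Observable unit    v              = v ≢ ⊥₋
    Observable void    v              = v ≢ ⊥₋
    Observable int     v              = v ≢ ⊥₋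
    Observable real    v              = v ≢ ⊥₋
    Observable (σ ⊕ τ) ⊥₋             = ⊥
    Observable (σ ⊕ τ) [ inj₁ v ]     = Observable σ v
    Observable (σ ⊕ τ) [ inj₂ w ]     = Observable τ w
    Observable (σ ⊗ τ) (v , w)        = Observable σ v × Observable τ w
    Observable (σ ⇒ τ) _              = ⊥
    Observable (𝐃 τ)   _              = ⊥

    resultTy : ∀ {τ} → FirstOrder τ → Ty
    resultTy (result {τ} _) = τ
    resultTy (_ ⇒ φ)        = resultTy φ

    Args : ∀ {τ} → FirstOrder τ → Set
    Args (result _)      = ⊤
    Args (_⇒_ {σ} _ φ)   = ∣ ⟦ σ ⟧ ∣ × Args φ

    apply : ∀ {τ} (φ : FirstOrder τ) → ∣ ⟦ τ ⟧ ∣ → Args φ → ∣ ⟦ resultTy φ ⟧ ∣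
    apply (result _) v tt       = v
    apply (_ ⇒ φ)    f (v , vs) = apply φ (proj₁ f v) vs

    SomeBottom : ∀ {τ} (φ : FirstOrder τ) → Args φ → Set
    SomeBottom (result _)    tt       = ⊥
    SomeBottom (_⇒_ {σ} _ φ) (v , vs) = IsBottom ⟦ σ ⟧ v ⊎ SomeBottom φ vs

  -- Con τ is the set of constants of type τ, and 𝓜 indexes the measures
  -- available for sampling.
  record Signature : Set₁ where
    field
      ⟦𝐃⟧     : Ty → Poset₀

    open Interpretation ⟦𝐃⟧ public

    field
      Con     : Ty → Set
      den     : ∀ {τ} → Con τ → ∣ ⟦ τ ⟧ ∣
      star    : Con unit
      den-star : den star ≡ [ tt ]
      num     : ℤ → Con int
      den-num : ∀ n → den (num n) ≡ [ n ]
      𝓜       : Set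
      measure : 𝓜 → BorelMeasure

  record StrictlyObservableFirstOrder (S : Signature) : Set where
    open Signature S
    field
      firstOrder     : ∀ {τ} → Con τ → FirstOrder τ
      observable-or-⊥ : ∀ {τ} (f : Con τ) (vs : Args (firstOrder f)) →
                       let v = apply (firstOrder f) (den f) vs in
                       Observable (resultTy (firstOrder f)) v ⊎ IsBottom ⟦ resultTy (firstOrder f) ⟧ v
      strict         : ∀ {τ} (f : Con τ) (vs : Args (firstOrder f)) → SomeBottom (firstOrder f) vs →
                       IsBottom ⟦ resultTy (firstOrder f) ⟧ (apply (firstOrder f) (den f) vs)
      zero-ary       : ∀ {τ} (f : Con τ) → ObservableTy τ → Basic τ × Observable τ (den f)


  module Language (S : Signature) where

    open Signature S

    Context : Set
    Context = List Ty

    infixl 8 _·_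

    -- Intrinsically typed terms with de Bruijn indices.  Constants of the
    -- signature of type real are excluded; in their place there is a leaf
    -- of type real for each element of A.  Generalized terms are those
    -- with A = Interval.
    data Tm (A : Set) (Δ : Context) : Ty → Set where
      var    : ∀ {σ} → σ ∈ˡ Δ → Tm A Δ σ
      con    : ∀ {σ} (f : Con σ) → .(σ ≢ real) → Tm A Δ σ
      leaf   : A → Tm A Δ real
      sample : 𝓜 → Tm A Δ (𝐃 real)
      score  : Tm A Δ real → Tm A Δ (𝐃 unit)
      lam    : ∀ {σ τ} → Tm A (σ ∷ Δ) τ → Tm A Δ (σ ⇒ τ)
      _·_    : ∀ {σ τ} → Tm A Δ (σ ⇒ τ) → Tm A Δ σ → Tm A Δ τ
      rec    : ∀ {σ} → Tm A Δ (σ ⇒ σ) → Tm A Δ σ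
      ret    : ∀ {τ} → Tm A Δ τ → Tm A Δ (𝐃 τ)
      bind   : ∀ {σ τ} → Tm A Δ (𝐃 σ) → Tm A (σ ∷ Δ) (𝐃 τ) → Tm A Δ (𝐃 τ)
      pair   : ∀ {σ τ} → Tm A Δ σ → Tm A Δ τ → Tm A Δ (σ ⊗ τ)
      π₁     : ∀ {σ τ} → Tm A Δ (σ ⊗ τ) → Tm A Δ σ
      π₂     : ∀ {σ τ} → Tm A Δ (σ ⊗ τ) → Tm A Δ τ
      ι₁     : ∀ {σ τ} → Tm A Δ σ → Tm A Δ (σ ⊕ τ)
      ι₂     : ∀ {σ τ} → Tm A Δ τ → Tm A Δ (σ ⊕ τ)
      case   : ∀ {σ τ υ} → Tm A Δ (σ ⊕ τ) → Tm A Δ (σ ⇒ υ) → Tm A Δ (τ ⇒ υ) → Tm A Δ υ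

    module _ {A : Set} where

      Renaming Substitution : Context → Context → Set
      Renaming     Δ Δ′ = ∀ {σ} → σ ∈ˡ Δ → σ ∈ˡ Δ′
      Substitution Δ Δ′ = ∀ {σ} → σ ∈ˡ Δ → Tm A Δ′ σ

      extʳ : ∀ {Δ Δ′ σ} → Renaming Δ Δ′ → Renaming (σ ∷ Δ) (σ ∷ Δ′)
      extʳ ρ (here e)  = here e
      extʳ ρ (there x) = there (ρ x)

      rename : ∀ {Δ Δ′ τ} → Renaming Δ Δ′ → Tm A Δ τ → Tm A Δ′ τ
      rename ρ (var x)      = var (ρ x)
      rename ρ (con f n)    = con f n
      rename ρ (leaf a)     = leaf a
      rename ρ (sample μ)   = sample μ
      rename ρ (score M)    = score (rename ρ M)
      rename ρ (lam M)      = lam (rename (extʳ ρ) M)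
      rename ρ (M · N)      = rename ρ M · rename ρ N
      rename ρ (rec M)      = rec (rename ρ M)
      rename ρ (ret M)      = ret (rename ρ M)
      rename ρ (bind M N)   = bind (rename ρ M) (rename (extʳ ρ) N)
      rename ρ (pair M N)   = pair (rename ρ M) (rename ρ N)
      rename ρ (π₁ M)       = π₁ (rename ρ M)
      rename ρ (π₂ M)       = π₂ (rename ρ M)
      rename ρ (ι₁ M)       = ι₁ (rename ρ M)
      rename ρ (ι₂ M)       = ι₂ (rename ρ M)
      rename ρ (case M N P) = case (rename ρ M) (rename ρ N) (rename ρ P)

      extˢ : ∀ {Δ Δ′ σ} → Substitution Δ Δ′ → Substitution (σ ∷ Δ) (σ ∷ Δ′)
      extˢ s (here e)  = var (here e)
      extˢ s (there x) = rename there (s x)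

      substitute : ∀ {Δ Δ′ τ} → Substitution Δ Δ′ → Tm A Δ τ → Tm A Δ′ τ
      substitute s (var x)      = s x
      substitute s (con f n)    = con f n
      substitute s (leaf a)     = leaf a
      substitute s (sample μ)   = sample μ
      substitute s (score M)    = score (substitute s M)
      substitute s (lam M)      = lam (substitute (extˢ s) M)
      substitute s (M · N)      = substitute s M · substitute s N
      substitute s (rec M)      = rec (substitute s M)
      substitute s (ret M)      = ret (substitute s M)
      substitute s (bind M N)   = bind (substitute s M) (substitute (extˢ s) N)
      substitute s (pair M N)   = pair (substitute s M) (substitute s N)
      substitute s (π₁ M)       = π₁ (substitute s M)
      substitute s (π₂ M)       = π₂ (substitute s M)
      substitute s (ι₁ M)       = ι₁ (substitute s M)
      substitute s (ι₂ M)       = ι₂ (substitute s M)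
      substitute s (case M N P) = case (substitute s M) (substitute s N) (substitute s P)

      single : ∀ {Δ σ} → Tm A Δ σ → Substitution (σ ∷ Δ) Δ
      single M (here refl) = M
      single M (there x)   = var x

      _[_]₀ : ∀ {Δ σ τ} → Tm A (σ ∷ Δ) τ → Tm A Δ σ → Tm A Δ τ
      N [ M ]₀ = substitute (single M) N

    Term : Ty → Set
    Term = Tm Interval []

    -- A template with template variables x₁,…,xₖ, read from left to right
    -- and each occurring once, has no choice in how they are numbered: it
    -- is a term with k unlabelled leaves.  A template variable is then the
    -- position of a leaf.
    Template : Ty → Set
    Template = Tm ⊤ []

    fv : ∀ {Δ τ} → Tm ⊤ Δ τ → Set
    fv (var x)      = ⊥
    fv (con f n)    = ⊥
    fv (leaf _)     = ⊤
    fv (sample μ)   = ⊥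
    fv (score M)    = fv M
    fv (lam M)      = fv M
    fv (M · N)      = fv M ⊎ fv N
    fv (rec M)      = fv M
    fv (ret M)      = fv M
    fv (bind M N)   = fv M ⊎ fv N
    fv (pair M N)   = fv M ⊎ fv N
    fv (π₁ M)       = fv M
    fv (π₂ M)       = fv M
    fv (ι₁ M)       = fv M
    fv (ι₂ M)       = fv M
    fv (case M N P) = fv M ⊎ fv N ⊎ fv P

    record Configuration : Set where
      constructor conf
      field
        {type} : Ty
        shape  : Template type
        θ      : fv shape → Interval

    infix 4 _≤ᶜ_

    data _≤ᶜ_ : Configuration → Configuration → Set where
      pointwise : ∀ {τ} {M : Template τ} {θ θ′ : fv M → Interval} →
                  (∀ x → 𝐈ℝ ⊢ θ x ≤ θ′ x) → conf M θ ≤ᶜ conf M θ′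

    ≤ᶜ-trans : ∀ {C C′ C″} → C ≤ᶜ C′ → C′ ≤ᶜ C″ → C ≤ᶜ C″
    ≤ᶜ-trans (pointwise {θ = θ} {θ′} p) (pointwise {θ′ = θ″} q) =
      pointwise (λ x → Poset.trans 𝐈ℝ {θ x} {θ′ x} {θ″ x} (p x) (q x))

    Γ : Poset₀
    Γ = Symmetric.poset {A = Configuration} {R = _≤ᶜ_}
      (λ {C} → pointwise (λ x → Poset.refl 𝐈ℝ {Configuration.θ C x})) ≤ᶜ-trans

    -- The bijection between configurations and generalized terms: fill
    -- computes Mθ; erase and labels recover M and θ.

    fill : ∀ {A Δ τ} (M : Tm ⊤ Δ τ) → (fv M → A) → Tm A Δ τ
    fill (var x)      θ = var x
    fill (con f n)    θ = con f n
    fill (leaf _)     θ = leaf (θ tt)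
    fill (sample μ)   θ = sample μ
    fill (score M)    θ = score (fill M θ)
    fill (lam M)      θ = lam (fill M θ)
    fill (M · N)      θ = fill M (θ ∘ inj₁) · fill N (θ ∘ inj₂)
    fill (rec M)      θ = rec (fill M θ)
    fill (ret M)      θ = ret (fill M θ)
    fill (bind M N)   θ = bind (fill M (θ ∘ inj₁)) (fill N (θ ∘ inj₂))
    fill (pair M N)   θ = pair (fill M (θ ∘ inj₁)) (fill N (θ ∘ inj₂))
    fill (π₁ M)       θ = π₁ (fill M θ)
    fill (π₂ M)       θ = π₂ (fill M θ)
    fill (ι₁ M)       θ = ι₁ (fill M θ)
    fill (ι₂ M)       θ = ι₂ (fill M θ)
    fill (case M N P) θ =
      case (fill M (θ ∘ inj₁)) (fill N (θ ∘ inj₂ ∘ inj₁)) (fill P (θ ∘ inj₂ ∘ inj₂))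

    erase : ∀ {A Δ τ} → Tm A Δ τ → Tm ⊤ Δ τ
    erase (var x)      = var x
    erase (con f n)    = con f n
    erase (leaf _)     = leaf tt
    erase (sample μ)   = sample μ
    erase (score M)    = score (erase M)
    erase (lam M)      = lam (erase M)
    erase (M · N)      = erase M · erase N
    erase (rec M)      = rec (erase M)
    erase (ret M)      = ret (erase M)
    erase (bind M N)   = bind (erase M) (erase N)
    erase (pair M N)   = pair (erase M) (erase N)
    erase (π₁ M)       = π₁ (erase M)
    erase (π₂ M)       = π₂ (erase M)
    erase (ι₁ M)       = ι₁ (erase M)
    erase (ι₂ M)       = ι₂ (erase M)
    erase (case M N P) = case (erase M) (erase N) (erase P)

    labels : ∀ {A Δ τ} (M : Tm A Δ τ) → fv (erase M) → A
    labels (leaf a)     _ = a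
    labels (score M)      = labels M
    labels (lam M)        = labels M
    labels (M · N)        = [ labels M , labels N ]′
    labels (rec M)        = labels M
    labels (ret M)        = labels M
    labels (bind M N)     = [ labels M , labels N ]′
    labels (pair M N)     = [ labels M , labels N ]′
    labels (π₁ M)         = labels M
    labels (π₂ M)         = labels M
    labels (ι₁ M)         = labels M
    labels (ι₂ M)         = labels M
    labels (case M N P)   = [ labels M , [ labels N , labels P ]′ ]′

    term : (C : Configuration) → Term (Configuration.type C)
    term (conf M θ) = fill M θ

    configuration : ∀ {τ} → Term τ → Configuration
    configuration M = conf (erase M) (labels M)

    fill-erase : ∀ {A Δ τ} (M : Tm A Δ τ) → fill (erase M) (labels M) ≡ M
    fill-erase (var x)      = refl
    fill-erase (con f n)    = refl
    fill-erase (leaf a)     = refl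
    fill-erase (sample μ)   = refl
    fill-erase (score M)    = cong score (fill-erase M)
    fill-erase (lam M)      = cong lam (fill-erase M)
    fill-erase (M · N)      = cong₂ _·_ (fill-erase M) (fill-erase N)
    fill-erase (rec M)      = cong rec (fill-erase M)
    fill-erase (ret M)      = cong ret (fill-erase M)
    fill-erase (bind M N)   = cong₂ bind (fill-erase M) (fill-erase N)
    fill-erase (pair M N)   = cong₂ pair (fill-erase M) (fill-erase N)
    fill-erase (π₁ M)       = cong π₁ (fill-erase M)
    fill-erase (π₂ M)       = cong π₂ (fill-erase M)
    fill-erase (ι₁ M)       = cong ι₁ (fill-erase M)
    fill-erase (ι₂ M)       = cong ι₂ (fill-erase M)
    fill-erase (case M N P)
      rewrite fill-erase M | fill-erase N | fill-erase P = refl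

    -- The order of Γ read on generalized terms (see ≲⇒≤ᶜ and ≤ᶜ⇒≲).
    infix 4 _≲_

    data _≲_ {Δ} : ∀ {τ} → Tm Interval Δ τ → Tm Interval Δ τ → Set where
      var    : ∀ {σ} (x : σ ∈ˡ Δ) → var x ≲ var x
      con    : ∀ {σ} (f : Con σ) .(n : σ ≢ real) → con f n ≲ con f n
      leaf   : ∀ {𝐚 𝐛} → 𝐈ℝ ⊢ 𝐚 ≤ 𝐛 → leaf 𝐚 ≲ leaf 𝐛
      sample : ∀ μ → sample μ ≲ sample μ
      score  : ∀ {M M′} → M ≲ M′ → score M ≲ score M′
      lam    : ∀ {σ τ} {M M′ : Tm Interval (σ ∷ Δ) τ} → M ≲ M′ → lam M ≲ lam M′
      _·_    : ∀ {σ τ} {M M′ : Tm Interval Δ (σ ⇒ τ)} {N N′} → M ≲ M′ → N ≲ N′ → M · N ≲ M′ · N′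
      rec    : ∀ {σ} {M M′ : Tm Interval Δ (σ ⇒ σ)} → M ≲ M′ → rec M ≲ rec M′
      ret    : ∀ {τ} {M M′ : Tm Interval Δ τ} → M ≲ M′ → ret M ≲ ret M′
      bind   : ∀ {σ τ M M′} {N N′ : Tm Interval (σ ∷ Δ) (𝐃 τ)} →
               M ≲ M′ → N ≲ N′ → bind M N ≲ bind M′ N′
      pair   : ∀ {σ τ} {M M′ : Tm Interval Δ σ} {N N′ : Tm Interval Δ τ} →
               M ≲ M′ → N ≲ N′ → pair M N ≲ pair M′ N′
      π₁     : ∀ {σ τ} {M M′ : Tm Interval Δ (σ ⊗ τ)} → M ≲ M′ → π₁ M ≲ π₁ M′
      π₂     : ∀ {σ τ} {M M′ : Tm Interval Δ (σ ⊗ τ)} → M ≲ M′ → π₂ M ≲ π₂ M′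
      ι₁     : ∀ {σ τ} {M M′ : Tm Interval Δ σ} → M ≲ M′ → ι₁ {τ = τ} M ≲ ι₁ M′
      ι₂     : ∀ {σ τ} {M M′ : Tm Interval Δ τ} → M ≲ M′ → ι₂ {σ = σ} M ≲ ι₂ M′
      case   : ∀ {σ τ υ} {M M′ : Tm Interval Δ (σ ⊕ τ)} {N N′ : Tm Interval Δ (σ ⇒ υ)} {P P′} →
               M ≲ M′ → N ≲ N′ → P ≲ P′ → case M N P ≲ case M′ N′ P′

    ≲-refl : ∀ {Δ τ} (M : Tm Interval Δ τ) → M ≲ M
    ≲-refl (var x)      = var x
    ≲-refl (con f n)    = con f n
    ≲-refl (leaf a)     = leaf (Poset.refl 𝐈ℝ {a})
    ≲-refl (sample μ)   = sample μ
    ≲-refl (score M)    = score (≲-refl M)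
    ≲-refl (lam M)      = lam (≲-refl M)
    ≲-refl (M · N)      = ≲-refl M · ≲-refl N
    ≲-refl (rec M)      = rec (≲-refl M)
    ≲-refl (ret M)      = ret (≲-refl M)
    ≲-refl (bind M N)   = bind (≲-refl M) (≲-refl N)
    ≲-refl (pair M N)   = pair (≲-refl M) (≲-refl N)
    ≲-refl (π₁ M)       = π₁ (≲-refl M)
    ≲-refl (π₂ M)       = π₂ (≲-refl M)
    ≲-refl (ι₁ M)       = ι₁ (≲-refl M)
    ≲-refl (ι₂ M)       = ι₂ (≲-refl M)
    ≲-refl (case M N P) = case (≲-refl M) (≲-refl N) (≲-refl P)

    fill-mono : ∀ {Δ τ} (M : Tm ⊤ Δ τ) {θ θ′ : fv M → Interval} →
                (∀ x → 𝐈ℝ ⊢ θ x ≤ θ′ x) → fill M θ ≲ fill M θ′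
    fill-mono (var x)      p = var x
    fill-mono (con f n)    p = con f n
    fill-mono (leaf _)     p = leaf (p tt)
    fill-mono (sample μ)   p = sample μ
    fill-mono (score M)    p = score (fill-mono M p)
    fill-mono (lam M)      p = lam (fill-mono M p)
    fill-mono (M · N)      p = fill-mono M (p ∘ inj₁) · fill-mono N (p ∘ inj₂)
    fill-mono (rec M)      p = rec (fill-mono M p)
    fill-mono (ret M)      p = ret (fill-mono M p)
    fill-mono (bind M N)   p = bind (fill-mono M (p ∘ inj₁)) (fill-mono N (p ∘ inj₂))
    fill-mono (pair M N)   p = pair (fill-mono M (p ∘ inj₁)) (fill-mono N (p ∘ inj₂))
    fill-mono (π₁ M)       p = π₁ (fill-mono M p)
    fill-mono (π₂ M)       p = π₂ (fill-mono M p)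
    fill-mono (ι₁ M)       p = ι₁ (fill-mono M p)
    fill-mono (ι₂ M)       p = ι₂ (fill-mono M p)
    fill-mono (case M N P) p =
      case (fill-mono M (p ∘ inj₁)) (fill-mono N (p ∘ inj₂ ∘ inj₁)) (fill-mono P (p ∘ inj₂ ∘ inj₂))

    private
      data Below {Δ τ} : (M : Tm ⊤ Δ τ) → (fv M → Interval) →
                         (N : Tm ⊤ Δ τ) → (fv N → Interval) → Set where
        pointwise : ∀ {M θ θ′} → (∀ x → 𝐈ℝ ⊢ θ x ≤ θ′ x) → Below M θ M θ′

      module _ {Δ : Context} where

        lam⁺ : ∀ {σ τ} {M N : Tm ⊤ (σ ∷ Δ) τ} {θ θ′} → Below M θ N θ′ → Below {Δ} (lam M) θ (lam N) θ′
        lam⁺ (pointwise p) = pointwise p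

        score⁺ : ∀ {M N : Tm ⊤ Δ real} {θ θ′} → Below M θ N θ′ → Below (score M) θ (score N) θ′
        score⁺ (pointwise p) = pointwise p

        rec⁺ : ∀ {σ} {M N : Tm ⊤ Δ (σ ⇒ σ)} {θ θ′} → Below M θ N θ′ → Below (rec M) θ (rec N) θ′
        rec⁺ (pointwise p) = pointwise p

        ret⁺ : ∀ {τ} {M N : Tm ⊤ Δ τ} {θ θ′} → Below M θ N θ′ → Below (ret M) θ (ret N) θ′
        ret⁺ (pointwise p) = pointwise p

        π₁⁺ : ∀ {σ τ} {M N : Tm ⊤ Δ (σ ⊗ τ)} {θ θ′} → Below M θ N θ′ → Below (π₁ M) θ (π₁ N) θ′
        π₁⁺ (pointwise p) = pointwise p

        π₂⁺ : ∀ {σ τ} {M N : Tm ⊤ Δ (σ ⊗ τ)} {θ θ′} → Below M θ N θ′ → Below (π₂ M) θ (π₂ N) θ′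
        π₂⁺ (pointwise p) = pointwise p

        ι₁⁺ : ∀ {σ τ} {M N : Tm ⊤ Δ σ} {θ θ′} → Below M θ N θ′ → Below (ι₁ {τ = τ} M) θ (ι₁ N) θ′
        ι₁⁺ (pointwise p) = pointwise p

        ι₂⁺ : ∀ {σ τ} {M N : Tm ⊤ Δ τ} {θ θ′} → Below M θ N θ′ → Below (ι₂ {σ = σ} M) θ (ι₂ N) θ′
        ι₂⁺ (pointwise p) = pointwise p

        ·⁺ : ∀ {σ τ} {M N : Tm ⊤ Δ (σ ⇒ τ)} {M′ N′ θ θ′ φ} →
             Below M θ N (φ ∘ inj₁) → Below M′ θ′ N′ (φ ∘ inj₂) →
             Below (M · M′) [ θ , θ′ ]′ (N · N′) φ
        ·⁺ (pointwise p) (pointwise q) = pointwise (λ { (inj₁ x) → p x ; (inj₂ x) → q x })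

        bind⁺ : ∀ {σ τ M N} {M′ N′ : Tm ⊤ (σ ∷ Δ) (𝐃 τ)} {θ θ′ φ} →
                Below M θ N (φ ∘ inj₁) → Below M′ θ′ N′ (φ ∘ inj₂) →
                Below (bind M M′) [ θ , θ′ ]′ (bind N N′) φ
        bind⁺ (pointwise p) (pointwise q) = pointwise (λ { (inj₁ x) → p x ; (inj₂ x) → q x })

        pair⁺ : ∀ {σ τ} {M N : Tm ⊤ Δ σ} {M′ N′ : Tm ⊤ Δ τ} {θ θ′ φ} →
                Below M θ N (φ ∘ inj₁) → Below M′ θ′ N′ (φ ∘ inj₂) →
                Below (pair M M′) [ θ , θ′ ]′ (pair N N′) φ
        pair⁺ (pointwise p) (pointwise q) = pointwise (λ { (inj₁ x) → p x ; (inj₂ x) → q x })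

        case⁺ : ∀ {σ τ υ} {M N : Tm ⊤ Δ (σ ⊕ τ)} {M′ N′ : Tm ⊤ Δ (σ ⇒ υ)} {M″ N″ θ θ′ θ″ φ} →
                Below M θ N (φ ∘ inj₁) → Below M′ θ′ N′ (φ ∘ inj₂ ∘ inj₁) →
                Below M″ θ″ N″ (φ ∘ inj₂ ∘ inj₂) →
                Below (case M M′ M″) [ θ , [ θ′ , θ″ ]′ ]′ (case N N′ N″) φ
        case⁺ (pointwise p) (pointwise q) (pointwise r) = pointwise
          (λ { (inj₁ x) → p x ; (inj₂ (inj₁ x)) → q x ; (inj₂ (inj₂ x)) → r x })

      below-fill : ∀ {Δ τ} {M : Tm Interval Δ τ} (N : Tm ⊤ Δ τ) {θ : fv N → Interval} →
                   M ≲ fill N θ → Below (erase M) (labels M) N θ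
      below-fill (var x)      (var .x)     = pointwise (λ ())
      below-fill (con f n)    (con .f _)   = pointwise (λ ())
      below-fill (leaf _)     (leaf l)     = pointwise (λ _ → l)
      below-fill (sample μ)   (sample .μ)  = pointwise (λ ())
      below-fill (score N)    (score m)    = score⁺ (below-fill N m)
      below-fill (lam N)      (lam m)      = lam⁺ (below-fill N m)
      below-fill (N · N′)     (m · m′)     = ·⁺ (below-fill N m) (below-fill N′ m′)
      below-fill (rec N)      (rec m)      = rec⁺ (below-fill N m)
      below-fill (ret N)      (ret m)      = ret⁺ (below-fill N m)
      below-fill (bind N N′)  (bind m m′)  = bind⁺ (below-fill N m) (below-fill N′ m′)
      below-fill (pair N N′)  (pair m m′)  = pair⁺ (below-fill N m) (below-fill N′ m′)
      below-fill (π₁ N)       (π₁ m)       = π₁⁺ (below-fill N m)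
      below-fill (π₂ N)       (π₂ m)       = π₂⁺ (below-fill N m)
      below-fill (ι₁ N)       (ι₁ m)       = ι₁⁺ (below-fill N m)
      below-fill (ι₂ N)       (ι₂ m)       = ι₂⁺ (below-fill N m)
      below-fill (case N N′ N″) (case m m′ m″) =
        case⁺ (below-fill N m) (below-fill N′ m′) (below-fill N″ m″)

    ≲-fill⇒≤ᶜ : ∀ {τ} {M : Term τ} (N : Template τ) {θ} → M ≲ fill N θ → configuration M ≤ᶜ conf N θ
    ≲-fill⇒≤ᶜ N m = go (below-fill N m)
      where
      go : ∀ {τ} {M N : Template τ} {θ θ′} → Below M θ N θ′ → conf M θ ≤ᶜ conf N θ′
      go (pointwise p) = pointwise p

    ≲⇒≤ᶜ : ∀ {τ} {M M′ : Term τ} → M ≲ M′ → configuration M ≤ᶜ configuration M′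
    ≲⇒≤ᶜ {M = M} {M′} m = ≲-fill⇒≤ᶜ (erase M′) (subst (M ≲_) (sym (fill-erase M′)) m)

    ≤ᶜ⇒≲ : ∀ {τ} {M : Term τ} {N : Template τ} {θ} → configuration M ≤ᶜ conf N θ → M ≲ fill N θ
    ≤ᶜ⇒≲ {M = M} {N} {θ} p = subst (_≲ fill N θ) (fill-erase M) (go p)
      where
      go : ∀ {τ} {M N : Template τ} {θ θ′} → conf M θ ≤ᶜ conf N θ′ → fill M θ ≲ fill N θ′
      go (pointwise {M = M} q) = fill-mono M q

    fill-cancel : ∀ {Δ τ} (M : Tm ⊤ Δ τ) {θ θ′ : fv M → Interval} →
                  fill M θ ≲ fill M θ′ → ∀ x → 𝐈ℝ ⊢ θ x ≤ θ′ x
    fill-cancel (leaf _)       (leaf l)      _               = l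
    fill-cancel (score M)      (score m)     x               = fill-cancel M m x
    fill-cancel (lam M)        (lam m)       x               = fill-cancel M m x
    fill-cancel (M · N)        (m · n)       (inj₁ x)        = fill-cancel M m x
    fill-cancel (M · N)        (m · n)       (inj₂ x)        = fill-cancel N n x
    fill-cancel (rec M)        (rec m)       x               = fill-cancel M m x
    fill-cancel (ret M)        (ret m)       x               = fill-cancel M m x
    fill-cancel (bind M N)     (bind m n)    (inj₁ x)        = fill-cancel M m x
    fill-cancel (bind M N)     (bind m n)    (inj₂ x)        = fill-cancel N n x
    fill-cancel (pair M N)     (pair m n)    (inj₁ x)        = fill-cancel M m x
    fill-cancel (pair M N)     (pair m n)    (inj₂ x)        = fill-cancel N n x
    fill-cancel (π₁ M)         (π₁ m)        x               = fill-cancel M m x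
    fill-cancel (π₂ M)         (π₂ m)        x               = fill-cancel M m x
    fill-cancel (ι₁ M)         (ι₁ m)        x               = fill-cancel M m x
    fill-cancel (ι₂ M)         (ι₂ m)        x               = fill-cancel M m x
    fill-cancel (case M N P)   (case m n p)  (inj₁ x)        = fill-cancel M m x
    fill-cancel (case M N P)   (case m n p)  (inj₂ (inj₁ x)) = fill-cancel N n x
    fill-cancel (case M N P)   (case m n p)  (inj₂ (inj₂ x)) = fill-cancel P p x

    configuration-term : ∀ C → Γ ⊢ configuration (term C) ≈ C
    configuration-term (conf M θ) = forth , back forth (fill-erase (fill M θ))
      where
      forth : configuration (fill M θ) ≤ᶜ conf M θ
      forth = ≲-fill⇒≤ᶜ M (≲-refl (fill M θ))
      back : ∀ {τ} {M N : Template τ} {θ θ′} → conf N θ′ ≤ᶜ conf M θ → fill N θ′ ≡ fill M θ →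
             conf M θ ≤ᶜ conf N θ′
      back {θ = θ} {θ′} (pointwise {M = M} _) e =
        pointwise (fill-cancel M (subst (_≲ fill M θ′) e (≲-refl (fill M θ′))))

    data Constant : ∀ {σ} → Term σ → Set where
      leaf : ∀ 𝐚 → Constant (leaf 𝐚)
      con  : ∀ {σ} → Basic σ → (f : Con σ) .(n : σ ≢ real) → Constant (con f n)

    -- Terms f a₁ ⋯ aᵢ, where f is in the signature and a₁, …, aᵢ are
    -- zero-ary constants of basic types.  For a first-order f, such a term
    -- has a function type if and only if i < α(f).
    data Applied : ∀ {τ} → Term τ → Set where
      con : ∀ {τ} (f : Con τ) .(n : τ ≢ real) → Applied (con f n)
      _·_ : ∀ {σ τ} {t : Term (σ ⇒ τ)} {a : Term σ} → Applied t → Constant a → Applied (t · a)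

    constant-den : ∀ {σ} {a : Term σ} → Constant a → ∣ ⟦ σ ⟧ ∣
    constant-den (leaf 𝐚)    = [ 𝐚 ]
    constant-den (con _ f _) = den f

    applied-den : ∀ {τ} {t : Term τ} → Applied t → ∣ ⟦ τ ⟧ ∣
    applied-den (con f _) = den f
    applied-den (t · a)   = proj₁ (applied-den t) (constant-den a)

    data Value : ∀ {τ} → Term τ → Set where
      constant : ∀ {σ} {a : Term σ} → Constant a → Value a
      lam      : ∀ {σ τ} (M : Tm Interval (σ ∷ []) τ) → Value (lam M)
      ret      : ∀ {τ} {V : Term τ} → Value V → Value (ret V)
      pair     : ∀ {σ τ} {V : Term σ} {W : Term τ} → Value V → Value W → Value (pair V W)
      ι₁       : ∀ {σ τ} {V : Term σ} → Value V → Value (ι₁ {τ = τ} V)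
      ι₂       : ∀ {σ τ} {V : Term τ} → Value V → Value (ι₂ {σ = σ} V)
      partial  : ∀ {σ τ} {t : Term (σ ⇒ τ)} → Applied t → Value t

    -- WeakCtx ρ τ and Ctx ρ τ: contexts of type τ with a hole of type ρ.
    data WeakCtx (ρ : Ty) : Ty → Set where
      □     : WeakCtx ρ ρ
      score : WeakCtx ρ real → WeakCtx ρ (𝐃 unit)
      _·_   : ∀ {σ τ} → WeakCtx ρ (σ ⇒ τ) → Term σ → WeakCtx ρ τ
      bind  : ∀ {σ τ} → WeakCtx ρ (𝐃 σ) → Tm Interval (σ ∷ []) (𝐃 τ) → WeakCtx ρ (𝐃 τ)
      arg   : ∀ {σ τ} {t : Term (σ ⇒ τ)} → Applied t → WeakCtx ρ σ → WeakCtx ρ τ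
      case  : ∀ {σ τ υ} → WeakCtx ρ (σ ⊕ τ) → Term (σ ⇒ υ) → Term (τ ⇒ υ) → WeakCtx ρ υ
      π₁    : ∀ {σ τ} → WeakCtx ρ (σ ⊗ τ) → WeakCtx ρ σ
      π₂    : ∀ {σ τ} → WeakCtx ρ (σ ⊗ τ) → WeakCtx ρ τ

    data Ctx (ρ : Ty) : Ty → Set where
      weak  : ∀ {τ} → WeakCtx ρ τ → Ctx ρ τ
      ret   : ∀ {τ} → Ctx ρ τ → Ctx ρ (𝐃 τ)
      pairˡ : ∀ {σ τ} → Ctx ρ σ → Term τ → Ctx ρ (σ ⊗ τ)
      pairʳ : ∀ {σ τ} {V : Term σ} → Value V → Ctx ρ τ → Ctx ρ (σ ⊗ τ)
      ι₁    : ∀ {σ τ} → Ctx ρ σ → Ctx ρ (σ ⊕ τ)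
      ι₂    : ∀ {σ τ} → Ctx ρ τ → Ctx ρ (σ ⊕ τ)

    infix 9 _⟨_⟩ʷ _⟨_⟩

    _⟨_⟩ʷ : ∀ {ρ τ} → WeakCtx ρ τ → Term ρ → Term τ
    □            ⟨ M ⟩ʷ = M
    score E      ⟨ M ⟩ʷ = score (E ⟨ M ⟩ʷ)
    (E · N)      ⟨ M ⟩ʷ = E ⟨ M ⟩ʷ · N
    bind E N     ⟨ M ⟩ʷ = bind (E ⟨ M ⟩ʷ) N
    arg {t = t} _ E ⟨ M ⟩ʷ = t · E ⟨ M ⟩ʷ
    case E N P   ⟨ M ⟩ʷ = case (E ⟨ M ⟩ʷ) N P
    π₁ E         ⟨ M ⟩ʷ = π₁ (E ⟨ M ⟩ʷ)
    π₂ E         ⟨ M ⟩ʷ = π₂ (E ⟨ M ⟩ʷ)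

    _⟨_⟩ : ∀ {ρ τ} → Ctx ρ τ → Term ρ → Term τ
    weak E    ⟨ M ⟩ = E ⟨ M ⟩ʷ
    ret E     ⟨ M ⟩ = ret (E ⟨ M ⟩)
    pairˡ E N ⟨ M ⟩ = pair (E ⟨ M ⟩) N
    pairʳ {V = V} _ E ⟨ M ⟩ = pair V (E ⟨ M ⟩)
    ι₁ E      ⟨ M ⟩ = ι₁ (E ⟨ M ⟩)
    ι₂ E      ⟨ M ⟩ = ι₂ (E ⟨ M ⟩)

    literal : ∀ τ (v : ∣ ⟦ τ ⟧ ∣) → Observable τ v → Term τ
    literal unit    ⊥₋         o       = ⊥-elim (o refl)
    literal unit    [ _ ]      o       = con star (λ ())
    literal void    ⊥₋         o       = ⊥-elim (o refl)
    literal int     ⊥₋         o       = ⊥-elim (o refl)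
    literal int     [ n ]      o       = con (num n) (λ ())
    literal real    ⊥₋         o       = ⊥-elim (o refl)
    literal real    [ 𝐚 ]      o       = leaf 𝐚
    literal (σ ⊕ τ) [ inj₁ v ] o       = ι₁ (literal σ v o)
    literal (σ ⊕ τ) [ inj₂ w ] o       = ι₂ (literal τ w o)
    literal (σ ⊗ τ) (v , w)    (o , p) = pair (literal σ v o) (literal τ w p)

    sampled : ∀ {τ} → WeakCtx (𝐃 real) τ → ℝ → Configuration
    sampled E a = configuration (E ⟨ ret (leaf (singleton a)) ⟩ʷ)

    sampled-continuous : ∀ {τ} (E : WeakCtx (𝐃 real) τ) →
                         Continuous ℝ-space (Scott Γ) (sampled E)
    sampled-continuous E V v = singleton-continuous (V ∘ plug) (Scott-continuous⇒continuous 𝐈ℝ Γ plug-continuous V v)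
      where
      plug : Interval → Configuration
      plug 𝐚 = configuration (E ⟨ ret (leaf 𝐚) ⟩ʷ)

      E-mono : ∀ {ρ τ} (E : WeakCtx ρ τ) {M M′} → M ≲ M′ → E ⟨ M ⟩ʷ ≲ E ⟨ M′ ⟩ʷ
      E-mono □                 m = m
      E-mono (score E)         m = score (E-mono E m)
      E-mono (E · N)           m = E-mono E m · ≲-refl N
      E-mono (bind E N)        m = bind (E-mono E m) (≲-refl N)
      E-mono (arg {t = t} _ E) m = ≲-refl t · E-mono E m
      E-mono (case E N P)      m = case (E-mono E m) (≲-refl N) (≲-refl P)
      E-mono (π₁ E)            m = π₁ (E-mono E m)
      E-mono (π₂ E)            m = π₂ (E-mono E m)

      module _ {I : Set} (i₀ : I) (x : I → Interval) {s} (l : IsLub 𝐈ℝ x s) where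

        E-lub : ∀ {τ} (E : WeakCtx (𝐃 real) τ) {N} → E ⟨ ret (leaf (x i₀)) ⟩ʷ ≲ N →
                (∀ i → E ⟨ ret (leaf (x i)) ⟩ʷ ≲ N) → E ⟨ ret (leaf s) ⟩ʷ ≲ N
        E-lub □            (ret (leaf {𝐛 = 𝐛} _)) h =
          ret (leaf (least l 𝐛 (λ i → h i |>′ λ { (ret (leaf p)) → p })))
        E-lub (score E)    (score m)      h = score (E-lub E m (λ i → h i |>′ λ { (score p) → p }))
        E-lub (E · _)      (m · m′)       h = E-lub E m (λ i → h i |>′ λ { (p · _) → p }) · m′
        E-lub (bind E _)   (bind m m′)    h = bind (E-lub E m (λ i → h i |>′ λ { (bind p _) → p })) m′
        E-lub (arg _ E)    (m′ · m)       h = m′ · E-lub E m (λ i → h i |>′ λ { (_ · p) → p })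
        E-lub (case E _ _) (case m m′ m″) h = case (E-lub E m (λ i → h i |>′ λ { (case p _ _) → p })) m′ m″
        E-lub (π₁ E)       (π₁ m)         h = π₁ (E-lub E m (λ i → h i |>′ λ { (π₁ p) → p }))
        E-lub (π₂ E)       (π₂ m)         h = π₂ (E-lub E m (λ i → h i |>′ λ { (π₂ p) → p }))

      same-type : ∀ {C C′} → C ≤ᶜ C′ → Configuration.type C ≡ Configuration.type C′
      same-type (pointwise _) = refl

      plug-continuous : ScottContinuous 𝐈ℝ Γ plug
      plug-continuous = record
        { mono          = plug-mono
        ; preserves-lub = λ D d {s} l → record
          { upper = λ i → plug-mono (upper l i)
          ; least = λ t h → plug-least (inhabited d) (members D) l t (same-type (h (inhabited d))) h
          }
        }
        where
        plug-mono : ∀ {𝐚 𝐛} → 𝐈ℝ ⊢ 𝐚 ≤ 𝐛 → plug 𝐚 ≤ᶜ plug 𝐛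
        plug-mono l = ≲⇒≤ᶜ (E-mono E (ret (leaf l)))
        plug-least : ∀ {I : Set} (i₀ : I) (x : I → Interval) {s} → IsLub 𝐈ℝ x s → ∀ C → Configuration.type (plug s) ≡ Configuration.type C →
                     (∀ i → plug (x i) ≤ᶜ C) → plug s ≤ᶜ C
        plug-least i₀ x l (conf N θ) refl h = ≲-fill⇒≤ᶜ N (E-lub i₀ x l E (≤ᶜ⇒≲ (h i₀)) (λ i → ≤ᶜ⇒≲ (h i)))

    infix 3 _⟶_

    data _⟶_ : ∀ {τ} → Term τ → ContinuousValuation (Scott Γ) → Set where
      bind-ret : ∀ {σ τ υ} (E : WeakCtx (𝐃 τ) υ) (M : Term σ) (N : Tm Interval (σ ∷ []) (𝐃 τ)) →
        E ⟨ bind (ret M) N ⟩ʷ ⟶ δ (configuration (E ⟨ N [ M ]₀ ⟩ʷ))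
      unfold : ∀ {σ τ} (E : Ctx σ τ) (M : Term (σ ⇒ σ)) →
        E ⟨ rec M ⟩ ⟶ δ (configuration (E ⟨ M · rec M ⟩))
      beta : ∀ {σ τ υ} (E : Ctx τ υ) (M : Tm Interval (σ ∷ []) τ) (N : Term σ) →
        E ⟨ lam M · N ⟩ ⟶ δ (configuration (E ⟨ M [ N ]₀ ⟩))
      π₁-pair : ∀ {σ τ υ} (E : Ctx σ υ) (M : Term σ) (N : Term τ) →
        E ⟨ π₁ (pair M N) ⟩ ⟶ δ (configuration (E ⟨ M ⟩))
      π₂-pair : ∀ {σ τ υ} (E : Ctx τ υ) (M : Term σ) (N : Term τ) →
        E ⟨ π₂ (pair M N) ⟩ ⟶ δ (configuration (E ⟨ N ⟩))
      case-ι₁ : ∀ {σ τ υ χ} (E : Ctx υ χ) (M : Term σ) (N : Term (σ ⇒ υ)) (P : Term (τ ⇒ υ)) →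
        E ⟨ case (ι₁ M) N P ⟩ ⟶ δ (configuration (E ⟨ N · M ⟩))
      case-ι₂ : ∀ {σ τ υ χ} (E : Ctx υ χ) (M : Term τ) (N : Term (σ ⇒ υ)) (P : Term (τ ⇒ υ)) →
        E ⟨ case (ι₂ M) N P ⟩ ⟶ δ (configuration (E ⟨ P · M ⟩))
      sampling : ∀ {τ} (E : WeakCtx (𝐃 real) τ) (μ : 𝓜) →
        E ⟨ sample μ ⟩ʷ ⟶ image (sampled E) (sampled-continuous E) (valuation (measure μ))
      scoring : ∀ {τ} (E : WeakCtx (𝐃 unit) τ) (𝐚 : Interval) →
        E ⟨ score (leaf 𝐚) ⟩ʷ ⟶ ∣ [ 𝐚 ] ∣⁺ ·δ configuration (E ⟨ ret (con star (λ ())) ⟩ʷ)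
      delta : ∀ {σ τ υ} (E : Ctx τ υ) {t : Term (σ ⇒ τ)} {a : Term σ} (p : Applied t) (q : Constant a) →
        ObservableTy τ → (o : Observable τ (applied-den (p · q))) →
        E ⟨ t · a ⟩ ⟶ δ (configuration (E ⟨ literal τ (applied-den (p · q)) o ⟩))
      delta-⊥ : ∀ {σ τ υ} (E : Ctx τ υ) {t : Term (σ ⇒ τ)} {a : Term σ} (p : Applied t) (q : Constant a) →
        ObservableTy τ → ¬ Observable τ (applied-den (p · q)) →
        E ⟨ t · a ⟩ ⟶ 𝟎

    -- Over strictly observable first-order constants at most one rule
    -- applies, so which ν excluded middle provides is immaterial; when no
    -- rule applies the value is zero.
    Next : ∣ Γ ∣ → ∣ 𝐕 (Scott Γ) ∣
    Next C with lem {∃ (term C ⟶_)}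
    ... | yes (ν , _) = ν
    ... | no  _       = 𝟎

{-# OPTIONS --safe #-}
-- Relabelling a term does not affect which rule applies to it: if some
-- labelling of a template M reduces by E⟨L⟩ → ν, then every labelling θ of M
-- reduces by the same rule in the same context, and the reduct depends on θ
-- only through the labels.  So for each template M, either Next vanishes on all
-- labellings of M or it is, by determinism, a family of valuations νθ produced
-- by a single rule.  Such a family is Scott-continuous in θ: reducts are
-- relabellings of a fixed term, since substitution commutes with relabelling; for
-- score one uses the continuity of |·|, for sample the continuity of the
-- valuation μ along the directed preimages of an open set, and for a constant f
-- the joint continuity of application in the dcpos interpreting first-order
-- types.  This suffices because everything below a labelling of M is itself a
-- labelling of M, so that a directed lub in Γ is computed in a single shape.
module Submission where

import Relation.Binary.Construct.Interior.Symmetric as Symmetric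
import Data.Rational.Properties as ℚ
open import Axiom.ExcludedMiddle using (ExcludedMiddle)
open import Data.Bool.Base using (Bool; true; false; T)
open import Data.Empty using (⊥-elim)
open import Data.List.Base using ([]; _∷_)
open import Data.List.Membership.Propositional using () renaming (_∈_ to _∈ˡ_)
open import Data.List.Relation.Unary.Any using (here; there)
open import Data.Product.Base using (∃; ∃-syntax; _×_; _,_; proj₁; proj₂)
open import Data.Product.Relation.Binary.Pointwise.NonDependent using (×-poset)
open import Data.Rational.Base as ℚ using (0ℚ; 1ℚ; _<_; _+_; -_)
open import Data.Sum.Base using (_⊎_; inj₁; inj₂; [_,_]′)
open import Data.Sum.Relation.Binary.Pointwise using (⊎-poset) renaming (inj₁ to inj₁≤; inj₂ to inj₂≤)
open import Data.Unit.Base using (⊤; tt)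
open import Function.Base using (_∘_; id; _|>′_)
open import Level using (0ℓ)
open import Relation.Binary.Bundles using (Poset)
open import Relation.Binary.Construct.Add.Infimum.NonStrict using (⊥₋≤_; [_])
open import Relation.Binary.PropositionalEquality
  using (_≡_; _≢_; refl; sym; trans; cong; cong₂; subst; subst₂)
open import Relation.Nullary using (¬_; Dec; yes; no)
open import Relation.Nullary.Construct.Add.Infimum using (⊥₋; [_])
open import Relation.Nullary.Decidable using (fromWitness; toWitness)

open import Defs
open Symmetric using (_,_)
open IsDirected
open IsLub
open ScottContinuous
open IsScottOpen
open ℝ
open ℝ̄₊
open Interval

-- The rules `delta` and `delta-⊥` do not fit the pattern of one rule per template: which of the two
-- applies may change with the labels, and the reduct of `delta` is not a relabelling of a fixed
-- term, since its literal is computed from the labels by the denotation of the constant. They are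
-- therefore merged into `discharge`, and the point to prove is that, for an open `U`, the
-- labellings at which the literal exists and its configuration lies in `U` form a Scott-open set.
-- Lubs are given only by their universal property. To extract a witness from one, it is compared
-- with an explicit upper bound: a union of lower cuts for numbers and intervals, the pointwise
-- supremum for functions. The latter is the reason for the completeness proofs. Determinism enters
-- because `Next` returns whichever valuation excluded middle supplies, separately at each
-- labelling; only uniqueness ties these choices to one family.

module Order (lem : ExcludedMiddle 0ℓ) where
  open Classical lem

  -- Directed families and Scott continuity

  -- Families rather than subsets: images and restrictions of a family are again families, with no
  -- comprehension involved. The passage to the subsets in the definition of `ScottContinuous` is
  -- made once, through `range`, in `preserves` and `reached`.
  record Directed (P : Poset₀) {I : Set} (x : I → ∣ P ∣) : Set where
    field
      index : I
      join  : ∀ i j → ∃[ k ] P ⊢ x i ≤ x k × P ⊢ x j ≤ x k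

  open Directed public

  members-directed : ∀ (P : Poset₀) {D : ℙ ∣ P ∣} → IsDirected P D → Directed P (members D)
  members-directed P d = record
    { index = inhabited d
    ; join  = λ (x , x∈D) (y , y∈D) →
        let (z , z∈D , x≤z , y≤z) = bounded d x∈D y∈D in (z , z∈D) , x≤z , y≤z
    }

  module _ (P : Poset₀) {I : Set} (x : I → ∣ P ∣) where

    range : ℙ ∣ P ∣
    range y = ⌜ (∃[ i ] x i ≡ y) ⌝

    in-range : ∀ i → x i ∈ range
    in-range i = holds (i , refl)

    range-directed : Directed P x → IsDirected P range
    range-directed d = record
      { inhabited = x (index d) , in-range (index d)
      ; bounded   = λ p q → bound (held p) (held q)
      }
      where
      bound : ∀ {y z} → ∃[ i ] x i ≡ y → ∃[ j ] x j ≡ z →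
              ∃[ w ] w ∈ range × P ⊢ y ≤ w × P ⊢ z ≤ w
      bound (i , refl) (j , refl) = let (k , a , b) = join d i j in x k , in-range k , a , b

    range-lub : ∀ {s} → IsLub P x s → IsLub P (members range) s
    range-lub {s} l = record
      { upper = λ (y , m) → let (i , e) = held {∃[ i ] x i ≡ y} m in
                subst (λ z → P ⊢ z ≤ s) e (upper l i)
      ; least = λ t h → least l t (λ i → h (x i , in-range i))
      }

  mono-directed : ∀ {P Q : Poset₀} {f} → ScottContinuous P Q f →
                  ∀ {I : Set} {x : I → ∣ P ∣} → Directed P x → Directed Q (f ∘ x)
  mono-directed c d = record
    { index = index d
    ; join  = λ i j → let (k , a , b) = join d i j in k , mono c a , mono c b
    }

  preserves : ∀ {P Q : Poset₀} {f} → ScottContinuous P Q f → ∀ {I : Set} {x : I → ∣ P ∣} →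
              Directed P x → ∀ {s} → IsLub P x s → IsLub Q (f ∘ x) (f s)
  preserves {P} {Q} {f} c {x = x} d {s} l = record
    { upper = λ i → mono c (upper l i)
    ; least = λ t h → least (preserves-lub c (range P x) (range-directed P x d) (range-lub P x l)) t
        (λ (y , m) → bounded-by t h (held m))
    }
    where
    bounded-by : ∀ t → (∀ i → Q ⊢ f (x i) ≤ t) → ∀ {y} → ∃[ i ] x i ≡ y → Q ⊢ f y ≤ t
    bounded-by t h (i , refl) = h i

  reached : ∀ {P : Poset₀} {U} → IsScottOpen P U → ∀ {I : Set} {x : I → ∣ P ∣} →
            Directed P x → ∀ {s} → IsLub P x s → s ∈ U → ∃[ i ] x i ∈ U
  reached {P} {U} u {x = x} d l m =
    let (y , y∈ , y∈U) = inaccessible u (range P x) (range-directed P x d) (range-lub P x l) m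
        (i , e)        = held {∃[ i ] x i ≡ y} y∈
    in i , subst (_∈ U) (sym e) y∈U

  -- Monotonicity already makes the image of a lub an upper bound, so only leastness remains to be
  -- supplied.
  scottContinuous : ∀ {P Q : Poset₀} {f} → (∀ {x y} → P ⊢ x ≤ y → Q ⊢ f x ≤ f y) →
    (∀ {I : Set} (x : I → ∣ P ∣) → Directed P x → ∀ {s} → IsLub P x s →
     ∀ t → (∀ i → Q ⊢ f (x i) ≤ t) → Q ⊢ f s ≤ t) →
    ScottContinuous P Q f
  scottContinuous {P} m h = record
    { mono          = m
    ; preserves-lub = λ D d l → record
      { upper = λ i → m (upper l i)
      ; least = h (members D) (members-directed P d) l
      }
    }

  ∘-continuous : ∀ {P Q R : Poset₀} {g f} → ScottContinuous Q R g → ScottContinuous P Q f →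
                 ScottContinuous P R (g ∘ f)
  ∘-continuous {P} {Q} {R} cg cf = scottContinuous {P} {R} (mono cg ∘ mono cf)
    (λ x d l → least (preserves cg (mono-directed cf d) (preserves cf d l)))

  id-continuous : ∀ {P : Poset₀} → ScottContinuous P P id
  id-continuous {P} = scottContinuous {P} {P} id (λ x d l → least l)

  const-continuous : ∀ {P Q : Poset₀} (y : ∣ Q ∣) → ScottContinuous P Q (λ _ → y)
  const-continuous {P} {Q} y =
    scottContinuous {P} {Q} (λ _ → Poset.refl Q) (λ x d l t h → h (index d))

  continuous-resp : ∀ {P Q : Poset₀} {f g} → (∀ x → Q ⊢ f x ≤ g x) → (∀ x → Q ⊢ g x ≤ f x) →
                    ScottContinuous P Q f → ScottContinuous P Q g
  continuous-resp {P} {Q} {f} {g} f≤g g≤f c = scottContinuous {P} {Q}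
    (λ {x} {y} p → Poset.trans Q (g≤f x) (Poset.trans Q (mono c p) (f≤g y)))
    (λ x d {s} l t h → Poset.trans Q (g≤f s)
      (least (preserves c d l) t (λ i → Poset.trans Q (f≤g (x i)) (h i))))

  -- Embeddings onto upper sets

  -- Covers the proper elements of a lift, the two summands of a coproduct, and the labellings of
  -- one template inside `Γ`, so that a single argument restricts families in all of them.
  record OpenEmbedding (P Q : Poset₀) (e : ∣ P ∣ → ∣ Q ∣) : Set where
    field
      e-mono   : ∀ {x y} → P ⊢ x ≤ y → Q ⊢ e x ≤ e y
      e-cancel : ∀ {x y} → Q ⊢ e x ≤ e y → P ⊢ x ≤ y
      e-up     : ∀ {x z} → Q ⊢ e x ≤ z → ∃[ y ] z ≡ e y

  open OpenEmbedding public

  -- Once one member lies in the image, the members that do are cofinal: any member has a common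
  -- upper bound with the known one, and the image is an upper set. Hence lubs in `P` and in `Q`
  -- correspond.
  module Part {P Q : Poset₀} {e : ∣ P ∣ → ∣ Q ∣} (emb : OpenEmbedding P Q e)
              {I : Set} (x : I → ∣ Q ∣) (d : Directed Q x) (start : ∃[ i ] ∃[ y ] x i ≡ e y) where

    J : Set
    J = ∃[ i ] ∃[ y ] x i ≡ e y

    part : J → ∣ P ∣
    part (_ , y , _) = y

    later : ∀ i → ∃[ j ] Q ⊢ x i ≤ e (part j)
    later i =
      let (i₀ , y₀ , e₀)     = start
          (k , i≤k , i₀≤k)   = join d i i₀
          (y , eq)           = e-up emb (subst (λ z → Q ⊢ z ≤ x k) e₀ i₀≤k)
      in (k , y , eq) , subst (λ z → Q ⊢ x i ≤ z) eq i≤k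

    part-directed : Directed P part
    part-directed = record { index = start ; join = joins }
      where
      joins : ∀ j j′ → ∃[ k ] P ⊢ part j ≤ part k × P ⊢ part j′ ≤ part k
      joins (i , y , p) (i′ , y′ , p′) =
        let (k , a , b) = join d i i′
            (z , eq)    = e-up emb (subst (λ w → Q ⊢ w ≤ x k) p a)
        in (k , z , eq)
         , e-cancel emb (subst (λ w → Q ⊢ w ≤ e z) p (subst (λ w → Q ⊢ x i ≤ w) eq a))
         , e-cancel emb (subst (λ w → Q ⊢ w ≤ e z) p′ (subst (λ w → Q ⊢ x i′ ≤ w) eq b))

    part-lub : ∀ {v} → IsLub Q x (e v) → IsLub P part v
    part-lub {v} l = record
      { upper = λ (i , y , p) → e-cancel emb (subst (λ w → Q ⊢ w ≤ e v) p (upper l i))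
      ; least = λ t h → e-cancel emb (least l (e t) (λ i →
          let (j , a) = later i in Poset.trans Q a (e-mono emb (h j))))
      }

    lub-part : ∀ {v} → IsLub P part v → IsLub Q x (e v)
    lub-part {v} l = record
      { upper = λ i → let (j , a) = later i in Poset.trans Q a (e-mono emb (upper l j))
      ; least = least-e
      }
      where
      least-e : ∀ t → (∀ i → Q ⊢ x i ≤ t) → Q ⊢ e v ≤ t
      -- An upper bound of the family lies above the starting member, hence is itself in the image.
      least-e t h with e-up emb (subst (λ w → Q ⊢ w ≤ t) (proj₂ (proj₂ start)) (h (proj₁ start)))
      ... | t′ , refl = e-mono emb (least l t′ (λ (i , y , p) →
        e-cancel emb (subst (λ w → Q ⊢ w ≤ e t′) p (h i))))

  embedding-continuous : ∀ {P Q : Poset₀} {e} → OpenEmbedding P Q e → ScottContinuous P Q e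
  embedding-continuous {P} {Q} {e} emb = scottContinuous {P} {Q} (e-mono emb)
    (λ x d l t h → bounded-by x l t (e-up emb (h (index d))) h)
    where
    bounded-by : ∀ {I : Set} (x : I → ∣ P ∣) {s} → IsLub P x s → ∀ t → ∃[ y ] t ≡ e y →
                 (∀ i → Q ⊢ e (x i) ≤ t) → Q ⊢ e s ≤ t
    bounded-by x l _ (y , refl) h = e-mono emb (least l y (λ i → e-cancel emb (h i)))

  lift-embedding : ∀ (P : Poset₀) → OpenEmbedding P (Lift⊥ P) [_]
  lift-embedding P = record
    { e-mono   = [_]
    ; e-cancel = λ { [ l ] → l }
    ; e-up     = λ { {z = [ y ]} _ → y , refl }
    }

  inj₁-embedding : ∀ (P Q : Poset₀) → OpenEmbedding P (⊎-poset P Q) inj₁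
  inj₁-embedding P Q = record
    { e-mono   = inj₁≤
    ; e-cancel = λ { (inj₁≤ l) → l }
    ; e-up     = λ { (inj₁≤ {_} {y} _) → y , refl }
    }

  inj₂-embedding : ∀ (P Q : Poset₀) → OpenEmbedding Q (⊎-poset P Q) inj₂
  inj₂-embedding P Q = record
    { e-mono   = inj₂≤
    ; e-cancel = λ { (inj₂≤ l) → l }
    ; e-up     = λ { (inj₂≤ {_} {y} _) → y , refl }
    }

  -- Otherwise `⊥₋` would be an upper bound, and the lub could not be proper.
  reaches-proper : ∀ (P : Poset₀) {I : Set} (x : I → ∣ Lift⊥ P ∣) {v} → IsLub (Lift⊥ P) x [ v ] →
                   ∃[ i ] ∃[ y ] x i ≡ [ y ]
  reaches-proper P x l with lem {∃[ i ] ∃[ y ] x i ≡ [ y ]}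
  ... | yes p = p
  ... | no ¬p with least l ⊥₋ (λ i → all-⊥ i (x i) refl)
    where
    all-⊥ : ∀ i y → x i ≡ y → Lift⊥ P ⊢ y ≤ ⊥₋
    all-⊥ i ⊥₋    _ = ⊥₋≤ ⊥₋
    all-⊥ i [ y ] e = ⊥-elim (¬p (i , y , e))
  ...   | ()

  reaches-inj₁ : ∀ (P Q : Poset₀) {I : Set} (x : I → ∣ ⊎-poset P Q ∣) → Directed (⊎-poset P Q) x →
                 ∀ {v} → IsLub (⊎-poset P Q) x (inj₁ v) → ∃[ i ] ∃[ y ] x i ≡ inj₁ y
  reaches-inj₁ P Q x d l with x (index d) in e | upper l (index d)
  ... | inj₁ y | _ = index d , y , e
  ... | inj₂ y | ()

  reaches-inj₂ : ∀ (P Q : Poset₀) {I : Set} (x : I → ∣ ⊎-poset P Q ∣) → Directed (⊎-poset P Q) x →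
                 ∀ {v} → IsLub (⊎-poset P Q) x (inj₂ v) → ∃[ i ] ∃[ y ] x i ≡ inj₂ y
  reaches-inj₂ P Q x d l with x (index d) in e | upper l (index d)
  ... | inj₂ y | _ = index d , y , e
  ... | inj₁ y | ()

  -- Products

  -- An upper bound `t` of the first components is completed by `proj₂ s`, which already bounds the
  -- second ones.
  proj₁-lub : ∀ (P Q : Poset₀) {I : Set} {x : I → ∣ ×-poset P Q ∣} {s} →
              IsLub (×-poset P Q) x s → IsLub P (proj₁ ∘ x) (proj₁ s)
  proj₁-lub P Q {s = s} l = record
    { upper = λ i → proj₁ (upper l i)
    ; least = λ t h → proj₁ (least l (t , proj₂ s) (λ i → h i , proj₂ (upper l i)))
    }

  proj₂-lub : ∀ (P Q : Poset₀) {I : Set} {x : I → ∣ ×-poset P Q ∣} {s} →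
              IsLub (×-poset P Q) x s → IsLub Q (proj₂ ∘ x) (proj₂ s)
  proj₂-lub P Q {s = s} l = record
    { upper = λ i → proj₂ (upper l i)
    ; least = λ t h → proj₂ (least l (proj₁ s , t) (λ i → proj₁ (upper l i) , h i))
    }

  proj₁-directed : ∀ (P Q : Poset₀) {I : Set} {x : I → ∣ ×-poset P Q ∣} →
                   Directed (×-poset P Q) x → Directed P (proj₁ ∘ x)
  proj₁-directed P Q d = record
    { index = index d
    ; join  = λ i j → let (k , a , b) = join d i j in k , proj₁ a , proj₁ b
    }

  proj₂-directed : ∀ (P Q : Poset₀) {I : Set} {x : I → ∣ ×-poset P Q ∣} →
                   Directed (×-poset P Q) x → Directed Q (proj₂ ∘ x)
  proj₂-directed P Q d = record
    { index = index d
    ; join  = λ i j → let (k , a , b) = join d i j in k , proj₂ a , proj₂ b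
    }

  -- Completeness of lifts, sums, products and function spaces

  Complete : Poset₀ → Set₁
  Complete P = ∀ {I : Set} (x : I → ∣ P ∣) → Directed P x → ∃ (IsLub P x)

  discrete-complete : ∀ (A : Set) → Complete (discrete A)
  discrete-complete A x d = x (index d) , record
    { upper = λ i → let (k , a , b) = join d i (index d) in trans a (sym b)
    ; least = λ t h → h (index d)
    }

  Lift⊥-complete : ∀ (P : Poset₀) → Complete P → Complete (Lift⊥ P)
  Lift⊥-complete P c x d with lem {∃[ i ] ∃[ y ] x i ≡ [ y ]}
  ... | yes p = let open Part (lift-embedding P) x d p ; (v , l) = c part part-directed in
                [ v ] , lub-part l
  ... | no ¬p = ⊥₋ , record { upper = λ i → all-⊥ i (x i) refl ; least = λ t _ → ⊥₋≤ t }
    where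
    all-⊥ : ∀ i y → x i ≡ y → Lift⊥ P ⊢ y ≤ ⊥₋
    all-⊥ i ⊥₋    _ = ⊥₋≤ ⊥₋
    all-⊥ i [ y ] e = ⊥-elim (¬p (i , y , e))

  ⊎-complete : ∀ (P Q : Poset₀) → Complete P → Complete Q → Complete (⊎-poset P Q)
  ⊎-complete P Q c c′ x d with x (index d) in e
  ... | inj₁ y = let open Part (inj₁-embedding P Q) x d (index d , y , e)
                     (v , l) = c part part-directed
                 in inj₁ v , lub-part l
  ... | inj₂ y = let open Part (inj₂-embedding P Q) x d (index d , y , e)
                     (v , l) = c′ part part-directed
                 in inj₂ v , lub-part l

  ×-complete : ∀ (P Q : Poset₀) → Complete P → Complete Q → Complete (×-poset P Q)
  ×-complete P Q c c′ x d =
    let (v , l) = c (proj₁ ∘ x) (proj₁-directed P Q d)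
        (w , m) = c′ (proj₂ ∘ x) (proj₂-directed P Q d)
    in (v , w) , record
      { upper = λ i → upper l i , upper m i
      ; least = λ (t , u) h → least l t (proj₁ ∘ h) , least m u (proj₂ ∘ h)
      }

  module _ (P Q : Poset₀) (c : Complete Q) {I : Set} (f : I → ∣ P ⇨ Q ∣) (d : Directed (P ⇨ Q) f) where

    at-directed : ∀ x → Directed Q (λ i → proj₁ (f i) x)
    at-directed x = record
      { index = index d
      ; join  = λ i j → let (k , a , b) = join d i j in k , a x , b x
      }

    pointwise-lub : ∣ P ⇨ Q ∣
    pointwise-lub = (λ x → proj₁ (c _ (at-directed x))) , scottContinuous {P} {Q}
      (λ {x} {y} x≤y → least (proj₂ (c _ (at-directed x))) _ (λ i →
        Poset.trans Q (mono (proj₂ (f i)) x≤y) (upper (proj₂ (c _ (at-directed y))) i)))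
      (λ x dx {s} l t h → least (proj₂ (c _ (at-directed s))) t (λ i →
        least (preserves (proj₂ (f i)) dx l) t (λ j →
          Poset.trans Q (upper (proj₂ (c _ (at-directed (x j)))) i) (h j))))

    pointwise-isLub : IsLub (P ⇨ Q) f pointwise-lub
    pointwise-isLub = record
      { upper = λ i x → upper (proj₂ (c _ (at-directed x))) i
      ; least = λ t h x → least (proj₂ (c _ (at-directed x))) (proj₁ t x) (λ i → h i x)
      }

    -- The lub `g` is known only by its universal property among continuous maps. It lies below
    -- `pointwise-lub`, an upper bound that exists by completeness of `Q`, so it is computed
    -- pointwise.
    lub-at : ∀ {g} → IsLub (P ⇨ Q) f g → ∀ x → IsLub Q (λ i → proj₁ (f i) x) (proj₁ g x)
    lub-at l x = record
      { upper = λ i → upper l i x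
      ; least = λ t h → Poset.trans Q (least l pointwise-lub (upper pointwise-isLub) x)
                          (least (proj₂ (c _ (at-directed x))) t h)
      }

  ⇨-complete : ∀ (P Q : Poset₀) → Complete Q → Complete (P ⇨ Q)
  ⇨-complete P Q c f d = pointwise-lub P Q c f d , pointwise-isLub P Q c f d

  -- Taking the lub first in the function and then in the argument leads to the double family
  -- `f (x i) (a (x j))`. Directedness puts each member below a diagonal one `f (x k) (a (x k))`.
  application-continuous : ∀ {R : Poset₀} (P Q : Poset₀) → Complete Q → ∀ {f a} →
    ScottContinuous R (P ⇨ Q) f → ScottContinuous R P a →
    ScottContinuous R Q (λ r → proj₁ (f r) (a r))
  application-continuous {R} P Q c {f} {a} cf ca = scottContinuous {R} {Q} ap-mono
    (λ x d {s} l t h →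
      least (lub-at P Q c (f ∘ x) (mono-directed cf d) (preserves cf d l) (a s)) t (λ i →
        least (preserves (proj₂ (f (x i))) (mono-directed ca d) (preserves ca d l)) t (λ j →
          let (k , i≤k , j≤k) = join d i j in
          Poset.trans Q (Poset.trans Q (mono (proj₂ (f (x i))) (mono ca j≤k)) (mono cf i≤k (a (x k)))) (h k))))
    where
    ap-mono : ∀ {x y} → R ⊢ x ≤ y → Q ⊢ proj₁ (f x) (a x) ≤ proj₁ (f y) (a y)
    ap-mono {x} {y} p = Poset.trans Q (mono (proj₂ (f x)) (mono ca p)) (mono cf p (a y))

  -- Directed suprema of intervals

  -- The upper cut consists of the rationals that have an upper bound `r` of the family strictly
  -- below them; the strictness makes it open. The real `b` keeps the supremum finite: a rational
  -- `q` above `b` bounds the family, so `q + 1ℚ` is in the upper cut.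
  sup : ∀ {I : Set} → I → (x : I → ℝ) (b : ℝ) → (∀ i → x i ≤ᴿ b) → ℝ
  sup i₀ x b x≤b = record
    { L           = λ q → ⌜ (∃[ i ] q ∈ L (x i)) ⌝
    ; U           = λ q → ⌜ (∃[ r ] r < q × (∀ i → ¬ r ∈ L (x i))) ⌝
    ; L-inhabited = let (q , m) = L-inhabited (x i₀) in q , holds (i₀ , m)
    ; U-inhabited = let (q , m) = U-inhabited b in
                    q + 1ℚ , holds (q , q<q+1 q , λ i m′ → disjoint b (x≤b i q m′) m)
    ; L-lower     = λ l m → let (i , h) = held m in holds (i , L-lower (x i) l h)
    ; U-upper     = λ l m → let (r , l′ , h) = held m in holds (r , ℚ.<-trans l′ l , h)
    ; L-open      = λ m → let (i , h) = held m ; (r , l , h′) = L-open (x i) h in r , l , holds (i , h′)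
    ; U-open      = λ m → let (r , l , h) = held m ; (r′ , l₁ , l₂) = ℚ.<-dense l in
                    r′ , l₂ , holds (r , l₁ , h)
    ; disjoint    = λ m m′ → let (i , h) = held m ; (r , l , h′) = held m′ in h′ i (L-lower (x i) l h)
    ; located     = locate
    }
    where
    locate : ∀ {p q} → p < q → _
    locate {p} l with lem {∃[ i ] p ∈ L (x i)}
    ... | yes h = inj₁ (holds h)
    ... | no  n = inj₂ (holds (p , l , λ i h → n (i , h)))

  -- The order compares lower cuts only. Openness of the upper cut of `y` leaves room for
  -- locatedness of `x` to decide.
  ≤ᴿ⇒U : ∀ x y → x ≤ᴿ y → U y ⊆ U x
  ≤ᴿ⇒U x y l q m with U-open y m
  ... | r , r<q , m′ with located x r<q
  ...   | inj₁ h = ⊥-elim (disjoint y (l r h) m′)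
  ...   | inj₂ h = h

  -ᴿ-anti : ∀ x y → x ≤ᴿ y → -ᴿ y ≤ᴿ -ᴿ x
  -ᴿ-anti x y l q = ≤ᴿ⇒U x y l (- q)

  -ᴿ-involutive : ∀ x → -ᴿ -ᴿ x ≤ᴿ x × x ≤ᴿ -ᴿ -ᴿ x
  -ᴿ-involutive x = (λ q → subst (_∈ L x) (ℚ-Group.⁻¹-involutive q))
                  , (λ q → subst (_∈ L x) (sym (ℚ-Group.⁻¹-involutive q)))

  module _ {I : Set} (x : I → Interval) (d : Directed 𝐈ℝ x) where

    private
      i₀ = index d

    lo≤all-hi : ∀ i j → lo (x i) ≤ᴿ hi (x j)
    lo≤all-hi i j q m = let (k , (a , _) , (_ , b)) = join d i j in b q (lo≤hi (x k) q (a q m))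

    -- The upper end of the lub is an infimum, formed as the negative of the supremum of the negated
    -- upper ends. One member of the family bounds both suprema, as all the intervals overlap.
    sup-lo sup-hi⁻ : ℝ
    sup-lo  = sup i₀ (λ i → lo (x i)) (hi (x i₀)) (λ i → lo≤all-hi i i₀)
    sup-hi⁻ = sup i₀ (λ i → -ᴿ hi (x i)) (-ᴿ lo (x i₀))
                (λ i → -ᴿ-anti (lo (x i₀)) (hi (x i)) (lo≤all-hi i₀ i))

    interval-sup : Interval
    interval-sup = ⟦ sup-lo , -ᴿ sup-hi⁻ ∣ nonempty ⟧
      where
      nonempty : sup-lo ≤ᴿ -ᴿ sup-hi⁻
      nonempty q m =
        let (i , h)         = held {∃[ i ] q ∈ L (lo (x i))} m
            -- The upper cut of `sup-hi⁻` asks for a bound strictly below `- q`; moving up to `q′`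
            -- inside the lower cut provides `- q′`.
            (q′ , q<q′ , h′) = L-open (lo (x i)) h
        in holds (- q′ , neg-flip q<q′ , λ j k →
             disjoint (hi (x j)) (lo≤all-hi i j q′ h′)
               (subst (_∈ U (hi (x j))) (ℚ-Group.⁻¹-involutive q′) k))

    interval-sup-isLub : IsLub 𝐈ℝ x interval-sup
    interval-sup-isLub = record
      { upper = λ i → (λ q m → holds (i , m))
                    , (λ q m → proj₁ (-ᴿ-involutive (hi (x i))) q
                         (-ᴿ-anti (-ᴿ hi (x i)) sup-hi⁻ (λ r h → holds (i , h)) q m))
      ; least = λ t h →
          (λ q m → let (i , h′) = held {∃[ i ] q ∈ L (lo (x i))} m in proj₁ (h i) q h′)
        , (λ q m → -ᴿ-anti sup-hi⁻ (-ᴿ hi t) (below-t t h) q (proj₂ (-ᴿ-involutive (hi t)) q m))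
      }
      where
      below-t : ∀ t → (∀ i → 𝐈ℝ ⊢ x i ≤ t) → sup-hi⁻ ≤ᴿ -ᴿ hi t
      below-t t h r m = let (i , h′) = held {∃[ i ] r ∈ L (-ᴿ hi (x i))} m in
        -ᴿ-anti (hi t) (hi (x i)) (proj₂ (h i)) r h′

  𝐈ℝ-complete : Complete 𝐈ℝ
  𝐈ℝ-complete x d = interval-sup x d , interval-sup-isLub x d

  module _ {I : Set} {x : I → Interval} (d : Directed 𝐈ℝ x) {s} (l : IsLub 𝐈ℝ x s) where

    -- `s` lies below `interval-sup`, whose lower cut is a union over the family.
    lo-reached : ∀ {q} → q ∈ L (lo s) → ∃[ i ] q ∈ L (lo (x i))
    lo-reached m = held (proj₁ (least l (interval-sup x d) (upper (interval-sup-isLub x d))) _ m)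

    hi-reached : ∀ {q} → q ∈ L (-ᴿ hi s) → ∃[ i ] q ∈ L (-ᴿ hi (x i))
    hi-reached {q} m = held (proj₁ (-ᴿ-involutive (sup-hi⁻ x d)) q
      (-ᴿ-anti (-ᴿ sup-hi⁻ x d) (hi s) (proj₂ (least l (interval-sup x d) (upper (interval-sup-isLub x d)))) q m))

module Valuations (lem : ExcludedMiddle 0ℓ) where
  open Classical lem
  open Order lem
  open ContinuousValuation

  -- Continuity of the absolute value

  -- This lemma and the next two identify `|𝐚|` with the maximum of `0`, `lo 𝐚` and `- hi 𝐚`. In
  -- that form continuity is read off the endpoints, although the case in the definition may change
  -- along a directed family.
  lo⊆abs : ∀ 𝐚 {q} → q ∈ L (lo 𝐚) → q ∈ below ∣ [ 𝐚 ] ∣⁺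
  lo⊆abs 𝐚 {q} m with cmp q 0ℚ
  ... | inj₁ q<0 = ≥0 ∣ [ 𝐚 ] ∣⁺ q<0
  ... | inj₂ 0≤q with lem {0ᴿ ≤ᴿ lo 𝐚} | lem {hi 𝐚 ≤ᴿ 0ᴿ}
  ...   | yes _ | _ = m
  ...   | no ¬p | _ = ⊥-elim (¬p (λ r r<0 → L-lower (lo 𝐚) (ℚ.<-≤-trans (toWitness r<0) 0≤q) m))

  -hi⊆abs : ∀ 𝐚 {q} → q ∈ L (-ᴿ hi 𝐚) → q ∈ below ∣ [ 𝐚 ] ∣⁺
  -hi⊆abs 𝐚 {q} m with cmp q 0ℚ
  ... | inj₁ q<0 = ≥0 ∣ [ 𝐚 ] ∣⁺ q<0
  ... | inj₂ 0≤q with lem {0ᴿ ≤ᴿ lo 𝐚} | lem {hi 𝐚 ≤ᴿ 0ᴿ}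
  ...   | yes 0≤a | _ =
    -- The cases are incompatible: `m` and `0 ≤ q` give `hi 𝐚 < 0`, while `0 ≤ lo 𝐚 ≤ hi 𝐚`.
    let (r , r<-q , h) = U-open (hi 𝐚) m in
    ⊥-elim (disjoint (hi 𝐚) (lo≤hi 𝐚 r (0≤a r (fromWitness (ℚ.<-≤-trans r<-q (ℚ.neg-antimono-≤ 0≤q))))) h)
  ...   | no _ | yes _ = m
  ...   | no _ | no ¬p =
    ⊥-elim (¬p (λ r h → fromWitness (ℚ.<-≤-trans (L<U (hi 𝐚) h m) (ℚ.neg-antimono-≤ 0≤q))))

  abs⊆ : ∀ 𝐚 {q} → q ∈ below ∣ [ 𝐚 ] ∣⁺ → q < 0ℚ ⊎ q ∈ L (lo 𝐚) ⊎ q ∈ L (-ᴿ hi 𝐚)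
  abs⊆ 𝐚 m with lem {0ᴿ ≤ᴿ lo 𝐚} | lem {hi 𝐚 ≤ᴿ 0ᴿ}
  ... | yes _ | _     = inj₂ (inj₁ m)
  ... | no _  | yes _ = inj₂ (inj₂ m)
  ... | no _  | no _  = inj₁ (toWitness m)

  abs-continuous : ScottContinuous 𝐈ℝ ℝ̄₊-poset (λ 𝐚 → ∣ [ 𝐚 ] ∣⁺)
  abs-continuous = scottContinuous {𝐈ℝ} {ℝ̄₊-poset}
    (λ {𝐚} {𝐛} (lo≤ , ≤hi) q m → abs⊆ 𝐚 m |>′
      [ ≥0 ∣ [ 𝐛 ] ∣⁺
      , [ (λ h → lo⊆abs 𝐛 (lo≤ q h)) , (λ h → -hi⊆abs 𝐛 (-ᴿ-anti (hi 𝐛) (hi 𝐚) ≤hi q h)) ]′ ]′)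
    (λ x d {s} l t h q m → abs⊆ s m |>′
      [ ≥0 t
      , [ (λ k → let (i , k′) = lo-reached d l k in h i q (lo⊆abs (x i) k′))
        , (λ k → let (i , k′) = hi-reached d l k in h i q (-hi⊆abs (x i) k′)) ]′ ]′)

  -- Continuous families of valuations

  module _ {P : Poset₀} {X : Space} where

    𝐕-continuous : {ν : ∣ P ∣ → ContinuousValuation X} →
                   (∀ U → ScottContinuous P ℝ̄₊-poset (λ p → value (ν p) U)) →
                   ScottContinuous P (𝐕 X) ν
    𝐕-continuous {ν} c = scottContinuous {P} {𝐕 X} (λ p U → mono (c U) p)
      (λ x d l t h U → least (preserves (c U) d l) (value t U) (λ i → h i U))

  -- The argument X of indicator plays no role.
  module _ {X : Space} where

    indicator-mono : ∀ a b → (T a → T b) → ℝ̄₊-poset ⊢ indicator {X} a ≤ indicator {X} b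
    indicator-mono false b     _ = 0⁺-least (indicator {X} b)
    indicator-mono true  true  _ = λ _ m → m
    indicator-mono true  false p = ⊥-elim (p tt)

    indicator-continuous : ∀ {P : Poset₀} {W} → IsScottOpen P W →
                           ScottContinuous P ℝ̄₊-poset (λ p → indicator {X} (W p))
    indicator-continuous {P} {W} w = scottContinuous {P} {ℝ̄₊-poset}
      (λ {x} {y} p → indicator-mono (W x) (W y) (upward w p))
      (λ x d {s} l t h → bounded-by (W s) (W ∘ x) (reached w d l) t h)
      where
      bounded-by : ∀ {I : Set} b (c : I → Bool) → (T b → ∃[ i ] T (c i)) →
                   ∀ t → (∀ i → ℝ̄₊-poset ⊢ indicator {X} (c i) ≤ t) → ℝ̄₊-poset ⊢ indicator {X} b ≤ t
      bounded-by false c r t h = 0⁺-least t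
      bounded-by true  c r t h = let (i , m) = r tt in
        λ q k → h i q (indicator-mono true (c i) (λ _ → m) q k)

    ·⁺-indicator-mono : ∀ c c′ → ℝ̄₊-poset ⊢ c ≤ c′ → ∀ a b → (T a → T b) →
                        ℝ̄₊-poset ⊢ c ·⁺ indicator {X} a ≤ c′ ·⁺ indicator {X} b
    ·⁺-indicator-mono c c′ le a b p q m = held m |>′
      [ (λ l → holds (inj₁ l))
      , (λ (r , s , 0<r , 0<s , i , j , e) →
          holds (inj₂ (r , s , 0<r , 0<s , le r i , indicator-mono a b p s j , e))) ]′

    positive-indicator : ∀ b {r} → 0ℚ < r → r ∈ below (indicator {X} b) → T b
    positive-indicator true  _   _ = tt
    positive-indicator false 0<r m = ℚ.<-asym 0<r (toWitness m)

  union : ∀ {I : Set} → I → (I → ℝ̄₊) → ℝ̄₊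
  union i₀ x = record
    { below   = λ q → ⌜ (∃[ i ] q ∈ below (x i)) ⌝
    ; ≥0      = λ l → holds (i₀ , ≥0 (x i₀) l)
    ; lower   = λ l m → let (i , h) = held m in holds (i , lower (x i) l h)
    ; rounded = λ m → let (i , h) = held m ; (r , l , h′) = rounded (x i) h in r , l , holds (i , h′)
    }

  -- `s` is compared with `union`, whose lower set is the union of those of the family and which
  -- therefore bounds it.
  below-reached : ∀ {I : Set} {x : I → ℝ̄₊} → I → ∀ {s} → IsLub ℝ̄₊-poset x s →
                  ∀ {q} → q ∈ below s → ∃[ i ] q ∈ below (x i)
  below-reached {x = x} i₀ l {q} m = held (least l (union i₀ x) (λ i q k → holds (i , k)) q m)

  module _ {P Q : Poset₀} {f : ∣ P ∣ → ∣ Q ∣} (cf : ScottContinuous P Q f) where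

    private
      pull : ∀ {U} → IsScottOpen Q U → IsScottOpen P (U ∘ f)
      pull {U} u = Scott-continuous⇒continuous P Q cf U u

    δ-continuous : ScottContinuous P (𝐕 (Scott Q)) (λ p → δ {Scott Q} (f p))
    δ-continuous = 𝐕-continuous (λ (U , u) → indicator-continuous {Scott Q} (pull u))

    -- A rational below the product is either negative or less than `r * r′` with both factors
    -- positive. The positive `r′` forces the point into `U`, which already happens at some index
    -- `i`; `r` is below the coefficient at some index `j`; a common upper index serves both.
    ·δ-continuous : ∀ {c : ∣ P ∣ → ℝ̄₊} → ScottContinuous P ℝ̄₊-poset c →
                    ScottContinuous P (𝐕 (Scott Q)) (λ p → _·δ_ {Scott Q} (c p) (f p))
    ·δ-continuous {c} cc = 𝐕-continuous (λ (U , u) → scottContinuous {P} {ℝ̄₊-poset}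
      (λ {x} {y} p → ·⁺-indicator-mono {Scott Q} (c x) (c y) (mono cc p) (U (f x)) (U (f y)) (upward u (mono cf p)))
      (λ x d {s} l t h q m → held m |>′ [ ≥0 t , (λ (r , r′ , 0<r , 0<r′ , a , b , e) →
        let (i , i∈U)       = reached (pull u) d l (positive-indicator {Scott Q} (U (f s)) 0<r′ b)
            (j , j∈)        = below-reached (index d) (preserves cc d l) a
            (k , i≤k , j≤k) = join d i j
        in h k q (holds (inj₂ (r , r′ , 0<r , 0<r′ , mono cc j≤k r j∈
             , indicator-mono {Scott Q} (U (f s)) (U (f (x k))) (λ _ → upward u (mono cf i≤k) i∈U) r′ b , e)))) ]′))

  𝟎-least : ∀ {X : Space} (ν : ContinuousValuation X) → 𝐕 X ⊢ 𝟎 ≤ ν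
  𝟎-least ν U = 0⁺-least (value ν U)

  module _ {P Q : Poset₀} {X : Space} (F : ∣ P ∣ → Space.Point X → ∣ Q ∣)
           (cX : ∀ p → Continuous X (Scott Q) (F p))
           (cP : ∀ a → ScottContinuous P Q (λ p → F p a)) (ν : ContinuousValuation X) where

    private
      pull : ∣ 𝒪 (Scott Q) ∣ → ∣ P ∣ → ∣ 𝒪 X ∣
      pull U p = preimage {X} {Scott Q} (F p) (cX p) U

      -- Inclusion of opens is tested at each point `a`, where continuity of `F p a` in `p` applies.
      -- Composition with the Scott continuity of `ν` then gives continuity of the image valuation.
      pull-continuous : ∀ U → ScottContinuous P (𝒪 X) (pull U)
      pull-continuous (U , u) = scottContinuous {P} {𝒪 X}
        (λ p a → upward u (mono (cP a) p))
        (λ x d {s} l t h a m →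
          let (i , m′) = reached (Scott-continuous⇒continuous P Q (cP a) U u) d l m in h i a m′)

    -- The hypothesis says that ξ p is the image of ν under F p, whatever
    -- the proof of openness of the preimages.
    image-continuous : (ξ : ∣ P ∣ → ContinuousValuation (Scott Q)) →
      (∀ p U → ∃[ W ] proj₁ W ≡ proj₁ U ∘ F p × value (ξ p) U ≡ value ν W) →
      ScottContinuous P (𝐕 (Scott Q)) ξ
    image-continuous ξ e = 𝐕-continuous (λ U → continuous-resp {P} {ℝ̄₊-poset} (ν≤ξ U) (ξ≤ν U)
      (∘-continuous {P} {𝒪 X} {ℝ̄₊-poset} (continuous ν) (pull-continuous U)))
      where
      ν≤ξ : ∀ U p → ℝ̄₊-poset ⊢ value ν (pull U p) ≤ value (ξ p) U
      ν≤ξ U p with e p U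
      ... | (W , w) , refl , eq = subst (λ y → ℝ̄₊-poset ⊢ value ν (pull U p) ≤ y) (sym eq)
        (mono (continuous ν) {pull U p} {W , w} (λ _ m → m))
      ξ≤ν : ∀ U p → ℝ̄₊-poset ⊢ value (ξ p) U ≤ value ν (pull U p)
      ξ≤ν U p with e p U
      ... | (W , w) , refl , eq = subst (λ y → ℝ̄₊-poset ⊢ y ≤ value ν (pull U p)) (sym eq)
        (mono (continuous ν) {W , w} {pull U p} (λ _ m → m))

module Relabelling (lem : ExcludedMiddle 0ℓ) (S : Classical.Signature lem) where
  open Classical lem
  open Order lem
  open Signature S
  open Language S

  -- Labellings of a fixed shape

  -- For `A = fv M` this is the fibre of `Γ` over the shape `M`. Other label sets allow a context
  -- and the content of its hole to be labelled independently.
  Labels : Set → Poset₀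
  Labels A = Symmetric.poset {A = A → Interval} {R = λ θ θ′ → ∀ a → 𝐈ℝ ⊢ θ a ≤ θ′ a}
    (λ {θ} a → Poset.refl 𝐈ℝ {θ a})
    (λ {θ} {θ′} {θ″} p q a → Poset.trans 𝐈ℝ {θ a} {θ′ a} {θ″ a} (p a) (q a))

  module _ {A : Set} where

    -- To compare the label of the lub at a with an upper bound, modify the
    -- lub at a only.
    label-lub : ∀ {I : Set} {θ : I → A → Interval} {θ∞} → IsLub (Labels A) θ θ∞ →
                ∀ a → IsLub 𝐈ℝ (λ i → θ i a) (θ∞ a)
    label-lub {θ = θ} {θ∞} l a = record
      { upper = λ i → upper l i a
      ; least = λ t h → at-a t (least l (update t) (bound t h) a)
      }
      where
      update : Interval → A → Interval
      update t b with lem {b ≡ a}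
      ... | yes _ = t
      ... | no  _ = θ∞ b
      at-a : ∀ t → 𝐈ℝ ⊢ θ∞ a ≤ update t a → 𝐈ℝ ⊢ θ∞ a ≤ t
      at-a t p with lem {a ≡ a}
      ... | yes _ = p
      ... | no ¬e = ⊥-elim (¬e refl)
      bound : ∀ t → (∀ i → 𝐈ℝ ⊢ θ i a ≤ t) → ∀ i b → 𝐈ℝ ⊢ θ i b ≤ update t b
      bound t h i b with lem {b ≡ a}
      ... | yes refl = h i
      ... | no  _    = upper l i b

    label-continuous : ∀ a → ScottContinuous (Labels A) 𝐈ℝ (λ θ → θ a)
    label-continuous a = scottContinuous {Labels A} {𝐈ℝ} (λ p → p a)
      (λ θ d l → least (label-lub {θ = θ} l a))

    labelling-continuous : ∀ {P : Poset₀} {f : ∣ P ∣ → A → Interval} →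
      (∀ a → ScottContinuous P 𝐈ℝ (λ p → f p a)) → ScottContinuous P (Labels A) f
    labelling-continuous {P} c = scottContinuous {P} {Labels A} (λ p a → mono (c a) p)
      (λ x d l t h a → least (preserves (c a) d l) (t a) (λ i → h i a))

  conf-embedding : ∀ {τ} (M : Template τ) → OpenEmbedding (Labels (fv M)) Γ (conf M)
  conf-embedding M = record
    { e-mono   = pointwise
    ; e-cancel = λ { (pointwise p) → p }
    ; e-up     = λ { (pointwise {θ′ = θ′} _) → θ′ , refl }
    }

  -- Relabelling and its commutation with substitution

  -- Although it goes through `erase` and `fill`, it computes through every term former; hence the
  -- naturality proofs by `refl` for context frames without side terms.
  relabel : ∀ {A B Δ τ} → (A → B) → Tm A Δ τ → Tm B Δ τ
  relabel f M = fill (erase M) (f ∘ labels M)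

  configuration-continuous : ∀ {A τ} (M : Tm A [] τ) →
    ScottContinuous (Labels A) Γ (λ θ → configuration (relabel θ M))
  configuration-continuous {A} M = continuous-resp {Labels A} {Γ}
    (λ θ → rhs≤lhs (configuration-term (conf (erase M) (θ ∘ labels M))))
    (λ θ → lhs≤rhs (configuration-term (conf (erase M) (θ ∘ labels M))))
    (∘-continuous {Labels A} {Labels (fv (erase M))} {Γ} (embedding-continuous (conf-embedding (erase M)))
      (labelling-continuous (λ x → label-continuous (labels M x))))
    where open Symmetric.SymInterior

  -- The graph of relabel f as an inductive relation, so that a term of known
  -- form on either side can be inverted by pattern matching.
  data Relabelled {A B} (f : A → B) {Δ} : ∀ {τ} → Tm A Δ τ → Tm B Δ τ → Set where
    var    : ∀ {σ} (x : σ ∈ˡ Δ) → Relabelled f (var x) (var x)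
    con    : ∀ {σ} (c : Con σ) .(n : σ ≢ real) → Relabelled f (con c n) (con c n)
    leaf   : ∀ a {b} → f a ≡ b → Relabelled f (leaf a) (leaf b)
    sample : ∀ μ → Relabelled f (sample μ) (sample μ)
    score  : ∀ {M M′} → Relabelled f M M′ → Relabelled f (score M) (score M′)
    lam    : ∀ {σ τ} {M : Tm A (σ ∷ Δ) τ} {M′} → Relabelled f M M′ → Relabelled f (lam M) (lam M′)
    _·_    : ∀ {σ τ} {M : Tm A Δ (σ ⇒ τ)} {M′ N N′} → Relabelled f M M′ → Relabelled f N N′ →
             Relabelled f (M · N) (M′ · N′)
    rec    : ∀ {σ} {M : Tm A Δ (σ ⇒ σ)} {M′} → Relabelled f M M′ → Relabelled f (rec M) (rec M′)
    ret    : ∀ {τ} {M : Tm A Δ τ} {M′} → Relabelled f M M′ → Relabelled f (ret M) (ret M′)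
    bind   : ∀ {σ τ M M′} {N : Tm A (σ ∷ Δ) (𝐃 τ)} {N′} → Relabelled f M M′ → Relabelled f N N′ →
             Relabelled f (bind M N) (bind M′ N′)
    pair   : ∀ {σ τ} {M : Tm A Δ σ} {N : Tm A Δ τ} {M′ N′} → Relabelled f M M′ → Relabelled f N N′ →
             Relabelled f (pair M N) (pair M′ N′)
    π₁     : ∀ {σ τ} {M : Tm A Δ (σ ⊗ τ)} {M′} → Relabelled f M M′ → Relabelled f (π₁ M) (π₁ M′)
    π₂     : ∀ {σ τ} {M : Tm A Δ (σ ⊗ τ)} {M′} → Relabelled f M M′ → Relabelled f (π₂ M) (π₂ M′)
    ι₁     : ∀ {σ τ} {M : Tm A Δ σ} {M′} → Relabelled f M M′ → Relabelled f (ι₁ {τ = τ} M) (ι₁ M′)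
    ι₂     : ∀ {σ τ} {M : Tm A Δ τ} {M′} → Relabelled f M M′ → Relabelled f (ι₂ {σ = σ} M) (ι₂ M′)
    case   : ∀ {σ τ υ} {M : Tm A Δ (σ ⊕ τ)} {N : Tm A Δ (σ ⇒ υ)} {P M′ N′ P′} →
             Relabelled f M M′ → Relabelled f N N′ → Relabelled f P P′ →
             Relabelled f (case M N P) (case M′ N′ P′)

  module _ {A B : Set} {f : A → B} where

    relabelled-≡ : ∀ {Δ τ} {M : Tm A Δ τ} {N} → Relabelled f M N → relabel f M ≡ N
    relabelled-≡ (var x)      = refl
    relabelled-≡ (con c n)    = refl
    relabelled-≡ (leaf a e)   = cong leaf e
    relabelled-≡ (sample μ)   = refl
    relabelled-≡ (score m)    = cong score (relabelled-≡ m)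
    relabelled-≡ (lam m)      = cong lam (relabelled-≡ m)
    relabelled-≡ (m · n)      = cong₂ _·_ (relabelled-≡ m) (relabelled-≡ n)
    relabelled-≡ (rec m)      = cong rec (relabelled-≡ m)
    relabelled-≡ (ret m)      = cong ret (relabelled-≡ m)
    relabelled-≡ (bind m n)   = cong₂ bind (relabelled-≡ m) (relabelled-≡ n)
    relabelled-≡ (pair m n)   = cong₂ pair (relabelled-≡ m) (relabelled-≡ n)
    relabelled-≡ (π₁ m)       = cong π₁ (relabelled-≡ m)
    relabelled-≡ (π₂ m)       = cong π₂ (relabelled-≡ m)
    relabelled-≡ (ι₁ m)       = cong ι₁ (relabelled-≡ m)
    relabelled-≡ (ι₂ m)       = cong ι₂ (relabelled-≡ m)
    relabelled-≡ (case m n p)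
      with refl ← relabelled-≡ m | refl ← relabelled-≡ n | refl ← relabelled-≡ p = refl

    relabelled-fill : ∀ {Δ τ} (M : Tm ⊤ Δ τ) (θ : fv M → A) → Relabelled f (fill M θ) (fill M (f ∘ θ))
    relabelled-fill (var x)      θ = var x
    relabelled-fill (con c n)    θ = con c n
    relabelled-fill (leaf _)     θ = leaf (θ tt) refl
    relabelled-fill (sample μ)   θ = sample μ
    relabelled-fill (score M)    θ = score (relabelled-fill M θ)
    relabelled-fill (lam M)      θ = lam (relabelled-fill M θ)
    relabelled-fill (M · N)      θ = relabelled-fill M (θ ∘ inj₁) · relabelled-fill N (θ ∘ inj₂)
    relabelled-fill (rec M)      θ = rec (relabelled-fill M θ)
    relabelled-fill (ret M)      θ = ret (relabelled-fill M θ)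
    relabelled-fill (bind M N)   θ = bind (relabelled-fill M (θ ∘ inj₁)) (relabelled-fill N (θ ∘ inj₂))
    relabelled-fill (pair M N)   θ = pair (relabelled-fill M (θ ∘ inj₁)) (relabelled-fill N (θ ∘ inj₂))
    relabelled-fill (π₁ M)       θ = π₁ (relabelled-fill M θ)
    relabelled-fill (π₂ M)       θ = π₂ (relabelled-fill M θ)
    relabelled-fill (ι₁ M)       θ = ι₁ (relabelled-fill M θ)
    relabelled-fill (ι₂ M)       θ = ι₂ (relabelled-fill M θ)
    relabelled-fill (case M N P) θ = case (relabelled-fill M (θ ∘ inj₁))
      (relabelled-fill N (θ ∘ inj₂ ∘ inj₁)) (relabelled-fill P (θ ∘ inj₂ ∘ inj₂))

    relabelled : ∀ {Δ τ} (M : Tm A Δ τ) → Relabelled f M (relabel f M)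
    relabelled M = subst (λ N → Relabelled f N (relabel f M)) (fill-erase M)
      (relabelled-fill (erase M) (labels M))

    -- extʳ takes the label set as a parameter, so its instances at A and B
    -- agree only pointwise.
    relabelled-rename : ∀ {Δ Δ′ τ} (ρ : Renaming {A} Δ Δ′) (ρ′ : Renaming {B} Δ Δ′) →
                        (∀ {σ} (x : σ ∈ˡ Δ) → ρ x ≡ ρ′ x) → {M : Tm A Δ τ} {N : Tm B Δ τ} →
                        Relabelled f M N → Relabelled f (rename ρ M) (rename ρ′ N)
    relabelled-rename ρ ρ′ e (var x)      = subst (λ y → Relabelled f (var (ρ x)) (var y)) (e x) (var (ρ x))
    relabelled-rename ρ ρ′ e (con c n)    = con c n
    relabelled-rename ρ ρ′ e (leaf a p)   = leaf a p
    relabelled-rename ρ ρ′ e (sample μ)   = sample μ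
    relabelled-rename ρ ρ′ e (score m)    = score (relabelled-rename ρ ρ′ e m)
    relabelled-rename ρ ρ′ e (lam m)      = lam (relabelled-rename (extʳ {A} ρ) (extʳ {B} ρ′)
      (λ { (here _) → refl ; (there x) → cong there (e x) }) m)
    relabelled-rename ρ ρ′ e (m · n)      = relabelled-rename ρ ρ′ e m · relabelled-rename ρ ρ′ e n
    relabelled-rename ρ ρ′ e (rec m)      = rec (relabelled-rename ρ ρ′ e m)
    relabelled-rename ρ ρ′ e (ret m)      = ret (relabelled-rename ρ ρ′ e m)
    relabelled-rename ρ ρ′ e (bind m n)   = bind (relabelled-rename ρ ρ′ e m)
      (relabelled-rename (extʳ {A} ρ) (extʳ {B} ρ′) (λ { (here _) → refl ; (there x) → cong there (e x) }) n)
    relabelled-rename ρ ρ′ e (pair m n)   = pair (relabelled-rename ρ ρ′ e m) (relabelled-rename ρ ρ′ e n)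
    relabelled-rename ρ ρ′ e (π₁ m)       = π₁ (relabelled-rename ρ ρ′ e m)
    relabelled-rename ρ ρ′ e (π₂ m)       = π₂ (relabelled-rename ρ ρ′ e m)
    relabelled-rename ρ ρ′ e (ι₁ m)       = ι₁ (relabelled-rename ρ ρ′ e m)
    relabelled-rename ρ ρ′ e (ι₂ m)       = ι₂ (relabelled-rename ρ ρ′ e m)
    relabelled-rename ρ ρ′ e (case m n p) =
      case (relabelled-rename ρ ρ′ e m) (relabelled-rename ρ ρ′ e n) (relabelled-rename ρ ρ′ e p)

    RelabelledSub : ∀ {Δ Δ′} → Substitution {A} Δ Δ′ → Substitution {B} Δ Δ′ → Set
    RelabelledSub {Δ} s s′ = ∀ {σ} (x : σ ∈ˡ Δ) → Relabelled f (s x) (s′ x)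

    relabelled-ext : ∀ {Δ Δ′ σ} {s : Substitution Δ Δ′} {s′ : Substitution Δ Δ′} → RelabelledSub s s′ →
                     RelabelledSub (extˢ {A} {σ = σ} s) (extˢ {B} s′)
    relabelled-ext r (here e)  = var (here e)
    relabelled-ext r (there x) = relabelled-rename there there (λ _ → refl) (r x)

    relabelled-substitute : ∀ {Δ Δ′ τ} {s : Substitution Δ Δ′} {s′ : Substitution Δ Δ′} →
                            RelabelledSub s s′ → {M : Tm A Δ τ} {N : Tm B Δ τ} →
                            Relabelled f M N → Relabelled f (substitute s M) (substitute s′ N)
    relabelled-substitute r (var x)      = r x
    relabelled-substitute r (con c n)    = con c n
    relabelled-substitute r (leaf a p)   = leaf a p
    relabelled-substitute r (sample μ)   = sample μ
    relabelled-substitute r (score m)    = score (relabelled-substitute r m)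
    relabelled-substitute {s = s} {s′} r (lam m) =
      lam (relabelled-substitute {s = extˢ s} {extˢ s′} (relabelled-ext {s = s} {s′} r) m)
    relabelled-substitute r (m · n)      = relabelled-substitute r m · relabelled-substitute r n
    relabelled-substitute r (rec m)      = rec (relabelled-substitute r m)
    relabelled-substitute r (ret m)      = ret (relabelled-substitute r m)
    relabelled-substitute {s = s} {s′} r (bind m n) = bind (relabelled-substitute r m)
      (relabelled-substitute {s = extˢ s} {extˢ s′} (relabelled-ext {s = s} {s′} r) n)
    relabelled-substitute r (pair m n)   = pair (relabelled-substitute r m) (relabelled-substitute r n)
    relabelled-substitute r (π₁ m)       = π₁ (relabelled-substitute r m)
    relabelled-substitute r (π₂ m)       = π₂ (relabelled-substitute r m)
    relabelled-substitute r (ι₁ m)       = ι₁ (relabelled-substitute r m)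
    relabelled-substitute r (ι₂ m)       = ι₂ (relabelled-substitute r m)
    relabelled-substitute r (case m n p) =
      case (relabelled-substitute r m) (relabelled-substitute r n) (relabelled-substitute r p)

    relabelled-[]₀ : ∀ {Δ σ τ} {N : Tm A (σ ∷ Δ) τ} {N′ M M′} → Relabelled f N N′ → Relabelled f M M′ →
                     Relabelled f (N [ M ]₀) (N′ [ M′ ]₀)
    relabelled-[]₀ {M = M} {M′} n m = relabelled-substitute {s = single M} {single M′}
      (λ { (here refl) → m ; (there x) → var x }) n

  relabel-fill : ∀ {A B Δ τ} (f : A → B) (M : Tm ⊤ Δ τ) (θ : fv M → A) →
                 relabel f (fill M θ) ≡ fill M (f ∘ θ)
  relabel-fill f M θ = relabelled-≡ {f = f} (relabelled-fill M θ)

  relabel-∘ : ∀ {A B C Δ τ} (g : B → C) (f : A → B) (M : Tm A Δ τ) →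
              relabel g (relabel f M) ≡ relabel (g ∘ f) M
  relabel-∘ g f M = relabel-fill g (erase M) (f ∘ labels M)

  relabel-[]₀ : ∀ {A B Δ σ τ} (f : A → B) (N : Tm A (σ ∷ Δ) τ) (M : Tm A Δ σ) →
                relabel f (N [ M ]₀) ≡ relabel f N [ relabel f M ]₀
  relabel-[]₀ f N M = relabelled-≡ {f = f} (relabelled-[]₀ (relabelled N) (relabelled M))

module Reductions (lem : ExcludedMiddle 0ℓ) (S : Classical.Signature lem)
                  (sofo : Classical.StrictlyObservableFirstOrder lem S) where
  open Classical lem
  open Order lem
  open Valuations lem
  open Signature S
  open StrictlyObservableFirstOrder sofo
  open Language S
  open Relabelling lem S
  open ContinuousValuation

  -- Completeness for first-order types

  basic-complete : ∀ {τ} → Basic τ → Complete ⟦ τ ⟧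
  basic-complete unit = Lift⊥-complete (discrete _) (discrete-complete _)
  basic-complete void = Lift⊥-complete (discrete _) (discrete-complete _)
  basic-complete int  = Lift⊥-complete (discrete _) (discrete-complete _)
  basic-complete real = Lift⊥-complete 𝐈ℝ 𝐈ℝ-complete

  observable-complete : ∀ {τ} → ObservableTy τ → Complete ⟦ τ ⟧
  observable-complete (basic b)           = basic-complete b
  observable-complete (_⊕_ {σ} {τ} o o′) = Lift⊥-complete (⊎-poset ⟦ σ ⟧ ⟦ τ ⟧)
    (⊎-complete ⟦ σ ⟧ ⟦ τ ⟧ (observable-complete o) (observable-complete o′))
  observable-complete (_⊗_ {σ} {τ} o o′) =
    ×-complete ⟦ σ ⟧ ⟦ τ ⟧ (observable-complete o) (observable-complete o′)

  firstOrder-complete : ∀ {τ} → FirstOrder τ → Complete ⟦ τ ⟧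
  firstOrder-complete (result o)         = observable-complete o
  firstOrder-complete (_⇒_ {σ} {τ} _ φ) = ⇨-complete ⟦ σ ⟧ ⟦ τ ⟧ (firstOrder-complete φ)

  applied-firstOrder : ∀ {τ} {t : Term τ} → Applied t → FirstOrder τ
  applied-firstOrder (con f _) = firstOrder f
  applied-firstOrder (p · _) with applied-firstOrder p
  ... | result (basic ())
  ... | _ ⇒ φ = φ

  -- Constants and values under relabelling

  module _ {A : Set} {θ : A → Interval} where

    -- Only the shape matters, so the derivation found at the labelling `θ` is replayed at every
    -- `φ`. The `Relabelled` argument lets the generic term be inverted along with it.
    constant-at : ∀ {σ} {a : Tm A [] σ} {a′} → Constant a′ → Relabelled θ a a′ →
                  ∀ φ → Constant (relabel φ a)
    constant-at (leaf _)    (leaf x _) φ = leaf (φ x)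
    constant-at (con b _ _) (con c n)  φ = con b c n

    applied-at : ∀ {τ} {t : Tm A [] τ} {t′} → Applied t′ → Relabelled θ t t′ →
                 ∀ φ → Applied (relabel φ t)
    applied-at (con _ _) (con c n) φ = con c n
    applied-at (p · q)   (m · n)   φ = applied-at p m φ · constant-at q n φ

    value-at : ∀ {τ} {V : Tm A [] τ} {V′} → Value V′ → Relabelled θ V V′ →
               ∀ φ → Value (relabel φ V)
    value-at (constant q) m          φ = constant (constant-at q m φ)
    value-at (lam _)      (lam _)    φ = lam _
    value-at (ret v)      (ret m)    φ = ret (value-at v m φ)
    value-at (pair v w)   (pair m n) φ = pair (value-at v m φ) (value-at w n φ)
    value-at (ι₁ v)       (ι₁ m)     φ = ι₁ (value-at v m φ)
    value-at (ι₂ v)       (ι₂ m)     φ = ι₂ (value-at v m φ)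
    value-at (partial p)  m          φ = partial (applied-at p m φ)

    constant-den-continuous : ∀ {σ} {a : Tm A [] σ} {a′} (q : Constant a′) (m : Relabelled θ a a′) →
      ScottContinuous (Labels A) ⟦ σ ⟧ (λ φ → constant-den (constant-at q m φ))
    constant-den-continuous (leaf _) (leaf x _) =
      ∘-continuous {Labels A} {𝐈ℝ} {Lift⊥ 𝐈ℝ} (embedding-continuous (lift-embedding 𝐈ℝ)) (label-continuous x)
    constant-den-continuous {σ} (con _ _ _) (con c _) = const-continuous {Labels A} {⟦ σ ⟧} (den c)

    applied-den-continuous : ∀ {τ} {t : Tm A [] τ} {t′} (p : Applied t′) (m : Relabelled θ t t′) →
      ScottContinuous (Labels A) ⟦ τ ⟧ (λ φ → applied-den (applied-at p m φ))
    applied-den-continuous {τ} (con _ _) (con c _) = const-continuous {Labels A} {⟦ τ ⟧} (den c)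
    applied-den-continuous {τ} (_·_ {σ} p q) (m · n) =
      application-continuous {Labels A} ⟦ σ ⟧ ⟦ τ ⟧ (firstOrder-complete (applied-firstOrder (p · q)))
        (applied-den-continuous p m) (constant-den-continuous q n)

  -- Evaluation contexts under relabelling

  -- A decomposition of M as a context around L, in a form that can be
  -- instantiated at every labelling: plug ι fills the hole with a term that
  -- may carry labels other than those of the context.
  record Surrounds {A ρ τ} {𝒞 : Set} (_⟪_⟫ : 𝒞 → Term ρ → Term τ)
                   (L : Tm A [] ρ) (M : Tm A [] τ) : Set₁ where
    field
      at      : (A → Interval) → 𝒞
      plug    : ∀ {B : Set} → (A → B) → Tm B [] ρ → Tm B [] τ
      plug-at : ∀ {B : Set} (ι : A → B) (θ : B → Interval) N →
                relabel θ (plug ι N) ≡ at (θ ∘ ι) ⟪ relabel θ N ⟫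
      plugged : M ≡ plug id L

  open Surrounds

  Decomposes : ∀ {A ρ τ} {𝒞 : Set} → (𝒞 → Term ρ → Term τ) → (A → Interval) → Term ρ → Tm A [] τ → Set₁
  Decomposes _⟪_⟫ θ L M = ∃ λ L₀ → Relabelled θ L₀ L × Surrounds _⟪_⟫ L₀ M

  module _ {A : Set} {ρ σ τ : Ty} {𝒞 𝒞′ : Set} {_⟪_⟫ : 𝒞 → Term ρ → Term σ} {_⟪_⟫′ : 𝒞′ → Term ρ → Term τ}
           (f : ∀ {B : Set} → (A → B) → Tm B [] σ → Tm B [] τ)
           (F : (A → Interval) → 𝒞 → 𝒞′)
           (natural : ∀ {B : Set} (ι : A → B) (θ : B → Interval) (N : Tm B [] σ) →
                      relabel θ (f ι N) ≡ f (θ ∘ ι) (relabel θ N))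
           (F-f : ∀ θ E N → F θ E ⟪ N ⟫′ ≡ f θ (E ⟪ N ⟫)) where

    -- Adds one frame to a decomposition: `f` builds it on terms and `F` on contexts. The map `ι` is
    -- passed to `f` because the side terms of the frame carry labels from `A`, whereas the hole
    -- carries labels from `B`.
    extend : ∀ {θ L M M′} → M′ ≡ f id M → Decomposes _⟪_⟫ θ L M → Decomposes _⟪_⟫′ θ L M′
    extend e (L₀ , m , s) = L₀ , m , record
      { at      = λ θ → F θ (at s θ)
      ; plug    = λ ι N → f ι (plug s ι N)
      ; plug-at = λ ι θ N → trans (natural ι θ (plug s ι N))
                    (trans (cong (f (θ ∘ ι)) (plug-at s ι θ N)) (sym (F-f (θ ∘ ι) _ _)))
      ; plugged = trans e (cong (f id) (plugged s))
      }

  unrelabel : ∀ {A Δ τ} (M : Tm A Δ τ) → M ≡ relabel id M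
  unrelabel M = sym (fill-erase M)

  decomposeʷ : ∀ {A ρ τ} {θ : A → Interval} (E : WeakCtx ρ τ) {L} {M : Tm A [] τ} →
               Relabelled θ M (E ⟨ L ⟩ʷ) → Decomposes _⟨_⟩ʷ θ L M
  decomposeʷ □ {M = M} m = M , m , record
    { at = λ _ → □ ; plug = λ _ N → N ; plug-at = λ _ _ _ → refl ; plugged = refl }
  decomposeʷ (score E) (score m) = extend (λ _ → score) (λ _ → score) (λ _ _ _ → refl) (λ _ _ _ → refl)
    refl (decomposeʷ E m)
  decomposeʷ (E · _) (_·_ {M = M} {N = N} m _) = extend (λ ι X → X · relabel ι N) (λ θ E → E · relabel θ N)
    (λ ι θ X → cong (relabel θ X ·_) (relabel-∘ θ ι N)) (λ _ _ _ → refl)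
    (cong (M ·_) (unrelabel N)) (decomposeʷ E m)
  decomposeʷ (bind E _) (bind {M = M} {N = N} m _) = extend (λ ι X → bind X (relabel ι N)) (λ θ E → bind E (relabel θ N))
    (λ ι θ X → cong (bind (relabel θ X)) (relabel-∘ θ ι N)) (λ _ _ _ → refl)
    (cong (bind M) (unrelabel N)) (decomposeʷ E m)
  decomposeʷ (arg p E) (_·_ {M = t} {N = N} n m) = extend (λ ι X → relabel ι t · X) (λ θ E → arg (applied-at p n θ) E)
    (λ ι θ X → cong (_· relabel θ X) (relabel-∘ θ ι t)) (λ _ _ _ → refl)
    (cong (_· N) (unrelabel t)) (decomposeʷ E m)
  decomposeʷ (case E _ _) (case {M = M} {N} {P} m _ _) = extend
    (λ ι X → case X (relabel ι N) (relabel ι P)) (λ θ E → case E (relabel θ N) (relabel θ P))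
    (λ ι θ X → cong₂ (case (relabel θ X)) (relabel-∘ θ ι N) (relabel-∘ θ ι P)) (λ _ _ _ → refl)
    (cong₂ (case M) (unrelabel N) (unrelabel P)) (decomposeʷ E m)
  decomposeʷ (π₁ E) (π₁ m) = extend (λ _ → π₁) (λ _ → π₁) (λ _ _ _ → refl) (λ _ _ _ → refl)
    refl (decomposeʷ E m)
  decomposeʷ (π₂ E) (π₂ m) = extend (λ _ → π₂) (λ _ → π₂) (λ _ _ _ → refl) (λ _ _ _ → refl)
    refl (decomposeʷ E m)

  decompose : ∀ {A ρ τ} {θ : A → Interval} (E : Ctx ρ τ) {L} {M : Tm A [] τ} →
              Relabelled θ M (E ⟨ L ⟩) → Decomposes _⟨_⟩ θ L M
  decompose (weak E) m = extend (λ _ X → X) (λ _ → weak) (λ _ _ _ → refl) (λ _ _ _ → refl)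
    refl (decomposeʷ E m)
  decompose (ret E) (ret m) = extend (λ _ → ret) (λ _ → ret) (λ _ _ _ → refl) (λ _ _ _ → refl)
    refl (decompose E m)
  decompose (pairˡ E _) (pair {M = M} {N} m _) = extend (λ ι X → pair X (relabel ι N)) (λ θ E → pairˡ E (relabel θ N))
    (λ ι θ X → cong (pair (relabel θ X)) (relabel-∘ θ ι N)) (λ _ _ _ → refl)
    (cong (pair M) (unrelabel N)) (decompose E m)
  decompose (pairʳ v E) (pair {M = V} {N} n m) = extend (λ ι X → pair (relabel ι V) X) (λ θ E → pairʳ (value-at v n θ) E)
    (λ ι θ X → cong (λ W → pair W (relabel θ X)) (relabel-∘ θ ι V)) (λ _ _ _ → refl)
    (cong (λ W → pair W N) (unrelabel V)) (decompose E m)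
  decompose (ι₁ E) (ι₁ m) = extend (λ _ → ι₁) (λ _ → ι₁) (λ _ _ _ → refl) (λ _ _ _ → refl)
    refl (decompose E m)
  decompose (ι₂ E) (ι₂ m) = extend (λ _ → ι₂) (λ _ → ι₂) (λ _ _ _ → refl) (λ _ _ _ → refl)
    refl (decompose E m)

  -- Literals of observable values

  observable-up : ∀ τ {v w} → ⟦ τ ⟧ ⊢ v ≤ w → Observable τ v → Observable τ w
  observable-up unit    (⊥₋≤ _) o = ⊥-elim (o refl)
  observable-up unit    [ _ ]   o = λ ()
  observable-up void    (⊥₋≤ _) o = ⊥-elim (o refl)
  observable-up void    [ _ ]   o = λ ()
  observable-up int     (⊥₋≤ _) o = ⊥-elim (o refl)
  observable-up int     [ _ ]   o = λ ()
  observable-up real    (⊥₋≤ _) o = ⊥-elim (o refl)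
  observable-up real    [ _ ]   o = λ ()
  observable-up (σ ⊕ τ) [ inj₁≤ l ] o = observable-up σ l o
  observable-up (σ ⊕ τ) [ inj₂≤ l ] o = observable-up τ l o
  observable-up (σ ⊗ τ) (l , l′) (o , o′) = observable-up σ l o , observable-up τ l′ o′

  literal-mono : ∀ τ {v w} → ⟦ τ ⟧ ⊢ v ≤ w → ∀ o o′ → literal τ v o ≲ literal τ w o′
  literal-mono unit    (⊥₋≤ _)  o o′ = ⊥-elim (o refl)
  literal-mono unit    [ _ ]    o o′ = ≲-refl _
  literal-mono void    (⊥₋≤ _)  o o′ = ⊥-elim (o refl)
  literal-mono int     (⊥₋≤ _)  o o′ = ⊥-elim (o refl)
  literal-mono int     [ refl ] o o′ = ≲-refl _
  literal-mono real    (⊥₋≤ _)  o o′ = ⊥-elim (o refl)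
  literal-mono real    [ l ]    o o′ = leaf l
  literal-mono (σ ⊕ τ) [ inj₁≤ l ] o o′ = ι₁ (literal-mono σ l o o′)
  literal-mono (σ ⊕ τ) [ inj₂≤ l ] o o′ = ι₂ (literal-mono τ l o o′)
  literal-mono (σ ⊗ τ) (l , l′) (o , o₁) (o′ , o₁′) = pair (literal-mono σ l o o′) (literal-mono τ l′ o₁ o₁′)

  -- Scott-open sets of terms; no poset of terms is needed to speak about
  -- them.
  record OpenTerms {τ} (k : Term τ → Bool) : Set where
    field
      ≲-upward  : ∀ {M N} → M ≲ N → T (k M) → T (k N)
      fill-open : ∀ T → IsScottOpen (Labels (fv T)) (k ∘ fill T)

  open OpenTerms

  fixʳ-continuous : ∀ {A B : Set} (l : B → Interval) →
                    ScottContinuous (Labels A) (Labels (A ⊎ B)) (λ θ → [ θ , l ]′)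
  fixʳ-continuous {A} l = labelling-continuous {P = Labels A} λ
    { (inj₁ a) → label-continuous a
    ; (inj₂ b) → const-continuous {Labels A} {𝐈ℝ} (l b)
    }

  fixˡ-continuous : ∀ {A B : Set} (θ : A → Interval) →
                    ScottContinuous (Labels B) (Labels (A ⊎ B)) (λ l → [ θ , l ]′)
  fixˡ-continuous {B = B} θ = labelling-continuous {P = Labels B} λ
    { (inj₁ a) → const-continuous {Labels B} {𝐈ℝ} (θ a)
    ; (inj₂ b) → label-continuous b
    }

  -- Writing `N` as a labelling of its own template turns the set into the preimage of an open set
  -- for `pair T (erase N)`, the labels of `N` being held fixed.
  pairˡ-open : ∀ {σ τ} {k : Term (σ ⊗ τ) → Bool} → OpenTerms k → ∀ N → OpenTerms (λ M → k (pair M N))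
  pairˡ-open {k = k} K N = record
    { ≲-upward  = λ l → ≲-upward K (pair l (≲-refl N))
    ; fill-open = λ T → subst (λ N → IsScottOpen (Labels (fv T)) (λ l → k (pair (fill T l) N))) (fill-erase N)
        (Scott-continuous⇒continuous (Labels (fv T)) (Labels (fv T ⊎ fv (erase N)))
          (fixʳ-continuous (labels N)) _ (fill-open K (pair T (erase N))))
    }

  pairʳ-open : ∀ {σ τ} {k : Term (σ ⊗ τ) → Bool} → OpenTerms k → ∀ M → OpenTerms (λ N → k (pair M N))
  pairʳ-open {k = k} K M = record
    { ≲-upward  = λ l → ≲-upward K (pair (≲-refl M) l)
    ; fill-open = λ T → subst (λ M → IsScottOpen (Labels (fv T)) (λ l → k (pair M (fill T l)))) (fill-erase M)
        (Scott-continuous⇒continuous (Labels (fv T)) (Labels (fv (erase M) ⊎ fv T))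
          (fixˡ-continuous (labels M)) _ (fill-open K (pair (erase M) T)))
    }

  ι₁-open : ∀ {σ τ} {k : Term (σ ⊕ τ) → Bool} → OpenTerms k → OpenTerms (λ M → k (ι₁ M))
  ι₁-open K = record { ≲-upward = λ l → ≲-upward K (ι₁ l) ; fill-open = λ T → fill-open K (ι₁ T) }

  ι₂-open : ∀ {σ τ} {k : Term (σ ⊕ τ) → Bool} → OpenTerms k → OpenTerms (λ M → k (ι₂ M))
  ι₂-open K = record { ≲-upward = λ l → ≲-upward K (ι₂ l) ; fill-open = λ T → fill-open K (ι₂ T) }

  leaf-open : ∀ {k : Term real → Bool} → OpenTerms k → IsScottOpen 𝐈ℝ (λ 𝐚 → k (leaf 𝐚))
  leaf-open K = Scott-continuous⇒continuous 𝐈ℝ (Labels ⊤)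
    (labelling-continuous {P = 𝐈ℝ} (λ _ → id-continuous)) _ (fill-open K (leaf tt))

  LiteralIn : ∀ τ → (Term τ → Bool) → ∣ ⟦ τ ⟧ ∣ → Set
  LiteralIn τ k v = ∃ λ o → T (k (literal τ v o))

  -- A genuine limit occurs only at `real`, where it is absorbed by the openness of `k`. The
  -- discrete information, namely an integer or the choice of a summand, is already attained by a
  -- member of the family.
  literal-reached : ∀ τ {k} → OpenTerms k → ∀ {I : Set} (x : I → ∣ ⟦ τ ⟧ ∣) → Directed ⟦ τ ⟧ x →
                    ∀ s → IsLub ⟦ τ ⟧ x s → LiteralIn τ k s → ∃[ i ] LiteralIn τ k (x i)
  literal-reached unit K x d ⊥₋ l (o , m) = ⊥-elim (o refl)
  literal-reached unit {k} K x d [ _ ] l (o , m) =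
    let (i , y , e) = reaches-proper (discrete _) x l in i , subst (LiteralIn unit k) (sym e) ((λ ()) , m)
  literal-reached void K x d ⊥₋ l (o , m) = ⊥-elim (o refl)
  literal-reached int K x d ⊥₋ l (o , m) = ⊥-elim (o refl)
  literal-reached int {k} K x d [ n ] l (o , m) =
    let (i , y , e) = reaches-proper (discrete _) x l in
    i , same (x i) e (upper l i)
    where
    same : ∀ v {y} → v ≡ [ y ] → ⟦ int ⟧ ⊢ v ≤ [ n ] → LiteralIn int k v
    same _ refl [ refl ] = (λ ()) , m
  literal-reached real K x d ⊥₋ l (o , m) = ⊥-elim (o refl)
  literal-reached real {k} K x d [ 𝐚 ] l (o , m) =
    let open Part (lift-embedding 𝐈ℝ) x d (reaches-proper 𝐈ℝ x l)
        ((i , y , e) , m′) = reached (leaf-open K) part-directed (part-lub l) m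
    in i , subst (LiteralIn real k) (sym e) ((λ ()) , m′)
  literal-reached (σ ⊕ τ) {k} K x d [ inj₁ v ] l (o , m) =
    let P = ⊎-poset ⟦ σ ⟧ ⟦ τ ⟧
        module A = Part (lift-embedding P) x d (reaches-proper P x l)
        module B = Part (inj₁-embedding ⟦ σ ⟧ ⟦ τ ⟧) A.part A.part-directed
                     (reaches-inj₁ ⟦ σ ⟧ ⟦ τ ⟧ A.part A.part-directed (A.part-lub l))
        (((i , y , e) , z , e′) , o′ , m′) =
          literal-reached σ (ι₁-open K) B.part B.part-directed v (B.part-lub (A.part-lub l)) (o , m)
    in i , subst (LiteralIn (σ ⊕ τ) k) (sym (trans e (cong [_] e′))) (o′ , m′)
  literal-reached (σ ⊕ τ) {k} K x d [ inj₂ w ] l (o , m) =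
    let P = ⊎-poset ⟦ σ ⟧ ⟦ τ ⟧
        module A = Part (lift-embedding P) x d (reaches-proper P x l)
        module B = Part (inj₂-embedding ⟦ σ ⟧ ⟦ τ ⟧) A.part A.part-directed
                     (reaches-inj₂ ⟦ σ ⟧ ⟦ τ ⟧ A.part A.part-directed (A.part-lub l))
        (((i , y , e) , z , e′) , o′ , m′) =
          literal-reached τ (ι₂-open K) B.part B.part-directed w (B.part-lub (A.part-lub l)) (o , m)
    in i , subst (LiteralIn (σ ⊕ τ) k) (sym (trans e (cong [_] e′))) (o′ , m′)
  literal-reached (σ ⊗ τ) {k} K x d (v , w) l ((o , o′) , m) =
    -- The components are approximated one at a time: the first with the second held at its lub,
    -- then the second with the first held at member `i`. A common index above both finishes by
    -- monotonicity.
    let (i , oᵢ , mᵢ) = literal-reached σ (pairˡ-open K (literal τ w o′)) (proj₁ ∘ x)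
                          (proj₁-directed ⟦ σ ⟧ ⟦ τ ⟧ d) v (proj₁-lub ⟦ σ ⟧ ⟦ τ ⟧ l) (o , m)
        (j , oⱼ , mⱼ) = literal-reached τ (pairʳ-open K (literal σ (proj₁ (x i)) oᵢ)) (proj₂ ∘ x)
                          (proj₂-directed ⟦ σ ⟧ ⟦ τ ⟧ d) w (proj₂-lub ⟦ σ ⟧ ⟦ τ ⟧ l) (o′ , mᵢ)
        (n , (i≤n , _) , (_ , j≤n)) = join d i j
        oₙ  = observable-up σ i≤n oᵢ
        oₙ′ = observable-up τ j≤n oⱼ
    in n , (oₙ , oₙ′) , ≲-upward K (pair (literal-mono σ i≤n oᵢ oₙ) (literal-mono τ j≤n oⱼ oₙ′)) mⱼ

  -- Continuity of plugging a term into a context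

  -- Comparable terms have the same template, so it is enough to compare two labellings of one
  -- template.
  configuration-mono : ∀ {τ υ} (f : Term τ → Term υ) →
    (∀ T {l l′} → (∀ x → 𝐈ℝ ⊢ l x ≤ l′ x) → configuration (f (fill T l)) ≤ᶜ configuration (f (fill T l′))) →
    ∀ {M N} → M ≲ N → configuration (f M) ≤ᶜ configuration (f N)
  configuration-mono f h {M} {N} l =
    subst₂ (λ X Y → configuration (f X) ≤ᶜ configuration (f Y)) (fill-erase M) (fill-erase N)
      (go (≲⇒≤ᶜ l))
    where
    go : ∀ {M N θ θ′} → conf M θ ≤ᶜ conf N θ′ → configuration (f (fill M θ)) ≤ᶜ configuration (f (fill N θ′))
    go (pointwise p) = h _ p

  module Hole {A : Set} {ρ τ : Ty} {𝒞 : Set} {_⟪_⟫ : 𝒞 → Term ρ → Term τ} {L : Tm A [] ρ} {M : Tm A [] τ}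
              (s : Surrounds _⟪_⟫ L M) where

    private
      filled : ∀ T → (A ⊎ fv T → Interval) → Configuration
      filled T φ = configuration (at s (φ ∘ inj₁) ⟪ fill T (φ ∘ inj₂) ⟫)

      -- Context and content with separate labels form a single term over `A ⊎ fv T`, so continuity
      -- holds jointly. Fixing one summand gives continuity in the other.
      filled-continuous : ∀ T → ScottContinuous (Labels (A ⊎ fv T)) Γ (filled T)
      filled-continuous T = subst-continuous
        (λ φ → cong configuration (trans (plug-at s inj₁ φ (fill T inj₂))
          (cong (at s (φ ∘ inj₁) ⟪_⟫) (relabel-fill φ T inj₂))))
        (configuration-continuous (plug s inj₁ (fill T inj₂)))
        where
        subst-continuous : ∀ {f g : (A ⊎ fv T → Interval) → Configuration} → (∀ φ → f φ ≡ g φ) →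
          ScottContinuous (Labels (A ⊎ fv T)) Γ f → ScottContinuous (Labels (A ⊎ fv T)) Γ g
        subst-continuous e = continuous-resp {Labels (A ⊎ fv T)} {Γ}
          (λ φ → Poset.reflexive Γ (Poset.Eq.reflexive Γ (e φ)))
          (λ φ → Poset.reflexive Γ (Poset.Eq.reflexive Γ (sym (e φ))))

    context-continuous : ∀ T l → ScottContinuous (Labels A) Γ (λ θ → configuration (at s θ ⟪ fill T l ⟫))
    context-continuous T l =
      ∘-continuous {Labels A} {Labels (A ⊎ fv T)} {Γ} (filled-continuous T) (fixʳ-continuous l)

    content-continuous : ∀ θ T → ScottContinuous (Labels (fv T)) Γ (λ l → configuration (at s θ ⟪ fill T l ⟫))
    content-continuous θ T =
      ∘-continuous {Labels (fv T)} {Labels (A ⊎ fv T)} {Γ} (filled-continuous T) (fixˡ-continuous θ)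

    context-continuous′ : ∀ N → ScottContinuous (Labels A) Γ (λ θ → configuration (at s θ ⟪ N ⟫))
    context-continuous′ N = subst (λ X → ScottContinuous (Labels A) Γ (λ θ → configuration (at s θ ⟪ X ⟫)))
      (fill-erase N) (context-continuous (erase N) (labels N))

    content-open : ∀ θ {U} → IsScottOpen Γ U → OpenTerms (λ N → U (configuration (at s θ ⟪ N ⟫)))
    content-open θ u = record
      { ≲-upward  = λ l → upward u (configuration-mono (at s θ ⟪_⟫) (λ T p → mono (content-continuous θ T) p) l)
      ; fill-open = λ T → Scott-continuous⇒continuous (Labels (fv T)) Γ (content-continuous θ T) _ u
      }

    relabel-plugged : ∀ θ → relabel θ M ≡ at s θ ⟪ relabel θ L ⟫
    relabel-plugged θ = trans (cong (relabel θ) (plugged s)) (plug-at s id θ L)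

  -- Rules as continuous families of valuations

  record Family {A τ} (M : Tm A [] τ) : Set where
    field
      next       : (A → Interval) → ContinuousValuation (Scott Γ)
      reduces    : ∀ θ → relabel θ M ⟶ next θ
      continuous : ScottContinuous (Labels A) (𝐕 (Scott Γ)) next

  module _ {A : Set} {ρ τ : Ty} {𝒞 : Set} {_⟪_⟫ : 𝒞 → Term ρ → Term τ} {L : Tm A [] ρ} {M : Tm A [] τ}
           (s : Surrounds _⟪_⟫ L M) where

    open Hole s

    pure-family : (R : Tm A [] ρ) →
      (∀ θ → at s θ ⟪ relabel θ L ⟫ ⟶ δ (configuration (at s θ ⟪ relabel θ R ⟫))) → Family M
    pure-family R h = record
      { next       = λ θ → δ (configuration (relabel θ (plug s id R)))
      ; reduces    = λ θ → subst₂ (λ X Y → X ⟶ δ (configuration Y))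
                       (sym (relabel-plugged θ)) (sym (plug-at s id θ R)) (h θ)
      ; continuous = δ-continuous (configuration-continuous (plug s id R))
      }

    family-by : (next : (A → Interval) → ContinuousValuation (Scott Γ)) →
      (∀ θ → at s θ ⟪ relabel θ L ⟫ ⟶ next θ) →
      ScottContinuous (Labels A) (𝐕 (Scott Γ)) next → Family M
    family-by next h c = record
      { next       = next
      ; reduces    = λ θ → subst (_⟶ next θ) (sym (relabel-plugged θ)) (h θ)
      ; continuous = c
      }

  -- Reduction of applied constants

  -- The decision is an argument, so that facts about `discharge` can be proved by matching on it.
  dischargeBy : ∀ {τ υ} → Ctx τ υ → (v : ∣ ⟦ τ ⟧ ∣) → Dec (Observable τ v) → ContinuousValuation (Scott Γ)
  dischargeBy {τ} E v (yes o) = δ (configuration (E ⟨ literal τ v o ⟩))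
  dischargeBy     E v (no _)  = 𝟎

  discharge : ∀ {τ υ} → Ctx τ υ → ∣ ⟦ τ ⟧ ∣ → ContinuousValuation (Scott Γ)
  discharge E v = dischargeBy E v lem

  discharge-reduces : ∀ {σ τ υ} (E : Ctx τ υ) {t : Term (σ ⇒ τ)} {a : Term σ}
    (p : Applied t) (q : Constant a) → ObservableTy τ → E ⟨ t · a ⟩ ⟶ discharge E (applied-den (p · q))
  discharge-reduces {τ = τ} E p q ot = by lem
    where
    by : (o? : Dec (Observable τ (applied-den (p · q)))) → E ⟨ _ · _ ⟩ ⟶ dischargeBy E (applied-den (p · q)) o?
    by (yes o) = delta E p q ot o
    by (no ¬o) = delta-⊥ E p q ot ¬o

  module _ {A : Set} {ρ τ : Ty} {L : Tm A [] ρ} {M : Tm A [] τ} (s : Surrounds _⟨_⟩ L M)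
           {v : (A → Interval) → ∣ ⟦ ρ ⟧ ∣} (cv : ScottContinuous (Labels A) ⟦ ρ ⟧ v) where

    open Hole s

    -- The labellings at which `discharge` gives `U` the value `1⁺`; by `≤value` and `value≤`, its
    -- value at `U` is the indicator of this set.
    W : ℙ Configuration → ℙ (A → Interval)
    W U θ = ⌜ LiteralIn ρ (λ N → U (configuration (at s θ ⟨ N ⟩))) (v θ) ⌝

    ≤value : ∀ U u θ o? → ℝ̄₊-poset ⊢ indicator {Scott Γ} (W U θ) ≤ value (dischargeBy (at s θ) (v θ) o?) (U , u)
    ≤value U u θ (yes o) = indicator-mono {Scott Γ} (W U θ) (U (configuration (at s θ ⟨ literal ρ (v θ) o ⟩)))
      (λ m → let (o′ , m′) = held m in
         -- The two proofs of observability may differ; `literal-mono` at a reflexive inequality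
         -- bridges them.
         ≲-upward (content-open θ u) (literal-mono ρ (Poset.refl ⟦ ρ ⟧) o′ o) m′)
    ≤value U u θ (no ¬o) = indicator-mono {Scott Γ} (W U θ) false (λ m → ¬o (proj₁ (held m)))

    value≤ : ∀ U u θ o? → ℝ̄₊-poset ⊢ value (dischargeBy (at s θ) (v θ) o?) (U , u) ≤ indicator {Scott Γ} (W U θ)
    value≤ U u θ (yes o) = indicator-mono {Scott Γ} (U (configuration (at s θ ⟨ literal ρ (v θ) o ⟩))) (W U θ)
      (λ m → holds (o , m))
    value≤ U u θ (no _)  = 0⁺-least (indicator {Scott Γ} (W U θ))

    moved : ∀ {U} (u : IsScottOpen Γ U) {θ θ′} → Labels A ⊢ θ ≤ θ′ → ∀ {N N′} → N ≲ N′ →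
            T (U (configuration (at s θ ⟨ N ⟩))) → T (U (configuration (at s θ′ ⟨ N′ ⟩)))
    moved u {θ} {θ′} p {N} l m = ≲-upward (content-open θ′ u) l (upward u (mono (context-continuous′ N) {θ} {θ′} p) m)

    InW : ℙ Configuration → (A → Interval) → Set
    InW U θ = LiteralIn ρ (λ N → U (configuration (at s θ ⟨ N ⟩))) (v θ)

    W-up : ∀ {U} → IsScottOpen Γ U → ∀ {θ θ′} → Labels A ⊢ θ ≤ θ′ → InW U θ → InW U θ′
    W-up u {θ} {θ′} p (o , m) = o′ , moved u {θ} {θ′} p (literal-mono ρ (mono cv p) o o′) m
      where
      o′ : Observable ρ (v θ′)
      o′ = observable-up ρ (mono cv p) o

    module _ {U : ℙ Configuration} (u : IsScottOpen Γ U) {I : Set} (x : I → A → Interval)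
             (d : Directed (Labels A) x) {θ : A → Interval} (l : IsLub (Labels A) x θ) where

      content-reached : InW U θ → ∃[ i ] LiteralIn ρ (λ N → U (configuration (at s θ ⟨ N ⟩))) (v (x i))
      content-reached = literal-reached ρ (content-open θ u) (v ∘ x)
        (mono-directed {Labels A} {⟦ ρ ⟧} cv d) (v θ) (preserves {Labels A} {⟦ ρ ⟧} cv d l)

      context-reached : ∀ N → T (U (configuration (at s θ ⟨ N ⟩))) → ∃[ j ] T (U (configuration (at s (x j) ⟨ N ⟩)))
      context-reached N = reached {Labels A} (Scott-continuous⇒continuous (Labels A) Γ (context-continuous′ N) U u) d l

      -- The literal and the context both vary with the labelling. The literal is approximated
      -- inside the context of the lub, then the context around that literal, and a common index
      -- dominates both.
      W-reached : InW U θ → ∃[ i ] InW U (x i)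
      W-reached m =
        let (i , oᵢ , mᵢ) = content-reached m
            (j , mⱼ)      = context-reached (literal ρ (v (x i)) oᵢ) mᵢ
        in joined i oᵢ j mⱼ (join d i j)
        where
        joined : ∀ i oᵢ j → T (U (configuration (at s (x j) ⟨ literal ρ (v (x i)) oᵢ ⟩))) →
                 ∃[ k ] Labels A ⊢ x i ≤ x k × Labels A ⊢ x j ≤ x k → ∃[ i ] InW U (x i)
        joined i oᵢ j m (k , i≤k , j≤k) = k , oₖ
          , moved u {x j} {x k} j≤k (literal-mono ρ (mono cv {x i} {x k} i≤k) oᵢ oₖ) m
          where
          oₖ : Observable ρ (v (x k))
          oₖ = observable-up ρ (mono cv {x i} {x k} i≤k) oᵢ

    W-open : ∀ U → IsScottOpen Γ U → IsScottOpen (Labels A) (W U)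
    W-open U u = record
      { upward       = λ {θ} {θ′} p m → holds {InW U θ′} (W-up u {θ} {θ′} p (held {InW U θ} m))
      ; inaccessible = inacc
      }
      where
      inacc : ∀ D → IsDirected (Labels A) D → ∀ {θ} → IsLub (Labels A) (members D) θ → θ ∈ W U →
              ∃[ θ′ ] θ′ ∈ D × θ′ ∈ W U
      inacc D d {θ} l m = go (W-reached u (members D) (members-directed (Labels A) d) {θ} l (held {InW U θ} m))
        where
        go : ∃[ i ] InW U (members D i) → ∃[ θ′ ] θ′ ∈ D × θ′ ∈ W U
        go ((θ′ , θ′∈D) , m′) = θ′ , θ′∈D , holds {InW U θ′} m′

    discharge-continuous : ScottContinuous (Labels A) (𝐕 (Scott Γ)) (λ θ → discharge (at s θ) (v θ))
    discharge-continuous = 𝐕-continuous (λ (U , u) → continuous-resp {Labels A} {ℝ̄₊-poset}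
      (λ θ → ≤value U u θ lem) (λ θ → value≤ U u θ lem) (indicator-continuous {Scott Γ} (W-open U u)))
  successor : ∀ {τ ν} {M : Term τ} → M ⟶ ν → ContinuousValuation (Scott Γ)
  successor {ν = ν} _ = ν

  module _ {A : Set} {τ : Ty} {L : Tm A [] (𝐃 real)} {M : Tm A [] τ} (s : Surrounds _⟨_⟩ʷ L M) (μ : 𝓜) where

    -- The valuation is taken from the rule itself: writing the image again
    -- would lead to the comparison of two large proofs of openness.
    sampled-at : (A → Interval) → ContinuousValuation (Scott Γ)
    sampled-at θ = successor (sampling (at s θ) μ)

    sampled-at-continuous : ScottContinuous (Labels A) (𝐕 (Scott Γ)) sampled-at
    sampled-at-continuous = image-continuous {Labels A} {Γ} {ℝ-space}
      (λ θ → sampled (at s θ)) (λ θ → sampled-continuous (at s θ))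
      (λ a → Hole.context-continuous′ s (ret (leaf (singleton a))))
      (valuation (measure μ)) sampled-at (λ θ U → (_ , _) , refl , refl)

  -- Inverting the relabelling exposes the redex with its parts as terms over `A`, and the same rule
  -- can then be instantiated at every labelling. `delta` and `delta-⊥` yield the same family.
  family : ∀ {A τ} {θ : A → Interval} {M : Tm A [] τ} {N ν} → Relabelled θ M N → N ⟶ ν → Family M
  family m (bind-ret E _ _) with decomposeʷ E m
  ... | _ , bind {N = N} (ret {M = M} _) _ , s = pure-family s (N [ M ]₀) λ θ →
    subst (λ X → at s θ ⟨ bind (ret (relabel θ M)) (relabel θ N) ⟩ʷ ⟶ δ (configuration (at s θ ⟨ X ⟩ʷ)))
      (sym (relabel-[]₀ θ N M))
      (bind-ret (at s θ) (relabel θ M) (relabel θ N))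
  family m (unfold E _) with decompose E m
  ... | _ , rec {M = M} _ , s = pure-family s (M · rec M) λ θ → unfold (at s θ) (relabel θ M)
  family m (beta E _ _) with decompose E m
  ... | _ , _·_ {N = N} (lam {M = M} _) _ , s = pure-family s (M [ N ]₀) λ θ →
    subst (λ X → at s θ ⟨ lam (relabel θ M) · relabel θ N ⟩ ⟶ δ (configuration (at s θ ⟨ X ⟩)))
      (sym (relabel-[]₀ θ M N))
      (beta (at s θ) (relabel θ M) (relabel θ N))
  family m (π₁-pair E _ _) with decompose E m
  ... | _ , π₁ (pair {M = M} {N} _ _) , s = pure-family s M λ θ → π₁-pair (at s θ) (relabel θ M) (relabel θ N)
  family m (π₂-pair E _ _) with decompose E m
  ... | _ , π₂ (pair {M = M} {N} _ _) , s = pure-family s N λ θ → π₂-pair (at s θ) (relabel θ M) (relabel θ N)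
  family m (case-ι₁ E _ _ _) with decompose E m
  ... | _ , case {N = N} {P} (ι₁ {M = M} _) _ _ , s = pure-family s (N · M) λ θ →
    case-ι₁ (at s θ) (relabel θ M) (relabel θ N) (relabel θ P)
  family m (case-ι₂ E _ _ _) with decompose E m
  ... | _ , case {N = N} {P} (ι₂ {M = M} _) _ _ , s = pure-family s (P · M) λ θ →
    case-ι₂ (at s θ) (relabel θ M) (relabel θ N) (relabel θ P)
  family m (sampling E μ) with decomposeʷ E m
  ... | _ , sample _ , s = family-by s (sampled-at s μ) (λ θ → sampling (at s θ) μ) (sampled-at-continuous s μ)
  family {A} m (scoring E _) with decomposeʷ E m
  ... | _ , score (leaf a _) , s = family-by s _ (λ θ → scoring (at s θ) (θ a))
    (·δ-continuous (Hole.context-continuous′ s (ret (con star (λ ()))))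
      (∘-continuous {Labels A} {𝐈ℝ} {ℝ̄₊-poset} abs-continuous (label-continuous a)))
  family m (delta E p q ot _) with decompose E m
  ... | _ , t · a , s = family-by s _ (λ θ → discharge-reduces (at s θ) (applied-at p t θ) (constant-at q a θ) ot)
    (discharge-continuous s (applied-den-continuous (p · q) (t · a)))
  family m (delta-⊥ E p q ot _) with decompose E m
  ... | _ , t · a , s = family-by s _ (λ θ → discharge-reduces (at s θ) (applied-at p t θ) (constant-at q a θ) ot)
    (discharge-continuous s (applied-den-continuous (p · q) (t · a)))

  -- Determinism

  data Head : ∀ {τ} → Term τ → Set where
    bind-ret : ∀ {σ τ} {M : Term σ} {N : Tm Interval (σ ∷ []) (𝐃 τ)} → Head (bind (ret M) N)
    unfold   : ∀ {σ} {M : Term (σ ⇒ σ)} → Head (rec M)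
    beta     : ∀ {σ τ} {M : Tm Interval (σ ∷ []) τ} {N} → Head (lam M · N)
    π₁-pair  : ∀ {σ τ} {M : Term σ} {N : Term τ} → Head (π₁ (pair M N))
    π₂-pair  : ∀ {σ τ} {M : Term σ} {N : Term τ} → Head (π₂ (pair M N))
    case-ι₁  : ∀ {σ τ υ} {M : Term σ} {N : Term (σ ⇒ υ)} {P : Term (τ ⇒ υ)} → Head (case (ι₁ M) N P)
    case-ι₂  : ∀ {σ τ υ} {M : Term τ} {N : Term (σ ⇒ υ)} {P : Term (τ ⇒ υ)} → Head (case (ι₂ M) N P)
    sampling : ∀ {μ} → Head (sample μ)
    scoring  : ∀ {𝐚} → Head (score (leaf 𝐚))
    delta    : ∀ {σ τ} {t : Term (σ ⇒ τ)} {a} → Applied t → Constant a → ObservableTy τ → Head (t · a)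

  -- Contexts and heads carry derivations, in `arg`, `pairʳ` and `delta`. Their uniqueness therefore
  -- rests on the irrelevance of these derivations.
  basic-irrelevant : ∀ {σ} (b b′ : Basic σ) → b ≡ b′
  basic-irrelevant unit unit = refl
  basic-irrelevant void void = refl
  basic-irrelevant int  int  = refl
  basic-irrelevant real real = refl

  constant-irrelevant : ∀ {σ} {a : Term σ} (p q : Constant a) → p ≡ q
  constant-irrelevant (leaf _)    (leaf _)     = refl
  constant-irrelevant (con b f n) (con b′ _ _) = cong (λ b → con b f n) (basic-irrelevant b b′)

  applied-irrelevant : ∀ {τ} {t : Term τ} (p q : Applied t) → p ≡ q
  applied-irrelevant (con _ _) (con _ _) = refl
  applied-irrelevant (p · q)   (p′ · q′) = cong₂ _·_ (applied-irrelevant p p′) (constant-irrelevant q q′)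

  observableTy-irrelevant : ∀ {τ} (o o′ : ObservableTy τ) → o ≡ o′
  observableTy-irrelevant (basic b) (basic b′) = cong basic (basic-irrelevant b b′)
  observableTy-irrelevant (o ⊕ p)   (o′ ⊕ p′)  = cong₂ _⊕_ (observableTy-irrelevant o o′) (observableTy-irrelevant p p′)
  observableTy-irrelevant (o ⊗ p)   (o′ ⊗ p′)  = cong₂ _⊗_ (observableTy-irrelevant o o′) (observableTy-irrelevant p p′)

  value-irrelevant : ∀ {τ} {V : Term τ} (v w : Value V) → v ≡ w
  value-irrelevant (constant p) (constant q)  = cong constant (constant-irrelevant p q)
  -- As a `constant` it would have a basic type, as a `partial` value a function type.
  value-irrelevant (constant (con () _ _)) (partial (con _ _))
  value-irrelevant (lam _)      (lam _)       = refl
  value-irrelevant (ret v)      (ret w)       = cong ret (value-irrelevant v w)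
  value-irrelevant (pair v v′)  (pair w w′)   = cong₂ pair (value-irrelevant v w) (value-irrelevant v′ w′)
  value-irrelevant (ι₁ v)       (ι₁ w)        = cong ι₁ (value-irrelevant v w)
  value-irrelevant (ι₂ v)       (ι₂ w)        = cong ι₂ (value-irrelevant v w)
  value-irrelevant (partial (con _ _)) (constant (con () _ _))
  value-irrelevant (partial p)  (partial q)   = cong partial (applied-irrelevant p q)

  head-irrelevant : ∀ {τ} {L : Term τ} (h h′ : Head L) → h ≡ h′
  head-irrelevant bind-ret bind-ret = refl
  head-irrelevant unfold   unfold   = refl
  head-irrelevant beta     beta     = refl
  head-irrelevant π₁-pair  π₁-pair  = refl
  head-irrelevant π₂-pair  π₂-pair  = refl
  head-irrelevant case-ι₁  case-ι₁  = refl
  head-irrelevant case-ι₂  case-ι₂  = refl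
  head-irrelevant sampling sampling = refl
  head-irrelevant scoring  scoring  = refl
  head-irrelevant (delta p q o) (delta p′ q′ o′)
    with refl ← applied-irrelevant p p′ | refl ← constant-irrelevant q q′ | refl ← observableTy-irrelevant o o′ = refl

  -- Equality of terms, in a form that can be inverted by pattern matching.
  Same : ∀ {Δ τ} → Tm Interval Δ τ → Tm Interval Δ τ → Set
  Same = Relabelled id

  same⇒≡ : ∀ {Δ τ} {M N : Tm Interval Δ τ} → Same M N → M ≡ N
  same⇒≡ {M = M} m = trans (sym (fill-erase M)) (relabelled-≡ m)

  ≡⇒same : ∀ {Δ τ} {M N : Tm Interval Δ τ} → M ≡ N → Same M N
  ≡⇒same {M = M} refl = subst (Same M) (fill-erase M) (relabelled M)

  same-sym : ∀ {Δ τ} {M N : Tm Interval Δ τ} → Same M N → Same N M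
  same-sym m = ≡⇒same (sym (same⇒≡ m))

  -- Contains what the rules expect at the evaluated positions of a redex. The case `applied` is
  -- confined to function types, where arguments are still missing and `delta` cannot fire.
  data Whnf : ∀ {τ} → Term τ → Set where
    leaf    : ∀ {𝐚} → Whnf (leaf 𝐚)
    con     : ∀ {σ} {f : Con σ} .{n : σ ≢ real} → Whnf (con f n)
    lam     : ∀ {σ τ} {M : Tm Interval (σ ∷ []) τ} → Whnf (lam M)
    ret     : ∀ {τ} {M : Term τ} → Whnf (ret M)
    pair    : ∀ {σ τ} {M : Term σ} {N : Term τ} → Whnf (pair M N)
    ι₁      : ∀ {σ τ} {M : Term σ} → Whnf (ι₁ {τ = τ} M)
    ι₂      : ∀ {σ τ} {M : Term τ} → Whnf (ι₂ {σ = σ} M)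
    applied : ∀ {σ τ} {t : Term (σ ⇒ τ)} → Applied t → Whnf t

  constant-whnf : ∀ {σ} {a : Term σ} → Constant a → Whnf a
  constant-whnf (leaf _)    = leaf
  constant-whnf (con _ _ _) = con

  whnf-not-head : ∀ {τ} {N : Term τ} → Whnf N → ¬ Head N
  whnf-not-head (applied (p · _))  (delta _ _ (basic ()))
  whnf-not-head (applied (() · _)) beta

  whnf-stuck : ∀ {ρ τ} {N : Term τ} {L : Term ρ} (E : WeakCtx ρ τ) → Same N (E ⟨ L ⟩ʷ) → Whnf N → ¬ Head L
  whnf-stuck □         m       w                 h = whnf-not-head (subst Whnf (same⇒≡ m) w) h
  whnf-stuck (E · _)   (m · _) (applied (p · _)) h = whnf-stuck E m (applied p) h
  whnf-stuck (arg _ E) (_ · m) (applied (_ · q)) h = whnf-stuck E m (constant-whnf q) h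
  whnf-stuck (score _)    (score _)    ()
  whnf-stuck (bind _ _)   (bind _ _)   ()
  whnf-stuck (case _ _ _) (case _ _ _) (applied ())
  whnf-stuck (π₁ _)       (π₁ _)       (applied ())
  whnf-stuck (π₂ _)       (π₂ _)       (applied ())

  -- The type of the hole is part of the triple, so one equation identifies hole type, context and
  -- redex, and can be matched with `refl`.
  Focus : (Ty → Ty → Set) → Ty → Set
  Focus 𝒞 τ = ∃ λ ρ → 𝒞 ρ τ × Term ρ

  -- Every position of a head that a weak context can enter holds a weak head normal form, and no
  -- head lies inside one.
  head-unique : ∀ {ρ τ} {L : Term τ} {L′ : Term ρ} → (E : WeakCtx ρ τ) → Same L (E ⟨ L′ ⟩ʷ) →
                Head L → Head L′ → _≡_ {A = Focus WeakCtx τ} (τ , □ , L) (ρ , E , L′)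
  head-unique □             m             h              h′ = cong (λ X → _ , □ , X) (same⇒≡ m)
  head-unique (score E)     (score m)     scoring        h′ = ⊥-elim (whnf-stuck E m leaf h′)
  head-unique (E · _)       (m · _)       beta           h′ = ⊥-elim (whnf-stuck E m lam h′)
  head-unique (E · _)       (m · _)       (delta p _ _)  h′ = ⊥-elim (whnf-stuck E m (applied p) h′)
  head-unique (bind E _)    (bind m _)    bind-ret       h′ = ⊥-elim (whnf-stuck E m ret h′)
  head-unique (arg () _)    (lam _ · _)   beta           h′
  head-unique (arg _ E)     (_ · m)       (delta _ q _)  h′ = ⊥-elim (whnf-stuck E m (constant-whnf q) h′)
  head-unique (case E _ _)  (case m _ _)  case-ι₁        h′ = ⊥-elim (whnf-stuck E m ι₁ h′)
  head-unique (case E _ _)  (case m _ _)  case-ι₂        h′ = ⊥-elim (whnf-stuck E m ι₂ h′)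
  head-unique (π₁ E)        (π₁ m)        π₁-pair        h′ = ⊥-elim (whnf-stuck E m pair h′)
  head-unique (π₂ E)        (π₂ m)        π₂-pair        h′ = ⊥-elim (whnf-stuck E m pair h′)

  focusʷ-unique : ∀ {ρ ρ′ τ} (E : WeakCtx ρ τ) (E′ : WeakCtx ρ′ τ) {L L′} → Head L → Head L′ →
                  Same (E ⟨ L ⟩ʷ) (E′ ⟨ L′ ⟩ʷ) → _≡_ {A = Focus WeakCtx τ} (ρ , E , L) (ρ′ , E′ , L′)
  focusʷ-unique □ E′ h h′ m = head-unique E′ m h h′
  focusʷ-unique E □  h h′ m = sym (head-unique E (same-sym m) h′ h)
  focusʷ-unique (score E) (score E′) h h′ (score m) with refl ← focusʷ-unique E E′ h h′ m = refl
  focusʷ-unique (E · _) (E′ · _) h h′ (m · n)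
    with refl ← focusʷ-unique E E′ h h′ m | refl ← same⇒≡ n = refl
  -- `arg p` requires an applied constant in function position, where no head can occur.
  focusʷ-unique (E · _) (arg p _) h h′ (m · _) = ⊥-elim (whnf-stuck E (same-sym m) (applied p) h)
  focusʷ-unique (arg p _) (E′ · _) h h′ (m · _) = ⊥-elim (whnf-stuck E′ m (applied p) h′)
  focusʷ-unique (arg p E) (arg p′ E′) h h′ (n · m)
    with refl ← focusʷ-unique E E′ h h′ m | refl ← same⇒≡ n
    with refl ← applied-irrelevant p p′ = refl
  focusʷ-unique (bind E _) (bind E′ _) h h′ (bind m n)
    with refl ← focusʷ-unique E E′ h h′ m | refl ← same⇒≡ n = refl
  focusʷ-unique (case E _ _) (case E′ _ _) h h′ (case m n p)
    with refl ← focusʷ-unique E E′ h h′ m | refl ← same⇒≡ n | refl ← same⇒≡ p = refl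
  focusʷ-unique (π₁ E) (π₁ E′) h h′ (π₁ m) with refl ← focusʷ-unique E E′ h h′ m = refl
  focusʷ-unique (π₂ E) (π₂ E′) h h′ (π₂ m) with refl ← focusʷ-unique E E′ h h′ m = refl

  value-stuck : ∀ {ρ τ} {V : Term τ} {L : Term ρ} → Value V → (E : Ctx ρ τ) → Same V (E ⟨ L ⟩) → ¬ Head L
  value-stuck (constant q) (weak E)    m          h = whnf-stuck E m (constant-whnf q) h
  value-stuck (lam _)      (weak E)    m          h = whnf-stuck E m lam h
  value-stuck (ret _)      (weak E)    m          h = whnf-stuck E m ret h
  value-stuck (pair _ _)   (weak E)    m          h = whnf-stuck E m pair h
  value-stuck (ι₁ _)       (weak E)    m          h = whnf-stuck E m ι₁ h
  value-stuck (ι₂ _)       (weak E)    m          h = whnf-stuck E m ι₂ h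
  value-stuck (partial p)  (weak E)    m          h = whnf-stuck E m (applied p) h
  value-stuck (constant (con () _ _)) (ret _)
  value-stuck (constant (con () _ _)) (pairˡ _ _)
  value-stuck (constant (con () _ _)) (pairʳ _ _)
  value-stuck (constant (con () _ _)) (ι₁ _)
  value-stuck (constant (con () _ _)) (ι₂ _)
  value-stuck (ret v)      (ret E)     (ret m)    h = value-stuck v E m h
  value-stuck (pair v _)   (pairˡ E _) (pair m _) h = value-stuck v E m h
  value-stuck (pair _ v)   (pairʳ _ E) (pair _ m) h = value-stuck v E m h
  value-stuck (ι₁ v)       (ι₁ E)      (ι₁ m)     h = value-stuck v E m h
  value-stuck (ι₂ v)       (ι₂ E)      (ι₂ m)     h = value-stuck v E m h

  focus-unique : ∀ {ρ ρ′ τ} (E : Ctx ρ τ) (E′ : Ctx ρ′ τ) {L L′} → Head L → Head L′ →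
                 Same (E ⟨ L ⟩) (E′ ⟨ L′ ⟩) → _≡_ {A = Focus Ctx τ} (ρ , E , L) (ρ′ , E′ , L′)
  focus-unique (weak E) (weak E′) h h′ m with refl ← focusʷ-unique E E′ h h′ m = refl
  focus-unique (weak E) (ret _)     h h′ m = ⊥-elim (whnf-stuck E (same-sym m) ret  h)
  focus-unique (weak E) (pairˡ _ _) h h′ m = ⊥-elim (whnf-stuck E (same-sym m) pair h)
  focus-unique (weak E) (pairʳ _ _) h h′ m = ⊥-elim (whnf-stuck E (same-sym m) pair h)
  focus-unique (weak E) (ι₁ _)      h h′ m = ⊥-elim (whnf-stuck E (same-sym m) ι₁   h)
  focus-unique (weak E) (ι₂ _)      h h′ m = ⊥-elim (whnf-stuck E (same-sym m) ι₂   h)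
  focus-unique (ret _)     (weak E) h h′ m = ⊥-elim (whnf-stuck E m ret  h′)
  focus-unique (pairˡ _ _) (weak E) h h′ m = ⊥-elim (whnf-stuck E m pair h′)
  focus-unique (pairʳ _ _) (weak E) h h′ m = ⊥-elim (whnf-stuck E m pair h′)
  focus-unique (ι₁ _)      (weak E) h h′ m = ⊥-elim (whnf-stuck E m ι₁   h′)
  focus-unique (ι₂ _)      (weak E) h h′ m = ⊥-elim (whnf-stuck E m ι₂   h′)
  focus-unique (ret E) (ret E′) h h′ (ret m) with refl ← focus-unique E E′ h h′ m = refl
  focus-unique (pairˡ E _) (pairˡ E′ _) h h′ (pair m n)
    with refl ← focus-unique E E′ h h′ m | refl ← same⇒≡ n = refl
  -- `pairʳ` requires a value on the left, which excludes a head there.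
  focus-unique (pairˡ E _) (pairʳ v _) h h′ (pair m _) = ⊥-elim (value-stuck v E (same-sym m) h)
  focus-unique (pairʳ v _) (pairˡ E _) h h′ (pair m _) = ⊥-elim (value-stuck v E m h′)
  focus-unique (pairʳ v E) (pairʳ v′ E′) h h′ (pair n m)
    with refl ← focus-unique E E′ h h′ m | refl ← same⇒≡ n
    with refl ← value-irrelevant v v′ = refl
  focus-unique (ι₁ E) (ι₁ E′) h h′ (ι₁ m) with refl ← focus-unique E E′ h h′ m = refl
  focus-unique (ι₂ E) (ι₂ E′) h h′ (ι₂ m) with refl ← focus-unique E E′ h h′ m = refl

  -- bind-ret, sampling and scoring only fire in weak contexts; elsewhere
  -- the value is irrelevant.
  contract : ∀ {ρ τ} {L : Term ρ} → Head L → Ctx ρ τ → ContinuousValuation (Scott Γ)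
  contract (unfold {M = M})               E        = successor (unfold E M)
  contract (beta {M = M} {N})             E        = successor (beta E M N)
  contract (π₁-pair {M = M} {N})          E        = successor (π₁-pair E M N)
  contract (π₂-pair {M = M} {N})          E        = successor (π₂-pair E M N)
  contract (case-ι₁ {M = M} {N} {P})      E        = successor (case-ι₁ E M N P)
  contract (case-ι₂ {M = M} {N} {P})      E        = successor (case-ι₂ E M N P)
  contract (delta p q _)                  E        = discharge E (applied-den (p · q))
  contract (bind-ret {M = M} {N})         (weak E) = successor (bind-ret E M N)
  contract (sampling {μ})                 (weak E) = successor (sampling E μ)
  contract (scoring {𝐚})                  (weak E) = successor (scoring E 𝐚)
  contract _                              _        = 𝟎

  -- Every rule contracts one head in one context, so two reductions are compared through
  -- `focus-unique` rather than by all pairs of rules.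
  data Contracts {τ} (M : Term τ) (ν : ContinuousValuation (Scott Γ)) : Set where
    contracts : ∀ {ρ} {L : Term ρ} (E : Ctx ρ τ) (h : Head L) → M ≡ E ⟨ L ⟩ →
                𝐕 (Scott Γ) ⊢ ν ≤ contract h E → 𝐕 (Scott Γ) ⊢ contract h E ≤ ν → Contracts M ν

  𝐕-refl : ∀ ν → 𝐕 (Scott Γ) ⊢ ν ≤ ν
  𝐕-refl ν U q m = m

  contracts-to : ∀ {ρ τ} {L : Term ρ} (E : Ctx ρ τ) (h : Head L) → Contracts (E ⟨ L ⟩) (contract h E)
  contracts-to E h = contracts E h refl (𝐕-refl (contract h E)) (𝐕-refl (contract h E))

  literal-irrelevant : ∀ τ v (o o′ : Observable τ v) → literal τ v o ≡ literal τ v o′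
  literal-irrelevant unit    ⊥₋         o o′ = ⊥-elim (o refl)
  literal-irrelevant unit    [ _ ]      o o′ = refl
  literal-irrelevant void    ⊥₋         o o′ = ⊥-elim (o refl)
  literal-irrelevant int     ⊥₋         o o′ = ⊥-elim (o refl)
  literal-irrelevant int     [ _ ]      o o′ = refl
  literal-irrelevant real    ⊥₋         o o′ = ⊥-elim (o refl)
  literal-irrelevant real    [ _ ]      o o′ = refl
  literal-irrelevant (σ ⊕ τ) [ inj₁ v ] o o′ = cong ι₁ (literal-irrelevant σ v o o′)
  literal-irrelevant (σ ⊕ τ) [ inj₂ v ] o o′ = cong ι₂ (literal-irrelevant τ v o o′)
  literal-irrelevant (σ ⊗ τ) (v , w) (o , p) (o′ , p′) =
    cong₂ pair (literal-irrelevant σ v o o′) (literal-irrelevant τ w p p′)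

  discharge-observable : ∀ {τ υ} (E : Ctx τ υ) v (o : Observable τ v) o? →
    𝐕 (Scott Γ) ⊢ δ (configuration (E ⟨ literal τ v o ⟩)) ≤ dischargeBy E v o? ×
    𝐕 (Scott Γ) ⊢ dischargeBy E v o? ≤ δ (configuration (E ⟨ literal τ v o ⟩))
  discharge-observable {τ} E v o (no ¬o) = ⊥-elim (¬o o)
  discharge-observable {τ} E v o (yes o′) =
    subst (λ X → 𝐕 (Scott Γ) ⊢ ν ≤ δ (configuration (E ⟨ X ⟩)) × 𝐕 (Scott Γ) ⊢ δ (configuration (E ⟨ X ⟩)) ≤ ν)
      (literal-irrelevant τ v o o′) (𝐕-refl ν , 𝐕-refl ν)
    where ν = δ (configuration (E ⟨ literal τ v o ⟩))

  discharge-unobservable : ∀ {τ υ} (E : Ctx τ υ) v → ¬ Observable τ v → ∀ o? →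
    𝐕 (Scott Γ) ⊢ dischargeBy E v o? ≤ 𝟎
  discharge-unobservable E v ¬o (yes o) = ⊥-elim (¬o o)
  discharge-unobservable E v ¬o (no _)  = 𝐕-refl 𝟎

  contraction : ∀ {τ} {M : Term τ} {ν} → M ⟶ ν → Contracts M ν
  contraction (bind-ret E M N)    = contracts-to (weak E) bind-ret
  contraction (unfold E M)        = contracts-to E unfold
  contraction (beta E M N)        = contracts-to E beta
  contraction (π₁-pair E M N)     = contracts-to E π₁-pair
  contraction (π₂-pair E M N)     = contracts-to E π₂-pair
  contraction (case-ι₁ E M N P)   = contracts-to E case-ι₁
  contraction (case-ι₂ E M N P)   = contracts-to E case-ι₂
  contraction (sampling E μ)      = contracts-to (weak E) sampling
  contraction (scoring E 𝐚)       = contracts-to (weak E) scoring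
  contraction (delta E p q ot o)  =
    let (a , b) = discharge-observable E (applied-den (p · q)) o lem in contracts E (delta p q ot) refl a b
  contraction (delta-⊥ E p q ot ¬o) = contracts E (delta p q ot) refl
    (𝟎-least (discharge E (applied-den (p · q)))) (discharge-unobservable E (applied-den (p · q)) ¬o lem)

  deterministic : ∀ {τ} {M : Term τ} {ν ν′} → M ⟶ ν → M ⟶ ν′ → 𝐕 (Scott Γ) ⊢ ν ≤ ν′
  deterministic {ν = ν} {ν′} r r′ = go (contraction r) (contraction r′)
    where
    go : ∀ {M} → Contracts M ν → Contracts M ν′ → 𝐕 (Scott Γ) ⊢ ν ≤ ν′
    go (contracts E h refl a _) (contracts E′ h′ e _ b) with refl ← focus-unique E E′ h h′ (≡⇒same e)
      with refl ← head-irrelevant h h′ =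
      Poset.trans (𝐕 (Scott Γ)) {ν} {contract h E} {ν′} a b

  -- Continuity of `Next`

  Next≤ : ∀ C {ν} → term C ⟶ ν → 𝐕 (Scott Γ) ⊢ Next C ≤ ν
  Next≤ C r with lem {∃ (term C ⟶_)}
  ... | yes (_ , r′) = deterministic r′ r
  ... | no ¬r        = ⊥-elim (¬r (_ , r))

  ≤Next : ∀ C {ν} → term C ⟶ ν → 𝐕 (Scott Γ) ⊢ ν ≤ Next C
  ≤Next C r with lem {∃ (term C ⟶_)}
  ... | yes (_ , r′) = deterministic r r′
  ... | no ¬r        = ⊥-elim (¬r (_ , r))

  Next≤𝟎 : ∀ C → ¬ ∃ (term C ⟶_) → 𝐕 (Scott Γ) ⊢ Next C ≤ 𝟎
  Next≤𝟎 C ¬r with lem {∃ (term C ⟶_)}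
  ... | yes r = ⊥-elim (¬r r)
  ... | no _  = 𝐕-refl 𝟎

  Next-continuous-on : ∀ {τ} (M : Template τ) → ScottContinuous (Labels (fv M)) (𝐕 (Scott Γ)) (Next ∘ conf M)
  Next-continuous-on M with lem {∃[ θ ] ∃ (fill M θ ⟶_)}
  ... | yes (θ , ν , r) = continuous-resp {Labels (fv M)} {𝐕 (Scott Γ)}
      (λ φ → ≤Next (conf M φ) (reduces′ φ)) (λ φ → Next≤ (conf M φ) (reduces′ φ)) (Family.continuous F)
    where
    -- `fill M id` labels each leaf by its own position, so every labelling of `M` is a relabelling
    -- of it.
    F = family (relabelled-fill {f = θ} M id) r
    reduces′ : ∀ φ → fill M φ ⟶ Family.next F φ
    reduces′ φ = subst (_⟶ Family.next F φ) (relabel-fill φ M id) (Family.reduces F φ)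
  ... | no ¬r = continuous-resp {Labels (fv M)} {𝐕 (Scott Γ)}
      (λ φ → 𝟎-least (Next (conf M φ))) (λ φ → Next≤𝟎 (conf M φ) (λ r → ¬r (φ , r)))
      (const-continuous {Labels (fv M)} {𝐕 (Scott Γ)} 𝟎)

  Next-continuous : ScottContinuous Γ (𝐕 (Scott Γ)) Next
  Next-continuous = scottContinuous {Γ} {𝐕 (Scott Γ)}
    (λ { (pointwise {M = M} p) → mono (Next-continuous-on M) p })
    (λ x d {s} l → least-on x d s l)
    where
    shape-of : ∀ {τ C} {M : Template τ} {θ} → C ≤ᶜ conf M θ → ∃[ φ ] C ≡ conf M φ
    shape-of (pointwise {θ = φ} _) = φ , refl
    least-on : ∀ {I : Set} (x : I → Configuration) → Directed Γ x → ∀ s → IsLub Γ x s →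
               ∀ ν → (∀ i → 𝐕 (Scott Γ) ⊢ Next (x i) ≤ ν) → 𝐕 (Scott Γ) ⊢ Next s ≤ ν
    least-on x d (conf M θ) l ν h =
      least (preserves (Next-continuous-on M) part-directed (part-lub l)) ν
        (λ (i , φ , e) → subst (λ C → 𝐕 (Scott Γ) ⊢ Next C ≤ ν) e (h i))
      where open Part (conf-embedding M) x d (index d , shape-of (upper l (index d)))

proposition10p9 : (lem : ExcludedMiddle 0ℓ) →
    let open Classical lem in
    (S : Signature) → StrictlyObservableFirstOrder S →
    let open Language S in
    ScottContinuous Γ (𝐕 (Scott Γ)) Next
proposition10p9 lem S sofo = Reductions.Next-continuous lem S sofo
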